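{- For an integer $k\ge 2$, every graph of order at least three having at most two vertices of degree less than $k+1$ contains $k$ admissible cycles.
   Context: All graphs are finite, undirected, without loops or multiple edges. The length of a cycle $C$ is its number of edges $|E(C)|$. A sequence of $k$ cycles $C_1,\dots,C_k$ is called admissible if $|E(C_1)|\ge 2$ and either $|E(C_{i+1})|-|E(C_i)|=1$ for all $1\le i\le k-1$, or $|E(C_{i+1})|-|E(C_i)|=2$ for all $1\le i\le k-1$. "The graph contains $k$ admissible cycles" means there exist $k$ cycles in the graph forming an admissible sequence. -}

module Defs where

open import Data.Nat using (ℕ; zero; suc; _+_; _*_; _≤_; _<_)
open import Data.Fin using (Fin; toℕ)
open import Data.Bool using (Bool; true; false)
open import Data.List using (List; length; filter; allFin)
open import Data.List.Relation.Unary.Unique.Propositional using (Unique)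
open import Data.Product using (Σ; _×_; ∃)
open import Data.Sum using (_⊎_)
open import Relation.Binary.PropositionalEquality using (_≡_)
open import Relation.Nullary using (¬_)
open import Relation.Nullary.Decidable using (⌊_⌋)
open import Data.Bool using (_≟_)

record Graph : Set where
  field
    n        : ℕ
    adj      : Fin n → Fin n → Bool
    sym      : ∀ u v → adj u v ≡ adj v u
    irrefl   : ∀ v → adj v v ≡ false

open Graph public

Adj : (G : Graph) → Fin (n G) → Fin (n G) → Set
Adj G u v = adj G u v ≡ true

degree : (G : Graph) → Fin (n G) → ℕ
degree G v = length (filter (λ u → adj G v u ≟ true) (allFin (n G)))

lowDegCount : (G : Graph) → ℕ → ℕ
lowDegCount G d = length (filter (λ v → Data.Nat._<?_ (degree G v) d) (allFin (n G)))

record Cycle (G : Graph) : Set where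
  field
    len      : ℕ
    len≥3    : 3 ≤ len
    vert     : Fin len → Fin (n G)
    injective : ∀ i j → vert i ≡ vert j → i ≡ j
    consec   : ∀ (i : Fin len) (j : Fin len) → suc (toℕ i) ≡ toℕ j → Adj G (vert i) (vert j)
    closing  : ∀ (i : Fin len) (j : Fin len) → suc (toℕ i) ≡ len → toℕ j ≡ 0 → Adj G (vert i) (vert j)

open Cycle public

edgeCount : {G : Graph} → Cycle G → ℕ
edgeCount C = len C

ContainsAdmissible : (G : Graph) → (k : ℕ) → Set
ContainsAdmissible G k =
  Σ (Fin k → Cycle G) λ C →
    (∀ (i : Fin k) → toℕ i ≡ 0 → 2 ≤ edgeCount (C i)) ×
    ( (∀ (i j : Fin k) → suc (toℕ i) ≡ toℕ j → edgeCount (C j) ≡ edgeCount (C i) + 1)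
    ⊎ (∀ (i j : Fin k) → suc (toℕ i) ≡ toℕ j → edgeCount (C j) ≡ edgeCount (C i) + 2))

{-# OPTIONS --safe #-}
-- The theorem is derived from a statement about paths. Suppose that adding the edge xy makes a graph
-- 2-connected and that all vertices except x, y and one further vertex z have degree at least k + 1.
-- Then there are k paths from x to y of length at least 2 whose lengths form an arithmetic progression
-- with difference 1 or 2. The proof is by induction on the number of vertices.
--
-- Around x one chooses a set Q such that every vertex of a set S outside Q is reached from x through Q
-- by p paths with lengths in progression, while every vertex outside Q has at most p neighbours in Q, and
-- fewer than p if it is not in S. Depending on whether x lies in a triangle, has a neighbour in a
-- triangle, or neither, Q is built from a triangle, from a maximal clique, or from a complete bipartite
-- graph. Contracting Q to x, with S as the new neighbourhood, gives a smaller instance for k - p + 1 in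
-- the component of y, and the sums of two progressions contain a progression with one term less than
-- both together. If the contracted graph is not 2-connected in the above sense, some part of it hangs at
-- a single vertex; then either this part gives a smaller instance, or it contains z and little remains.
-- Doing this at both roots leaves the case that both lie in complete bipartite graphs that cover almost
-- all neighbours of the other root, and a 4-cycle through one of the roots serves as Q there.
--
-- In the theorem, let c and z be the vertices of small degree. A connected part of the graph attached to
-- a single vertex c, chosen smallest possible, together with c and a neighbour y of c satisfies the
-- hypothesis on paths, and the edge yc closes the paths from c to y to cycles.

module Submission where

open import Defs
open import Data.Nat using (ℕ; zero; suc; _+_; _*_; _∸_; _≤_; _<_; z≤n; s≤s; s≤s⁻¹; _≤?_)
open import Data.Nat.Properties hiding (_≟_)
open import Data.Nat.Solver using (module +-*-Solver)
open import Data.Bool using (true; false)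
open import Data.Fin using (Fin; toℕ) renaming (zero to fz; suc to fs)
import Data.Fin as F
import Data.Fin.Properties as FP
open import Data.List using (length; filter; tabulate)
open import Data.Product
open import Data.Sum using (_⊎_; inj₁; inj₂)
open import Data.Empty using (⊥; ⊥-elim)
open import Data.Unit using (⊤; tt)
open import Relation.Nullary
open import Relation.Nullary.Decidable using (_×-dec_; _⊎-dec_; ¬?; decidable-stable)
open import Relation.Binary.PropositionalEquality renaming (sym to ≡-sym)

-- The vertex z is what makes the induction close. Every reduction cuts the graph along a few
-- vertices, and one of these may lose neighbours; if the part that is kept does not contain z, the
-- damaged vertex takes over the role of z. Hence parts cut off without z are easy, and the long
-- case distinctions concern parts that contain z, where explicit short paths or another choice of
-- roots must help. The contraction rests on a balance of degrees. A vertex of S loses at most p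
-- neighbours and gains the edge to the contracted root; any other vertex loses at most p - 1. So
-- the degree condition survives for k - p + 1. That a vertex has so few neighbours in Q follows
-- from the extremal choice of Q together with the absence of the triangles treated before; this
-- dictates the order of the cases. A contraction hands over prefixes in progression only to
-- vertices of S. A hanging part that misses S may still have neighbours elsewhere in Q, and the
-- larger sets Q therefore carry a second system of prefixes that leave Q through those vertices.
-- All sets are decidable, so every case distinction and every choice of a maximal object is a
-- finite search.

module InGraph (Γ : Graph) where

  -- Decidable vertex sets and their sizes

  V : Set
  V = Fin (n Γ)

  _≟_ : (u v : V) → Dec (u ≡ v)
  _≟_ = FP._≟_

  -- Membership is a decidable predicate rather than a list or a bit vector: set operations are
  -- pointwise, and a proof of membership can carry data, such as the walk that puts a vertex into a
  -- component.
  record Sub : Set₁ where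
    constructor sub
    field
      has  : V → Set
      has? : ∀ v → Dec (has v)
  open Sub public

  infix 4 _∈_ _∉_ _⊆_
  infixl 6 _∪_ _∩_ _∖_ _-_

  _∈_ _∉_ : V → Sub → Set
  v ∈ A = has A v
  v ∉ A = ¬ has A v

  _⊆_ : Sub → Sub → Set
  A ⊆ B = ∀ {v} → v ∈ A → v ∈ B

  _∪_ _∩_ _∖_ : Sub → Sub → Sub
  A ∪ B = sub (λ v → v ∈ A ⊎ v ∈ B) (λ v → has? A v ⊎-dec has? B v)
  A ∩ B = sub (λ v → v ∈ A × v ∈ B) (λ v → has? A v ×-dec has? B v)
  A ∖ B = sub (λ v → v ∈ A × v ∉ B) (λ v → has? A v ×-dec ¬? (has? B v))

  ⁅_⁆ : V → Sub
  ⁅ a ⁆ = sub (_≡ a) (_≟ a)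

  _-_ : Sub → V → Sub
  A - a = sub (λ v → v ∈ A × v ≢ a) (λ v → has? A v ×-dec ¬? (v ≟ a))

  count : ∀ {m} (P : Fin m → Set) → (∀ i → Dec (P i)) → ℕ
  count {zero}  P P? = 0
  count {suc m} P P? with P? fz
  ... | yes _ = suc (count (λ i → P (fs i)) (λ i → P? (fs i)))
  ... | no  _ = count (λ i → P (fs i)) (λ i → P? (fs i))

  count-mono : ∀ {m} {P Q : Fin m → Set} P? Q? → (∀ i → P i → Q i) → count P P? ≤ count Q Q?
  count-mono {zero} P? Q? f = z≤n
  count-mono {suc m} P? Q? f with P? fz | Q? fz
  ... | yes p | yes q = s≤s (count-mono _ _ (λ i → f (fs i)))
  ... | yes p | no ¬q = ⊥-elim (¬q (f fz p))
  ... | no _ | yes _ = m≤n⇒m≤1+n (count-mono _ _ (λ i → f (fs i)))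
  ... | no _ | no _ = count-mono _ _ (λ i → f (fs i))

  count-< : ∀ {m} {P Q : Fin m → Set} P? Q? → (∀ i → P i → Q i) → ∀ j → Q j → ¬ P j → count P P? < count Q Q?
  count-< {suc m} P? Q? f j qj ¬pj with P? fz | Q? fz
  count-< {suc m} P? Q? f j qj ¬pj | yes p | no ¬q = ⊥-elim (¬q (f fz p))
  count-< {suc m} P? Q? f j qj ¬pj | no _ | yes _ = s≤s (count-mono _ _ (λ i → f (fs i)))
  count-< {suc m} P? Q? f fz qj ¬pj | yes p | yes q = ⊥-elim (¬pj p)
  count-< {suc m} P? Q? f (fs j) qj ¬pj | yes p | yes q = s≤s (count-< _ _ (λ i → f (fs i)) j qj ¬pj)
  count-< {suc m} P? Q? f fz qj ¬pj | no p | no q = ⊥-elim (q qj)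
  count-< {suc m} P? Q? f (fs j) qj ¬pj | no p | no q = count-< _ _ (λ i → f (fs i)) j qj ¬pj

  count-∪ : ∀ {m} {P Q R : Fin m → Set} P? Q? R? → (∀ i → R i → P i ⊎ Q i) →
            count R R? ≤ count P P? + count Q Q?
  count-∪ {zero} P? Q? R? f = z≤n
  count-∪ {suc m} P? Q? R? f with P? fz | Q? fz | R? fz
  ... | no ¬p | no ¬q | yes r = ⊥-elim (Data.Sum.[ ¬p , ¬q ] (f fz r))
  ... | yes _ | yes _ | yes _ = s≤s (≤-trans (count-∪ _ _ _ (λ i → f (fs i))) (+-monoʳ-≤ _ (n≤1+n _)))
  ... | yes _ | no _  | yes _ = s≤s (count-∪ _ _ _ (λ i → f (fs i)))
  ... | no _  | yes _ | yes _ = ≤-trans (s≤s (count-∪ _ _ _ (λ i → f (fs i)))) (≤-reflexive (≡-sym (+-suc _ _)))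
  ... | yes _ | yes _ | no _ = ≤-trans (count-∪ _ _ _ (λ i → f (fs i))) (+-mono-≤ (n≤1+n _) (n≤1+n _))
  ... | yes _ | no _  | no _ = ≤-trans (count-∪ _ _ _ (λ i → f (fs i))) (n≤1+n _)
  ... | no _  | yes _ | no _ = ≤-trans (count-∪ _ _ _ (λ i → f (fs i))) (+-monoʳ-≤ _ (n≤1+n _))
  ... | no _  | no _  | no _ = count-∪ _ _ _ (λ i → f (fs i))

  count-none : ∀ {m} {P : Fin m → Set} P? → (∀ i → ¬ P i) → count P P? ≡ 0
  count-none {zero} P? f = refl
  count-none {suc m} P? f with P? fz
  ... | yes p = ⊥-elim (f fz p)
  ... | no _ = count-none _ (λ i → f (fs i))

  count-one : ∀ {m} {P : Fin m → Set} P? → (∀ i j → P i → P j → i ≡ j) → count P P? ≤ 1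
  count-one {zero} P? f = z≤n
  count-one {suc m} P? f with P? fz
  ... | yes p = s≤s (≤-reflexive (count-none _ (λ i q → FP.0≢1+n (f fz (fs i) p q))))
  ... | no _ = count-one _ (λ i j p q → FP.suc-injective (f (fs i) (fs j) p q))

  opaque
    -- Opaque, so that type checking never unfolds a count over all vertices; outside this block
    -- only the estimates proved here are used.
    # : Sub → ℕ
    # A = count (has A) (has? A)

    #-unfold : ∀ A → # A ≡ count (has A) (has? A)
    #-unfold A = refl

    #-mono : ∀ {A B} → A ⊆ B → # A ≤ # B
    #-mono {A} {B} f = count-mono (has? A) (has? B) (λ i → f {i})

    #-< : ∀ {A B v} → A ⊆ B → v ∈ B → v ∉ A → # A < # B
    #-< {A} {B} f b a = count-< (has? A) (has? B) (λ i → f {i}) _ b a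

    #-∪ : ∀ {A B C} → (∀ {v} → v ∈ C → v ∈ A ⊎ v ∈ B) → # C ≤ # A + # B
    #-∪ {A} {B} {C} f = count-∪ (has? A) (has? B) (has? C) (λ i → f {i})

    #-one : ∀ {A} a → (∀ {v} → v ∈ A → v ≡ a) → # A ≤ 1
    #-one {A} a f = count-one (has? A) (λ i j p q → trans (f p) (≡-sym (f q)))

    #-zero : ∀ {A} → (∀ {v} → v ∉ A) → # A ≡ 0
    #-zero {A} f = count-none (has? A) (λ i → f)

  #-two : ∀ {A} a b → (∀ {v} → v ∈ A → v ≡ a ⊎ v ≡ b) → # A ≤ 2
  #-two {A} a b f = ≤-trans (#-∪ {⁅ a ⁆} {⁅ b ⁆} f)
    (+-mono-≤ (#-one {⁅ a ⁆} a (λ p → p)) (#-one {⁅ b ⁆} b (λ p → p)))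

  ∃? : ∀ {P : V → Set} → (∀ v → Dec (P v)) → Dec (∃ P)
  ∃? = FP.any?

  abstract
    #-> : ∀ {A B} → # B < # A → ∃ λ v → v ∈ A × v ∉ B
    #-> {A} {B} lt with ∃? (has? (A ∖ B))
    ... | yes r = r
    ... | no ¬r = ⊥-elim (<⇒≱ lt (#-mono λ {v} a → dec-in v a))
      where
      dec-in : ∀ v → v ∈ A → v ∈ B
      dec-in v a with has? B v
      ... | yes b = b
      ... | no ¬b = ⊥-elim (¬r (v , a , ¬b))

    #-elem : ∀ {A} → 0 < # A → ∃ λ v → v ∈ A
    #-elem {A} lt with #-> {A} {sub (λ _ → ⊥) (λ _ → no λ ())} (≤-trans (s≤s (≤-reflexive (#-zero (λ ())))) lt)
    ... | v , a , _ = v , a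

    #-pos : ∀ {A v} → v ∈ A → 0 < # A
    #-pos {A} {v} a = ≤-trans (s≤s z≤n) (#-< {sub (λ _ → ⊥) (λ _ → no λ ())} {A} (λ ()) a (λ ()))

    #-elem≢ : ∀ {A} a → 2 ≤ # A → ∃ λ v → v ∈ A × v ≢ a
    #-elem≢ {A} a le with #-> {A} {⁅ a ⁆} (≤-trans (s≤s (#-one {⁅ a ⁆} a (λ p → p))) le)
    ... | v , p , q = v , p , q

    #-remove : ∀ {A} a → # A ≤ suc (# (A - a))
    #-remove {A} a = ≤-trans (#-∪ {⁅ a ⁆} {A - a} λ {v} p → dec v p) (+-monoˡ-≤ _ (#-one {⁅ a ⁆} a (λ p → p)))
      where
      dec : ∀ v → v ∈ A → v ≡ a ⊎ (v ∈ A × v ≢ a)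
      dec v p with v ≟ a
      ... | yes e = inj₁ e
      ... | no ne = inj₂ (p , ne)

  -- Paths and walks

  record Rel : Set₁ where
    field
      e     : V → V → Set
      e?    : ∀ u v → Dec (e u v)
      e-sym : ∀ {u v} → e u v → e v u
      e-irr : ∀ {v} → ¬ e v v

    e-≢ : ∀ {u v} → e u v → u ≢ v
    e-≢ a refl = e-irr a

    nb : V → Sub
    nb v = sub (e v) (e? v)
  open Rel public

  -- A path is simple because each step deletes the vertex it leaves from the ambient set.
  data Path (E : V → V → Set) (A : V → Set) (u v : V) : ℕ → Set where
    nil  : u ≡ v → A u → Path E A u v 0
    cons : ∀ {w m} → A u → E u w → Path E (λ t → A t × t ≢ u) w v m → Path E A u v (suc m)

  data Walk (E : V → V → Set) (A : V → Set) (u v : V) : Set where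
    here : u ≡ v → A u → Walk E A u v
    step : ∀ {w} → A u → E u w → Walk E A w v → Walk E A u v

  SomePath : (E : V → V → Set) (A : V → Set) (u v : V) → Set
  SomePath E A u v = ∃ λ m → Path E A u v m

  module _ {E : V → V → Set} where

    path-map : ∀ {E' : V → V → Set} {A B : V → Set} {u v m} → (∀ {s t} → A s → A t → E s t → E' s t) →
               (∀ {t} → A t → B t) → Path E A u v m → Path E' B u v m
    path-start : ∀ {A u v m} → Path E A u v m → A u
    path-start (nil _ a) = a
    path-start (cons a _ _) = a
    path-map f g (nil e a) = nil e (g a)
    path-map f g (cons a e p) = cons (g a) (f a (proj₁ (path-start p)) e)
      (path-map (λ s t → f (proj₁ s) (proj₁ t)) (λ (t , ne) → g t , ne) p)

    path-mono : ∀ {A B : V → Set} {u v m} → (∀ {t} → A t → B t) → Path E A u v m → Path E B u v m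
    path-mono = path-map (λ _ _ x → x)

    path-end : ∀ {A u v m} → Path E A u v m → A v
    path-end (nil refl a) = a
    path-end (cons _ _ p) = proj₁ (path-end p)

    -- Simplicity of the concatenation is read off the ambient sets, which may share only the
    -- junction v. This is why paths are indexed by the set in which they live.
    path-append : ∀ {A B : V → Set} {u v w m k} → Path E A u v m → Path E B v w k →
                  (∀ {t} → A t → B t → t ≡ v) → Path E (λ t → A t ⊎ B t) u w (m + k)
    path-append (nil refl a) q d = path-mono inj₂ q
    path-append {A} {B} {u} (cons a e p) q d =
      cons (inj₁ a) e (path-mono f (path-append p q (λ (x , _) y → d x y)))
      where
      f : ∀ {t} → (A t × t ≢ u) ⊎ B t → (A t ⊎ B t) × t ≢ u
      f (inj₁ (x , ne)) = inj₁ x , ne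
      f (inj₂ b) = inj₂ b , λ { refl → proj₂ (path-end p) (≡-sym (d a b)) }

    walk-start : ∀ {A u v} → Walk E A u v → A u
    walk-start (here _ a) = a
    walk-start (step a _ _) = a

    walk-end : ∀ {A u v} → Walk E A u v → A v
    walk-end (here refl a) = a
    walk-end (step _ _ w) = walk-end w

    walk-trans : ∀ {A u v w} → Walk E A u v → Walk E A v w → Walk E A u w
    walk-trans (here refl _) q = q
    walk-trans (step a e p) q = step a e (walk-trans p q)

    walk-mono : ∀ {A B : V → Set} {u v} → (∀ {t} → A t → B t) → Walk E A u v → Walk E B u v
    walk-mono f (here e a) = here e (f a)
    walk-mono f (step a e w) = step (f a) e (walk-mono f w)

    walk-edge : ∀ {A : V → Set} {u v} → A u → A v → E u v → Walk E A u v
    walk-edge a b e = step a e (here refl b)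

    path-walk : ∀ {A u v m} → Path E A u v m → Walk E A u v
    path-walk (nil e a) = here e a
    path-walk (cons a e p) = step a e (walk-mono proj₁ (path-walk p))

    -- One step of loop erasure: if the path from w passes through u, its tail from u is kept;
    -- otherwise it avoids u, and the edge from u to w can be put in front.
    from : ∀ {A u w v m} → Path E A w v m → A u → SomePath E A u v ⊎ Path E (λ t → A t × t ≢ u) w v m
    from {A} {u} {w} (nil refl a) au with u ≟ w
    ... | yes refl = inj₁ (0 , nil refl a)
    ... | no ne = inj₂ (nil refl (a , λ e → ne (≡-sym e)))
    from {A} {u} {w} (cons a e p) au with u ≟ w
    ... | yes refl = inj₁ (_ , cons a e p)
    ... | no ne with from p (au , ne)
    ... | inj₁ (_ , q) = inj₁ (_ , path-mono proj₁ q)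
    ... | inj₂ q = inj₂ (cons (a , λ e → ne (≡-sym e)) e
                     (path-mono (λ ((x , n1) , n2) → (x , n2) , n1) q))

    walk-path : ∀ {A u v} → Walk E A u v → SomePath E A u v
    walk-path (here e a) = 0 , nil e a
    walk-path (step a e w) with walk-path w
    ... | m , p with from p a
    ... | inj₁ q = q
    ... | inj₂ q = suc m , cons a e q

    -- The path is stopped at its first vertex r in T; the condition added to the ambient set
    -- records that T is not met earlier.
    path-until : ∀ {A u v m} (T : Sub) → Path E A u v m → v ∈ T →
                 ∃ λ r → r ∈ T × SomePath E (λ t → A t × (t ∈ T → t ≡ r)) u r
    path-until {u = u} T p tv with has? T u
    ... | yes tu = u , tu , 0 , nil refl (path-start p , λ _ → refl)
    path-until T (nil refl a) tv | no ¬tu = ⊥-elim (¬tu tv)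
    path-until {u = u} T (cons a e p) tv | no ¬tu with path-until T p tv
    ... | r , tr , m , q = r , tr , suc m , cons (a , λ tu → ⊥-elim (¬tu tu)) e
          (path-mono (λ ((x , ne) , f) → (x , f) , ne) q)

    -- The ambient set may be larger than the path. `On` gives the exact vertex set, needed wherever
    -- two paths are compared.
    On : ∀ {A u v m} → V → Path E A u v m → Set
    On {u = u} t (nil _ _) = t ≡ u
    On {u = u} t (cons _ _ p) = t ≡ u ⊎ On t p

    on? : ∀ t {A u v m} (p : Path E A u v m) → Dec (On t p)
    on? t {u = u} (nil _ _) = t ≟ u
    on? t {u = u} (cons _ _ p) = (t ≟ u) ⊎-dec on? t p

    on-start : ∀ {A u v m} (p : Path E A u v m) → On u p
    on-start (nil _ _) = refl
    on-start (cons _ _ _) = inj₁ refl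

    on-in : ∀ {t A u v m} (p : Path E A u v m) → On t p → A t
    on-in (nil _ a) refl = a
    on-in (cons a _ _) (inj₁ refl) = a
    on-in (cons _ _ p) (inj₂ o) = proj₁ (on-in p o)

    on-end : ∀ {A u v m} (p : Path E A u v m) → On v p
    on-end (nil refl _) = refl
    on-end (cons _ _ p) = inj₂ (on-end p)

    path-tight : ∀ {A u v m} (p : Path E A u v m) → Path E (λ t → On t p) u v m
    path-tight (nil refl a) = nil refl refl
    path-tight (cons a e p) = cons (inj₁ refl) e
      (path-mono (λ o → inj₂ o , λ { refl → proj₂ (on-in p o) refl }) (path-tight p))

    -- The halves come with ambient sets that meet only in t, so that each half can be recombined
    -- with other paths by `path-append`.
    path-split : ∀ {A u v m t} (p : Path E A u v m) → On t p →
      Σ (V → Set) λ A₁ → Σ (V → Set) λ A₂ → SomePath E A₁ u t × SomePath E A₂ t v ×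
      (∀ {s} → A₁ s → On s p) × (∀ {s} → A₂ s → On s p) × (∀ {s} → A₁ s → A₂ s → s ≡ t)
    path-split p@(nil refl a) refl = _ , _ , (0 , path-tight p) , (0 , path-tight p) , (λ o → o) , (λ o → o) , (λ o _ → o)
    path-split {u = u} p@(cons a e q) (inj₁ refl) =
      (_≡ u) , (λ s → On s p) , (0 , nil refl refl) , (_ , path-tight p) , inj₁ , (λ o → o) , (λ o _ → o)
    path-split {u = u} (cons a e p) (inj₂ o) with path-split p o
    ... | A₁ , A₂ , (m₁ , p₁) , q₂ , f , g , h =
      (λ s → s ≡ u ⊎ A₁ s) , A₂ ,
      (suc m₁ , cons (inj₁ refl) e (path-mono (λ x → inj₂ x , λ { refl → proj₂ (on-in p (f x)) refl }) p₁)) , q₂ ,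
      (λ { (inj₁ e) → inj₁ e ; (inj₂ x) → inj₂ (f x) }) ,
      (λ x → inj₂ (g x)) ,
      (λ { (inj₁ refl) y → ⊥-elim (proj₂ (on-in p (g y)) refl) ; (inj₂ x) y → h x y })

  module _ (E : Rel) where

    path-edge : ∀ {A : V → Set} {u v} → A u → A v → e E u v → Path (e E) A u v 1
    path-edge {A} {u} {v} a b x = cons {w = v} a x (nil refl (b , λ q → e-≢ E x (≡-sym q)))

    path-reverse : ∀ {A u v m} → Path (e E) A u v m → Path (e E) A v u m
    path-reverse (nil refl a) = nil refl a
    path-reverse {A} {u} {v} (cons {w} {m} a x p) =
      subst (Path (e E) A v u) (+-comm m 1)
        (path-mono (λ { (inj₁ (t , _)) → t ; (inj₂ (inj₁ refl)) → proj₁ (path-start p) ; (inj₂ (inj₂ refl)) → a })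
          (path-append (path-reverse p)
            (path-edge {A = λ t → t ≡ w ⊎ t ≡ u} (inj₁ refl) (inj₂ refl) (e-sym E x))
            (λ { _ (inj₁ e) → e ; (_ , ne) (inj₂ e) → ⊥-elim (ne e) })))

    walk-sym : ∀ {A u v} → Walk (e E) A u v → Walk (e E) A v u
    walk-sym (here refl a) = here refl a
    walk-sym {A} (step a x w) = walk-trans (walk-sym w) (walk-edge {A = A} (walk-start w) a (e-sym E x))

    path? : ∀ (A : V → Set) → (∀ v → Dec (A v)) → ∀ u v m → Dec (Path (e E) A u v m)
    path? A A? u v zero with u ≟ v | A? u
    ... | yes refl | yes a = yes (nil refl a)
    ... | no ne | _ = no λ { (nil e _) → ne e }
    ... | _ | no na = no λ { (nil _ a) → na a }
    path? A A? u v (suc m) with A? u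
    ... | no na = no λ { (cons a _ _) → na a }
    ... | yes a with ∃? (λ w → e? E u w ×-dec path? (λ t → A t × t ≢ u) (λ t → A? t ×-dec ¬? (t ≟ u)) w v m)
    ... | yes (w , x , p) = yes (cons a x p)
    ... | no no' = no λ { (cons _ x p) → no' (_ , x , p) }

    path-bound : ∀ (A : Sub) {u v m} → Path (e E) (has A) u v m → m < # A
    path-bound A (nil _ a) = #-pos a
    path-bound A {u} (cons a _ p) = ≤-trans (s≤s (path-bound (A - u) p)) (#-< {A - u} {A} proj₁ a (λ q → proj₂ q refl))

    -- A walk can be shortened to a path, and a path in A has fewer than `# A` edges, so finitely
    -- many lengths are to be tested.
    walk? : ∀ (A : Sub) u v → Dec (Walk (e E) (has A) u v)
    walk? A u v with FP.any? {n = # A} (λ i → path? (has A) (has? A) u v (F.toℕ i))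
    ... | yes (i , p) = yes (path-walk p)
    ... | no ¬p = no λ w → let (m , p) = walk-path w in
        ¬p (F.fromℕ< (path-bound A p) , subst (Path _ _ _ _) (≡-sym (FP.toℕ-fromℕ< (path-bound A p))) p)

    comp : Sub → V → Sub
    comp A u = sub (Walk (e E) (has A) u) (walk? A u)

    comp-closed : ∀ {A u v w} → v ∈ comp A u → w ∈ A → e E v w → w ∈ comp A u
    comp-closed {A} c a x = walk-trans c (walk-edge {A = has A} (walk-end c) a x)

    comp-conn : ∀ {A u v} → v ∈ comp A u → Walk (e E) (has (comp A u)) u v
    comp-conn {A} {u} c = go (here refl (walk-start c)) c
      where
      go : ∀ {a v} → Walk (e E) (has A) u a → Walk (e E) (has A) a v → Walk (e E) (has (comp A u)) a v
      go pre (here refl a) = here refl pre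
      go pre (step a x w) = step pre x (go (comp-closed {A} pre (walk-start w) x) w)

    walk-stays : ∀ {A : V → Set} {K : V → Set} {u v} → (∀ {s t} → K s → A s → A t → e E s t → K t) →
                 K u → Walk (e E) A u v → K v
    walk-stays f k (here refl _) = k
    walk-stays f k (step a x w) = walk-stays f (f k a (walk-start w) x) w

  -- Graphs with two roots

  -- Rooted E U x y says that adding the edge xy to the graph makes it 2-connected.
  Rooted : Rel → Sub → V → V → Set
  Rooted E U x y = ∀ w v → v ∈ U → v ≢ w → Walk (e E) (has (U - w)) v x ⊎ Walk (e E) (has (U - w)) v y

  -- The obstruction to `Rooted`: a nonempty part that w separates from both roots. Since w may lie
  -- outside U, a component without a root is covered as well.
  record Piece (E : Rel) (U : Sub) (x y : V) : Set₁ where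
    field
      w       : V
      K       : Sub
      K⊆U     : K ⊆ U
      some    : ∃ λ v → v ∈ K
      x∉K     : x ∉ K
      y∉K     : y ∉ K
      w∉K     : w ∉ K
      closed  : ∀ {a b} → a ∈ K → b ∈ U → e E a b → b ∈ K ⊎ b ≡ w

  ∈≢ : ∀ {A : Sub} {v r} → v ∈ A → r ∉ A → v ≢ r
  ∈≢ a b refl = b a

  abstract
   rooted? : ∀ E U x y → Rooted E U x y ⊎ Piece E U x y
   rooted? E U x y with ∃? (λ w → ∃? (λ v → has? U v ×-dec (¬? (v ≟ w) ×-dec
                           (¬? (walk? E (U - w) v x) ×-dec ¬? (walk? E (U - w) v y)))))
   ... | no ¬bad = inj₁ good
     where
     good : Rooted E U x y
     good w v v∈ v≢ with walk? E (U - w) v x | walk? E (U - w) v y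
     ... | yes p | _ = inj₁ p
     ... | no _ | yes p = inj₂ p
     ... | no ¬p | no ¬q = ⊥-elim (¬bad (w , v , v∈ , v≢ , ¬p , ¬q))
   ... | yes (w , v , v∈ , v≢ , ¬p , ¬q) = inj₂ record
     { w = w ; K = comp E (U - w) v
     ; K⊆U = λ c → proj₁ (walk-end c)
     ; some = v , here refl (v∈ , v≢)
     ; x∉K = ¬p ; y∉K = ¬q
     ; w∉K = λ c → proj₂ (walk-end c) refl
     ; closed = cl }
     where
     cl : ∀ {a b} → a ∈ comp E (U - w) v → b ∈ U → e E a b → b ∈ comp E (U - w) v ⊎ b ≡ w
     cl {a} {b} c bU x with b ≟ w
     ... | yes q = inj₂ q
     ... | no ne = inj₁ (comp-closed E {U - w} c (bU , ne) x)

  record Adm (E : V → V → Set) (A : V → Set) (k : ℕ) (x y : V) : Set where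
    constructor adm
    field
      base  : ℕ
      diff  : ℕ
      base≥ : 2 ≤ base
      diff≡ : diff ≡ 1 ⊎ diff ≡ 2
      paths : ∀ i → i < k → Path E A x y (base + i * diff)

  adm-mono : ∀ {E A B k x y} → (∀ {t} → A t → B t) → Adm E A k x y → Adm E B k x y
  adm-mono f (adm b d b≥ d≡ p) = adm b d b≥ d≡ (λ i l → path-mono f (p i l))

  adm-reverse : ∀ (E : Rel) {A k x y} → Adm (e E) A k x y → Adm (e E) A k y x
  adm-reverse E (adm b d b≥ d≡ p) = adm b d b≥ d≡ (λ i l → path-reverse E (p i l))

  -- z may lie outside U or coincide with a root, so instances without an exceptional vertex have
  -- the same form. `inner` provides a vertex subject to the degree bound; if U were only the two
  -- roots, the conclusion would fail.
  record Inst (k : ℕ) : Set₁ where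
    field
      E      : Rel
      U      : Sub
      x y z  : V
      x∈U    : x ∈ U
      y∈U    : y ∈ U
      x≢y    : x ≢ y
      rooted : Rooted E U x y
      deg    : ∀ {v} → v ∈ U → v ≢ x → v ≢ y → v ≢ z → suc k ≤ # (nb E v ∩ U)
      inner  : ∃ λ v → v ∈ U × v ≢ x × v ≢ y × v ≢ z

  AdmInst : ∀ {k} → Inst k → Set
  AdmInst {k} I = Adm (e (Inst.E I)) (has (Inst.U I)) k (Inst.x I) (Inst.y I)

  -- k is quantified inside, because a contraction lowers it together with the number of vertices.
  Smaller : ℕ → Set₁
  Smaller s = ∀ {k} → 1 ≤ k → (I : Inst k) → # (Inst.U I) < s → AdmInst I

  swapInst : ∀ {k} → Inst k → Inst k
  swapInst I = record
    { E = E ; U = U ; x = y ; y = x ; z = z ; x∈U = y∈U ; y∈U = x∈U ; x≢y = λ q → x≢y (≡-sym q)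
    ; rooted = λ w v a b → Data.Sum.swap (rooted w v a b)
    ; deg = λ a b c → deg a c b
    ; inner = let (v , a , b , c , d) = inner in v , a , c , b , d }
    where open Inst I

  module Basic {k : ℕ} (I : Inst k) where
    open Inst I

    Done : Set
    Done = AdmInst I

    -- All attachments of P, that is, its neighbours in U outside P, lie in X.
    Nb : Sub → Sub → Set
    Nb P X = ∀ {a b} → a ∈ P → b ∈ U → e E a b → b ∈ P ⊎ b ∈ X

    -- After the deletion of w a vertex of P still reaches a root, which is outside P; the first
    -- vertex outside P on the walk is an attachment other than w.
    exit : ∀ P X → x ∉ P → y ∉ P → Nb P X → ∀ w {v} → v ∈ P → v ∈ U → v ≢ w →
           ∃ λ r → r ∈ X × r ∈ U × r ≢ w × r ∉ P × Walk (e E) (λ t → (t ∈ P ⊎ t ≡ r) × t ≢ w) v r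
    exit P X x∉ y∉ nbP w {v} vP vU v≢ = Data.Sum.[ go x∉ vP , go y∉ vP ] (rooted w v vU v≢)
      where
      go : ∀ {a r} → r ∉ P → a ∈ P → Walk (e E) (has (U - w)) a r →
           ∃ λ r → r ∈ X × r ∈ U × r ≢ w × r ∉ P × Walk (e E) (λ t → (t ∈ P ⊎ t ≡ r) × t ≢ w) a r
      go r∉ aP (here refl _) = ⊥-elim (r∉ aP)
      go r∉ aP (step {w = b} aU ab wk) with has? P b
      ... | yes bP = let (r , f1 , f2 , f3 , f4 , q) = go r∉ bP wk in
                     r , f1 , f2 , f3 , f4 , step (inj₁ aP , proj₂ aU) ab q
      ... | no ¬bP with walk-start wk
      ... | bU , b≢ with nbP aP bU ab
      ... | inj₁ bP = ⊥-elim (¬bP bP)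
      ... | inj₂ bX = b , bX , bU , b≢ , ¬bP , step (inj₁ aP , proj₂ aU) ab (here refl (inj₂ refl , b≢))

    -- An inner vertex reaches x when y is deleted, and y when x is deleted.
    reach-xy : Walk (e E) (has U) y x
    reach-xy = walk-trans (walk-sym E to-y) to-x
      where
      v : V
      v = proj₁ inner
      vU : v ∈ U
      vU = proj₁ (proj₂ inner)
      to-x : Walk (e E) (has U) v x
      to-x with rooted y v vU (proj₁ (proj₂ (proj₂ (proj₂ inner))))
      ... | inj₁ q = walk-mono proj₁ q
      ... | inj₂ q = ⊥-elim (proj₂ (walk-end q) refl)
      to-y : Walk (e E) (has U) v y
      to-y with rooted x v vU (proj₁ (proj₂ (proj₂ inner)))
      ... | inj₁ q = ⊥-elim (proj₂ (walk-end q) refl)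
      ... | inj₂ q = walk-mono proj₁ q

    reach-x : ∀ {v} → v ∈ U → Walk (e E) (has U) v x
    reach-x {v} vU with v ≟ y
    ... | yes refl = reach-xy
    ... | no ne with rooted y v vU ne
    ... | inj₁ q = walk-mono proj₁ q
    ... | inj₂ q = ⊥-elim (proj₂ (walk-end q) refl)

    -- A fan of two paths as in Menger's theorem. `meet` speaks of the vertices on the paths, not of
    -- the ambient sets, so that `on?` can decide how to reroute.
    record Fan (a b v : V) : Set₁ where
      field
        {A B} : V → Set
        {m l} : ℕ
        p     : Path (e E) A a v m
        q     : Path (e E) B b v l
        A⊆U   : ∀ {t} → A t → t ∈ U
        B⊆U   : ∀ {t} → B t → t ∈ U
        meet  : ∀ {t} → On t p → On t q → t ≡ v

    mkFan : ∀ {a b v} {A B : V → Set} → (∀ {t} → A t → t ∈ U) → (∀ {t} → B t → t ∈ U) →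
            SomePath (e E) A a v → SomePath (e E) B b v → (∀ {t} → A t → B t → t ≡ v) → Fan a b v
    mkFan f g (_ , p) (_ , q) d = record
      { p = p ; q = q ; A⊆U = f ; B⊆U = g ; meet = λ o o' → d (on-in p o) (on-in q o') }

    fan-swap : ∀ {a b v} → Fan a b v → Fan b a v
    fan-swap F = record { p = q ; q = p ; A⊆U = B⊆U ; B⊆U = A⊆U ; meet = λ o o' → meet o' o }
      where open Fan F

    -- The path from a stops at v', while the path from b runs to v and then backwards along the
    -- remainder of the other path.
    fan-on : ∀ {a b v v'} (F : Fan a b v) → On v' (Fan.p F) → Fan a b v'
    fan-on {a} {b} {v} {v'} F o with path-split (Fan.p F) o
    ... | A₁ , A₂ , p₁ , (_ , p₂) , f , g , h =
      mkFan (λ x → A⊆U (on-in p (f x)))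
            (λ { (inj₁ x) → B⊆U (on-in q x) ; (inj₂ x) → A⊆U (on-in p (g x)) })
            p₁ (_ , path-append (path-tight q) (path-reverse E p₂) (λ x y → meet (g y) x))
            (λ { x (inj₁ y) → back x (meet (f x) y) ; x (inj₂ y) → h x y })
      where
      open Fan F
      back : ∀ {t} → A₁ t → t ≡ v → t ≡ v'
      back x refl = h x (path-end p₂)

    -- A detour from v' that avoids v meets the fan first at r. The path from a turns off at r and
    -- follows the detour to v'; the path from b is prolonged by the edge from v to v'.
    fan-jump : ∀ {a b v v' r} (F : Fan a b v) → v' ∈ U → e E v v' → ¬ On v' (Fan.p F) → ¬ On v' (Fan.q F) →
               On r (Fan.p F) → SomePath (e E) (λ t → (t ∈ U × t ≢ v) × (On t (Fan.p F) ⊎ On t (Fan.q F) → t ≡ r)) v' r →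
               Fan a b v'
    fan-jump {a} {b} {v} {v'} {r} F v'U vv' ¬p ¬q o (_ , c) with path-split (Fan.p F) o
    ... | A₁ , A₂ , (_ , p₁) , (_ , p₂) , f , g , h =
      mkFan {A = λ t → A₁ t ⊎ ((t ∈ U × t ≢ v) × (On t p ⊎ On t q → t ≡ r))} {B = λ t → On t q ⊎ (t ≡ v ⊎ t ≡ v')}
            (λ { (inj₁ x) → A⊆U (on-in p (f x)) ; (inj₂ x) → proj₁ (proj₁ x) })
            (λ { (inj₁ x) → B⊆U (on-in q x) ; (inj₂ (inj₁ refl)) → B⊆U (path-end q) ; (inj₂ (inj₂ refl)) → v'U })
            (_ , path-append p₁ (path-reverse E c) (λ x y → proj₂ y (inj₁ (f x))))
            (_ , path-append (path-tight q) (path-edge E {A = λ t → t ≡ v ⊎ t ≡ v'} (inj₁ refl) (inj₂ refl) vv')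
                   (λ { x (inj₁ w) → w ; x (inj₂ refl) → ⊥-elim (¬q x) }))
            (λ { (inj₁ x) (inj₁ y) → ⊥-elim (notA₁ x (meet (f x) y))
               ; (inj₁ x) (inj₂ (inj₁ y)) → ⊥-elim (notA₁ x y)
               ; (inj₁ x) (inj₂ (inj₂ refl)) → refl
               ; (inj₂ x) (inj₁ y) → ⊥-elim (notq x y)
               ; (inj₂ x) (inj₂ (inj₁ y)) → ⊥-elim (proj₂ (proj₁ x) y)
               ; (inj₂ x) (inj₂ (inj₂ refl)) → refl })
      where
      open Fan F
      r≢v : r ≢ v
      r≢v = proj₂ (proj₁ (path-end c))
      notA₁ : ∀ {t} → A₁ t → t ≢ v
      notA₁ x refl = r≢v (≡-sym (h x (path-end p₂)))
      notq : ∀ {t} → (t ∈ U × t ≢ v) × (On t p ⊎ On t q → t ≡ r) → ¬ On t q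
      notq (( _ , ne) , i) y with i (inj₂ y)
      ... | refl = ne (meet o y)

    fan-step : ∀ {v v'} → v' ∈ U → e E v v' → Fan x y v → Fan x y v'
    fan-step {v} {v'} v'U vv' F with on? v' (Fan.p F) | on? v' (Fan.q F)
    ... | yes o | _ = fan-on F o
    ... | no _ | yes o = fan-swap (fan-on (fan-swap F) o)
    ... | no ¬p | no ¬q = Data.Sum.[ (λ w → hit w (inj₁ (on-start p))) , (λ w → hit w (inj₂ (on-start q))) ]′
                            (rooted v v' v'U (λ r → e-≢ E vv' (≡-sym r)))
      where
      open Fan F
      T : Sub
      T = sub (λ t → On t p ⊎ On t q) (λ t → on? t p ⊎-dec on? t q)
      hit : ∀ {r} → Walk (e E) (has (U - v)) v' r → r ∈ T → Fan x y v'
      hit w h with path-until T (proj₂ (walk-path w)) h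
      ... | r , inj₁ o , c = fan-jump F v'U vv' ¬p ¬q o c
      ... | r , inj₂ o , (m , c) = fan-swap (fan-jump (fan-swap F) v'U vv' ¬q ¬p o
              (m , path-mono (λ (x , f) → x , λ { (inj₁ a) → f (inj₂ a) ; (inj₂ a) → f (inj₁ a) }) c))

    -- The fan at x is pushed along a walk, one edge at a time; Rooted supplies the detour around the vertex being left.
    fan : ∀ {v} → v ∈ U → Fan x y v
    fan {v} vU = go (walk-sym E (reach-x vU)) start
      where
      start : Fan x y x
      start = mkFan {A = _≡ x} {B = has U} (λ { refl → x∈U }) (λ a → a) (0 , nil refl refl) (walk-path reach-xy) (λ q _ → q)
      go : ∀ {a b} → Walk (e E) (has U) a b → Fan x y a → Fan x y b
      go (here refl _) F = F
      go (step _ ab w) F = go w (fan-step (walk-start w) ab F)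

    -- Disjoint ends for paths through P: whatever joins p and q inside P and X extends to a path
    -- between x and y, since the ends avoid P and all attachments but their own.
    record Link (P X : Sub) : Set₁ where
      field
        {p q} : V
        p∈X   : p ∈ X
        q∈X   : q ∈ X
        p≢q   : p ≢ q
        {A B} : V → Set
        pathA : SomePath (e E) A x p
        pathB : SomePath (e E) B y q
        A⊆    : ∀ {t} → A t → t ∈ U × t ∉ P × (t ∈ X → t ≡ p)
        B⊆    : ∀ {t} → B t → t ∈ U × t ∉ P × (t ∈ X → t ≡ q)
        disj  : ∀ {t} → A t → B t → ⊥

    abstract
     -- Take a fan at a vertex of P and stop each path where it first meets X; it cannot enter P
     -- before that.
     link : ∀ P X → x ∉ P → y ∉ P → Nb P X → ∀ {v} → v ∈ P → v ∈ U → Link P X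
     link P X x∉ y∉ nbP {v} vP vU with fan vU
     ... | F with enter (λ o → A⊆U (on-in p o)) (path-tight p) x∉ | enter (λ o → B⊆U (on-in q o)) (path-tight q) y∉
       where
       open Fan F
       enter : ∀ {A u m} → (∀ {t} → A t → t ∈ U) → Path (e E) A u v m → u ∉ P →
               ∃ λ r → r ∈ X × r ∉ P × SomePath (e E) (λ t → A t × t ∉ P × (t ∈ X → t ≡ r)) u r
       enter {u = u} AU p u∉ with has? X u
       ... | yes uX = u , uX , u∉ , 0 , nil refl (path-start p , u∉ , λ _ → refl)
       enter AU (nil refl _) u∉ | no _ = ⊥-elim (u∉ vP)
       enter {A} {u} AU (cons {w = w} a uw p) u∉ | no ¬uX = rest (has? P w)
         where
         rest : Dec (w ∈ P) → ∃ λ r → r ∈ X × r ∉ P × SomePath (e E) (λ t → A t × t ∉ P × (t ∈ X → t ≡ r)) u r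
         rest (yes wP) = ⊥-elim (Data.Sum.[ u∉ , ¬uX ] (nbP wP (AU a) (e-sym E uw)))
         rest (no ¬wP) with enter (λ z → AU (proj₁ z)) p ¬wP
         ... | r , rX , r∉ , m , q = r , rX , r∉ , suc m ,
               cons (a , u∉ , λ uX → ⊥-elim (¬uX uX)) uw (path-mono (λ ((b , ne) , c) → (b , c) , ne) q)
     ... | r , rX , r∉ , pr | s , sX , s∉ , ps = record
       { p∈X = rX ; q∈X = sX
       ; p≢q = λ { refl → bad (path-end (proj₂ pr)) (path-end (proj₂ ps)) }
       ; pathA = pr ; pathB = ps
       ; A⊆ = λ (a , b , c) → Fan.A⊆U F (on-in (Fan.p F) a) , b , c
       ; B⊆ = λ (a , b , c) → Fan.B⊆U F (on-in (Fan.q F) a) , b , c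
       ; disj = bad }
       where
       bad : ∀ {t} → On t (Fan.p F) × t ∉ P × (t ∈ X → t ≡ r) → On t (Fan.q F) × t ∉ P × (t ∈ X → t ≡ s) → ⊥
       bad (a , t∉ , _) (b , _) with Fan.meet F a b
       ... | refl = t∉ vP

  -- Arithmetic progressions

  -- From t to t + 1 the index i is raised while its bound permits, and then j.
  split₁ : ∀ {m p} → 1 ≤ m → 1 ≤ p → ∀ t → suc t < m + p → ∃ λ i → ∃ λ j → i < m × j < p × i + j ≡ t
  split₁ m≥ p≥ zero lt = 0 , 0 , m≥ , p≥ , refl
  split₁ {m} {p} m≥ p≥ (suc t) lt with split₁ {m} {p} m≥ p≥ t (≤-trans (n≤1+n _) lt)
  ... | i , j , i< , j< , refl with suc i ≤? m ∸ 1
  ... | yes le = suc i , j , ≤-trans (s≤s le) (≤-reflexive (m+[n∸m]≡n m≥)) , j< , refl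
  ... | no nle = i , suc j , i< , +-cancelˡ-≤ m (suc (suc j)) p (≤-trans (≤-reflexive eq) lt) , +-suc i j
    where
    m≡ : m ≡ suc i
    m≡ = ≤-antisym (≤-trans (≤-reflexive (≡-sym (m+[n∸m]≡n m≥))) (≰⇒> nle)) i<
    eq : m + suc (suc j) ≡ suc (suc (suc (i + j)))
    eq rewrite m≡ | +-suc i (suc j) | +-suc i j = refl

  -- When i has reached its bound, j goes up by one and i down by one, a net gain of 1. Lowering i
  -- needs m at least 2.
  split₂ : ∀ {m p} → 2 ≤ m → 1 ≤ p → ∀ t → suc t < m + p → ∃ λ i → ∃ λ j → i < m × j < p × i + j * 2 ≡ t
  split₂ m≥ p≥ zero lt = 0 , 0 , ≤-trans (s≤s z≤n) m≥ , p≥ , refl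
  split₂ {m} {p} m≥ p≥ (suc t) lt with split₂ {m} {p} m≥ p≥ t (≤-trans (n≤1+n _) lt)
  ... | i , j , i< , j< , refl with suc (suc i) ≤? m
  ... | yes le = suc i , j , le , j< , refl
  ... | no nle = go i i< nle lt
    where
    go : ∀ i → i < m → ¬ suc (suc i) ≤ m → suc (suc (i + j * 2)) < m + p →
         ∃ λ a → ∃ λ b → a < m × b < p × a + b * 2 ≡ suc (i + j * 2)
    go zero _ nle _ = ⊥-elim (nle m≥)
    go (suc i) i< nle lt = i , suc j , ≤-trans (n≤1+n _) i< ,
      +-cancelˡ-≤ m (suc (suc j)) p (≤-trans (≤-trans (+-monoʳ-≤ m (s≤s (s≤s (m≤m*n j 2)))) (≤-reflexive eq)) lt) ,
      trans (+-suc i (suc (j * 2))) (cong suc (+-suc i (j * 2)))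
      where
      m≡ : m ≡ suc (suc i)
      m≡ = ≤-antisym (s≤s⁻¹ (≰⇒> nle)) i<
      eq : m + suc (suc (j * 2)) ≡ suc (suc (suc (suc (i + j * 2))))
      eq rewrite m≡ | +-suc i (suc (j * 2)) | +-suc i (j * 2) = refl

  -- When the differences are 1 and 2, the sums fill an interval unless the progression of difference 1 is a single term.
  progression-sum : ∀ (R : ℕ → Set) {m p a b d e} → d ≡ 1 ⊎ d ≡ 2 → e ≡ 1 ⊎ e ≡ 2 → 1 ≤ m → 1 ≤ p →
          (∀ i j → i < m → j < p → R ((a + i * d) + (b + j * e))) →
          ∃ λ f → (f ≡ 1 ⊎ f ≡ 2) × (∀ t → suc t < m + p → R ((a + b) + t * f))
  progression-sum R {m} {p} {a} {b} {d} {e} d≡ e≡ m≥ p≥ F = go d≡ e≡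
    where
    same : ∀ d → (∀ i j → i < m → j < p → R ((a + i * d) + (b + j * d))) → ∀ t → suc t < m + p → R ((a + b) + t * d)
    same d F t lt with split₁ {m} {p} m≥ p≥ t lt
    ... | i , j , i< , j< , refl = subst R (solve 5 (λ a b i j d → (a :+ i :* d) :+ (b :+ j :* d) := (a :+ b) :+ (i :+ j) :* d) refl a b i j d) (F i j i< j<)
      where open +-*-Solver
    two : ∀ {m} → 1 ≤ m → m ≡ 1 ⊎ 2 ≤ m
    two {suc zero} _ = inj₁ refl
    two {suc (suc m)} _ = inj₂ (s≤s (s≤s z≤n))
    go : d ≡ 1 ⊎ d ≡ 2 → e ≡ 1 ⊎ e ≡ 2 → ∃ λ f → (f ≡ 1 ⊎ f ≡ 2) × (∀ t → suc t < m + p → R ((a + b) + t * f))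
    go (inj₁ refl) (inj₁ refl) = 1 , inj₁ refl , same 1 F
    go (inj₂ refl) (inj₂ refl) = 2 , inj₂ refl , same 2 F
    go (inj₁ refl) (inj₂ refl) with two m≥
    ... | inj₁ refl = 2 , inj₂ refl , λ t lt → subst R (lem t) (F 0 t (s≤s z≤n) (s≤s⁻¹ lt))
      where
      lem : ∀ t → (a + 0) + (b + t * 2) ≡ (a + b) + t * 2
      lem t rewrite +-identityʳ a | +-assoc a b (t * 2) = refl
    ... | inj₂ m≥2 = 1 , inj₁ refl , h
      where
      h : ∀ t → suc t < m + p → R ((a + b) + t * 1)
      h t lt with split₂ {m} {p} m≥2 p≥ t lt
      ... | i , j , i< , j< , refl = subst R (solve 4 (λ a b i j → (a :+ i :* con 1) :+ (b :+ j :* con 2) := (a :+ b) :+ (i :+ j :* con 2) :* con 1) refl a b i j) (F i j i< j<)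
        where open +-*-Solver
    go (inj₂ refl) (inj₁ refl) with two p≥
    ... | inj₁ refl = 2 , inj₂ refl , λ t lt → subst R (lem t) (F t 0 (s≤s⁻¹ (subst (suc t <_) (+-comm m 1) lt)) (s≤s z≤n))
      where
      lem : ∀ t → (a + t * 2) + (b + 0) ≡ (a + b) + t * 2
      lem t = solve 3 (λ a b t → (a :+ t) :+ (b :+ con 0) := (a :+ b) :+ t) refl a b (t * 2)
        where open +-*-Solver
    ... | inj₂ p≥2 = 1 , inj₁ refl , h
      where
      h : ∀ t → suc t < m + p → R ((a + b) + t * 1)
      h t lt with split₂ {p} {m} p≥2 m≥ t (subst (suc t <_) (+-comm m p) lt)
      ... | i , j , i< , j< , refl = subst R (solve 4 (λ a b i j → (a :+ j :* con 2) :+ (b :+ i :* con 1) := (a :+ b) :+ (i :+ j :* con 2) :* con 1) refl a b i j) (F j i j< i<)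
        where open +-*-Solver

  -- Contraction, cliques and complete bipartite graphs

  argmax : ∀ {P : V → Set} (P? : ∀ v → Dec (P v)) (f : V → ℕ) (B : ℕ) → (∀ v → f v ≤ B) → ∃ P →
           ∃ λ v → P v × (∀ u → P u → f u ≤ f v)
  argmax {P} P? f B f≤ (v , pv) = go B v pv (m≤n+m B (f v))
    where
    go : ∀ n v → P v → B ≤ f v + n → ∃ λ v → P v × (∀ u → P u → f u ≤ f v)
    go n v pv le with ∃? (λ u → P? u ×-dec (suc (f v) ≤? f u))
    ... | no none = v , pv , λ u pu → ≮⇒≥ (λ lt → none (u , pu , lt))
    go zero v pv le | yes (u , pu , lt) = ⊥-elim (<⇒≱ lt (≤-trans (f≤ u) (≤-trans le (≤-reflexive (+-identityʳ _)))))
    go (suc n) v pv le | yes (u , pu , lt) = go n u pu (≤-trans le (≤-trans (≤-reflexive (+-suc (f v) n)) (+-monoˡ-≤ n lt)))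

  -- Contracts a set of vertices around x that has been used for initial segments of paths; S consists of the vertices at which these segments leave the set.
  star : Rel → V → Sub → Rel
  star E x S = record
    { e = λ u v → (u ≢ x × v ≢ x × e E u v) ⊎ ((u ≡ x × v ≢ x × v ∈ S) ⊎ (v ≡ x × u ≢ x × u ∈ S))
    ; e? = λ u v → (¬? (u ≟ x) ×-dec (¬? (v ≟ x) ×-dec e? E u v)) ⊎-dec
                   (((u ≟ x) ×-dec (¬? (v ≟ x) ×-dec has? S v)) ⊎-dec ((v ≟ x) ×-dec (¬? (u ≟ x) ×-dec has? S u)))
    ; e-sym = λ { (inj₁ (a , b , c)) → inj₁ (b , a , e-sym E c) ; (inj₂ (inj₁ a)) → inj₂ (inj₂ a) ; (inj₂ (inj₂ a)) → inj₂ (inj₁ a) }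
    ; e-irr = λ { (inj₁ (_ , _ , c)) → e-irr E c ; (inj₂ (inj₁ (a , b , _))) → b a ; (inj₂ (inj₂ (a , b , _))) → b a } }

  Clique : Rel → Sub → Set
  Clique E C = ∀ {a b} → a ∈ C → b ∈ C → a ≢ b → e E a b

  module _ (E : Rel) where

    -- In a clique the length of a path between given ends is free: each step uses up an arbitrary
    -- vertex other than t.
    clique-path : ∀ j (C : Sub) b t → (∀ {c} → c ∈ C → e E b c) → Clique E C → t ∈ C → suc j ≤ # C →
                  Path (e E) (λ s → s ≡ b ⊎ s ∈ C) b t (suc j)
    clique-path zero C b t bC cl tC le = path-edge E (inj₁ refl) (inj₂ tC) (bC tC)
    clique-path (suc j) C b t bC cl tC le with #-elem≢ {C} t (≤-trans (s≤s (s≤s z≤n)) le)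
    ... | s , sC , st = cons (inj₁ refl) (bC sC)
          (path-mono (λ { (inj₁ refl) → inj₂ sC , ≢-sym (e-≢ E (bC sC)) ; (inj₂ (a , _)) → inj₂ a , ≢-sym (e-≢ E (bC a)) })
            (clique-path j (C - s) s t (λ (a , n) → cl sC a (≢-sym n)) (λ a b → cl (proj₁ a) (proj₁ b)) (tC , ≢-sym st)
              (s≤s⁻¹ (≤-trans le (#-remove {C} s)))))

    NotAll : Sub → V → Set
    NotAll C v = ∃ λ c → c ∈ C × ¬ e E v c

    not-all? : ∀ C v → NotAll C v ⊎ (∀ {c} → c ∈ C → e E v c)
    not-all? C v with ∃? (λ c → has? C c ×-dec ¬? (e? E v c))
    ... | yes r = inj₁ r
    ... | no n = inj₂ λ {c} cC → Data.Sum.[ (λ s → s) , (λ nv → ⊥-elim (n (c , cC , nv))) ]′ (dec c)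
      where
      dec : ∀ c → e E v c ⊎ ¬ e E v c
      dec c with e? E v c
      ... | yes a = inj₁ a
      ... | no a = inj₂ a

    -- C is enlarged as long as some vertex of X is adjacent to all of it; the number in `go` bounds
    -- the enlargements still possible.
    max-clique : ∀ (X C : Sub) → C ⊆ X → Clique E C → Σ Sub λ C' → (C ⊆ C') × (C' ⊆ X) × Clique E C' × (∀ {v} → v ∈ X → v ∉ C' → NotAll C' v)
    max-clique X C s cl = go (# X) C s cl (m≤n+m _ _)
      where
      go : ∀ n (C : Sub) → C ⊆ X → Clique E C → # X ≤ # C + n → Σ Sub λ C' → (C ⊆ C') × (C' ⊆ X) × Clique E C' × (∀ {v} → v ∈ X → v ∉ C' → NotAll C' v)
      go n C s cl le with ∃? (λ v → has? X v ×-dec (¬? (has? C v) ×-dec ¬? (∃? (λ c → has? C c ×-dec ¬? (e? E v c)))))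
      ... | no none = C , (λ a → a) , s , cl , λ {v} vX vC → Data.Sum.[ (λ r → r) , (λ f → ⊥-elim (none (v , vX , vC , λ (c , cC , n) → n (f cC)))) ]′ (not-all? C v)
      ... | yes (v , vX , vC , na) = next n le
        where
        C₁ : Sub
        C₁ = C ∪ ⁅ v ⁆
        bigger : # C < # C₁
        bigger = #-< {C} {C₁} {v} inj₁ (inj₂ refl) vC
        vc : ∀ {c} → c ∈ C → e E v c
        vc {c} cC with e? E v c
        ... | yes a = a
        ... | no n = ⊥-elim (na (c , cC , n))
        cl₁ : Clique E C₁
        cl₁ (inj₁ a) (inj₁ b) n = cl a b n
        cl₁ (inj₁ a) (inj₂ refl) n = e-sym E (vc a)
        cl₁ (inj₂ refl) (inj₁ b) n = vc b
        cl₁ (inj₂ refl) (inj₂ refl) n = ⊥-elim (n refl)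
        C₁⊆ : C₁ ⊆ X
        C₁⊆ (inj₁ a) = s a
        C₁⊆ (inj₂ refl) = vX
        next : ∀ n → # X ≤ # C + n → Σ Sub λ C' → (C ⊆ C') × (C' ⊆ X) × Clique E C' × (∀ {v} → v ∈ X → v ∉ C' → NotAll C' v)
        next zero le = ⊥-elim (<⇒≱ (≤-trans bigger (#-mono {C₁} {X} C₁⊆)) (≤-trans le (≤-reflexive (+-identityʳ _))))
        next (suc n) le with go n C₁ C₁⊆ cl₁ (≤-trans le (≤-trans (≤-reflexive (+-suc _ n)) (+-monoˡ-≤ n bigger)))
        ... | C' , a , b , c , d = C' , (λ t → a (inj₁ t)) , b , c , λ {v} → d {v}

  module _ (E : Rel) where

    -- u acts as one more vertex on the side of A, so the path alternates between the sides and has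
    -- odd length; each round uses up one vertex of either side.
    zigzag : ∀ j (A B : Sub) u t → (∀ {b} → b ∈ B → e E u b) → (∀ {a b} → a ∈ A → b ∈ B → e E a b) → u ∉ A → (∀ {a} → a ∈ A → a ∉ B) →
             t ∈ B → j ≤ # A → suc j ≤ # B → Path (e E) (λ s → s ≡ u ⊎ (s ∈ A ⊎ s ∈ B)) u t (1 + j * 2)
    zigzag zero A B u t uB AB u∉A A∌B tB _ _ = path-edge E (inj₁ refl) (inj₂ (inj₂ tB)) (uB tB)
    zigzag (suc j) A B u t uB AB u∉A A∌B tB jA jB with #-elem≢ {B} t (≤-trans (s≤s (s≤s z≤n)) jB) | #-elem {A} (≤-trans (s≤s z≤n) jA)
    ... | b , bB , bt | a , aA = cons (inj₁ refl) (uB bB) (cons (inj₂ (inj₂ bB) , ≢-sym (e-≢ E (uB bB))) (e-sym E (AB aA bB))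
          (path-mono inc (zigzag j (A - a) (B - b) a t (λ (c , _) → AB aA c) (λ (c , _) (d , _) → AB c d) (λ c → proj₂ c refl) (λ c d → A∌B (proj₁ c) (proj₁ d))
            (tB , ≢-sym bt) (s≤s⁻¹ (≤-trans jA (#-remove {A} a))) (s≤s⁻¹ (≤-trans jB (#-remove {B} b))))))
      where
      inc : ∀ {s} → s ≡ a ⊎ (s ∈ (A - a) ⊎ s ∈ (B - b)) → ((s ≡ u ⊎ (s ∈ A ⊎ s ∈ B)) × s ≢ u) × s ≢ b
      inc (inj₁ refl) = (inj₂ (inj₁ aA) , λ { refl → u∉A aA }) , λ { refl → A∌B aA bB }
      inc (inj₂ (inj₁ (c , _))) = (inj₂ (inj₁ c) , λ { refl → u∉A c }) , λ { refl → A∌B c bB }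
      inc (inj₂ (inj₂ (c , n))) = (inj₂ (inj₂ c) , ≢-sym (e-≢ E (uB c))) , n

  -- The part of Info that does not mention an instance, so that the two sides can be compared.
  record Side (E : Rel) (U : Sub) (x y z : V) : Set₁ where
    field
      A B  : Sub
      A⊆U  : A ⊆ U
      B⊆U  : B ⊆ U
      x∈A  : x ∈ A
      y∉A  : y ∉ A
      AB   : ∀ {a b} → a ∈ A → b ∈ B → e E a b
      A≤B  : # A ≤ # B
      A≥2  : 2 ≤ # A
      B≥2  : 2 ≤ # B
      -- At most one neighbour u of y escapes A and B. Either u is z, when only y and z remain
      -- around y, or z alone hangs at u, and then u was a vertex of S and has a neighbour in B.
      nby  : (∀ {t} → t ∈ U → e E y t → t ∈ A ⊎ t ∈ B) ⊎
             (∃ λ u → u ∉ A × u ∉ B × e E y u × z ∉ A × z ∉ B × (u ≡ z ⊎ (z ∈ U × z ≢ y × e E u z × ∃ λ b → b ∈ B × e E b u)) ×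
                (∀ {t} → t ∈ U → e E y t → (t ∈ A ⊎ t ∈ B) ⊎ t ≡ u))
    xB : ∀ {b} → b ∈ B → e E x b
    xB = AB x∈A

  NoTriangle : Rel → Sub → V → Set
  NoTriangle E U r = ∀ {b c} → b ∈ U → c ∈ U → e E r b → e E r c → e E b c → ⊥

  -- Suppose x has a neighbour t in the A at y. No vertex of the B at y is adjacent to x, because of
  -- t and the absence of triangles, so none lies in the A or B at x. But these are at least two
  -- neighbours of y, and only one may be extra.
  mixed : ∀ {E U x y z} → NoTriangle E U x → (X : Side E U x y z) (Y : Side E U y x z) →
          (∀ {t} → t ∈ Side.A X → ¬ e E y t) → ∀ {t} → t ∈ Side.A Y → e E x t → ⊥
  mixed {E} {U} {x} {y} {z} ntx X Y noA {t} tA xt = go (Side.nby X)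
    where
    module X = Side X
    module Y = Side Y
    not-x : ∀ {β} → β ∈ Y.B → ¬ e E x β
    not-x bB xb = ntx (Y.A⊆U tA) (Y.B⊆U bB) xt xb (Y.AB tA bB)
    AorB : ∀ {β} → β ∈ Y.B → ¬ (β ∈ X.A ⊎ β ∈ X.B)
    AorB bB (inj₁ a) = noA a (Y.xB bB)
    AorB bB (inj₂ b) = not-x bB (X.xB b)
    go : _ → ⊥
    go (inj₁ f) = let (β , bB) = #-elem {Y.B} (≤-trans (s≤s z≤n) Y.B≥2) in AorB bB (f (Y.B⊆U bB) (Y.xB bB))
    go (inj₂ (u , _ , _ , _ , _ , _ , _ , f)) with #-elem≢ {Y.B} u Y.B≥2
    ... | β , bB , bu = Data.Sum.[ AorB bB , bu ]′ (f (Y.B⊆U bB) (Y.xB bB))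

  -- Sets with few attachments

  module Reduce {k : ℕ} (I : Inst k) (k≥2 : 2 ≤ k) (ih : Smaller (# (Inst.U I))) where
    open Inst I
    open Basic I public

    k≥1 : 1 ≤ k
    k≥1 = ≤-trans (s≤s z≤n) k≥2

    deg-in : ∀ {v} (U' : Sub) → v ∈ U → v ≢ x → v ≢ y → v ≢ z →
             (∀ {b} → b ∈ U → e E v b → b ∈ U') → suc k ≤ # (nb E v ∩ U')
    deg-in U' vU nx ny nz f = ≤-trans (deg vU nx ny nz) (#-mono (λ (a , b) → a , f b a))

    sub-adm : ∀ {j} → 1 ≤ j → (U' : Sub) → U' ⊆ U → ∀ {o} → o ∈ U → o ∉ U' → ∀ p q ζ → p ∈ U' → q ∈ U' → p ≢ q →
              Rooted E U' p q → (∀ {v} → v ∈ U' → v ≢ p → v ≢ q → v ≢ ζ → suc j ≤ # (nb E v ∩ U')) →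
              ∀ {v} → v ∈ U' → v ≢ p → v ≢ q → v ≢ ζ → Adm (e E) (has U') j p q
    sub-adm j≥ U' s oU o∉ p q ζ pU qU pq R dg {v} a b c d = ih j≥
      record { E = E ; U = U' ; x = p ; y = q ; z = ζ ; x∈U = pU ; y∈U = qU ; x≢y = pq ; rooted = R ; deg = dg
             ; inner = v , a , b , c , d }
      (#-< {U'} {U} s oU o∉)

    -- Prolonging all paths by the same two ends shifts the progression and keeps its difference.
    sandwich : ∀ {B A₁ A₂ : V → Set} {p q} → Adm (e E) B k p q → SomePath (e E) A₁ x p → SomePath (e E) A₂ y q →
               (∀ {t} → B t → t ∈ U) →
               (∀ {t} → A₁ t → t ∈ U × (B t → t ≡ p)) → (∀ {t} → A₂ t → t ∈ U × (B t → t ≡ q)) →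
               (∀ {t} → A₁ t → A₂ t → ⊥) → Done
    sandwich {B} {A₁} {A₂} (adm b d b≥ d≡ P) (m , p₁) (l , p₂) BU f g h =
      adm (m + b + l) d (≤-trans b≥ (≤-trans (m≤n+m b m) (m≤m+n (m + b) l))) d≡ λ i i< →
        subst (Path (e E) (has U) x y) (lem i)
          (path-mono (λ { (inj₁ (inj₁ a)) → proj₁ (f a) ; (inj₁ (inj₂ a)) → BU a ; (inj₂ a) → proj₁ (g a) })
            (path-append (path-append p₁ (P i i<) (λ a c → proj₂ (f a) c)) (path-reverse E p₂)
              (λ { (inj₁ a) c → ⊥-elim (h a c) ; (inj₂ a) c → proj₂ (g c) a })))
      where
      lem : ∀ i → (m + (b + i * d)) + l ≡ (m + b + l) + i * d
      lem i = solve 4 (λ m b l t → (m :+ (b :+ t)) :+ l := (m :+ b :+ l) :+ t) refl m b l (i * d)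
        where open +-*-Solver

    bridge : ∀ {P X} {B : V → Set} (L : Link P X) → Adm (e E) B k (Link.p L) (Link.q L) →
             (∀ {t} → B t → t ∈ U) → (∀ {t} → B t → t ∈ P ⊎ t ∈ X) → Done
    bridge L ad BU f = sandwich ad pathA pathB BU
      (λ a → proj₁ (A⊆ a) , λ b → Data.Sum.[ (λ c → ⊥-elim (proj₁ (proj₂ (A⊆ a)) c)) , proj₂ (proj₂ (A⊆ a)) ]′ (f b))
      (λ a → proj₁ (B⊆ a) , λ b → Data.Sum.[ (λ c → ⊥-elim (proj₁ (proj₂ (B⊆ a)) c)) , proj₂ (proj₂ (B⊆ a)) ]′ (f b))
      disj
      where open Link L

    link-U : ∀ {P X} (L : Link P X) → Link.p L ∈ U × Link.p L ∉ P × Link.q L ∈ U × Link.q L ∉ P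
    link-U L = let (a , b , _) = Link.A⊆ L (path-end (proj₂ (Link.pathA L)))
                   (c , d , _) = Link.B⊆ L (path-end (proj₂ (Link.pathB L))) in a , b , c , d

    -- Both attachments that are reached from the roots become roots of a smaller instance.
    two-attachments : ∀ (P : Sub) → P ⊆ U → x ∉ P → y ∉ P → ∀ a b → Nb P (⁅ a ⁆ ∪ ⁅ b ⁆) →
         ∀ {o} → o ∈ U → o ∉ P → o ≢ a → o ≢ b → ∀ {v} → v ∈ P → v ≢ z → Done
    two-attachments P P⊆ x∉ y∉ a b nbP {o} oU o∉ oa ob {v} vP v≢z = bridge L ad (λ {t} → H⊆ {t}) (λ {t} → H⊆X {t})
      where
      L : Link P (⁅ a ⁆ ∪ ⁅ b ⁆)
      L = link P _ x∉ y∉ nbP vP (P⊆ vP)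
      open Link L
      LU = link-U L
      H : Sub
      H = P ∪ (⁅ p ⁆ ∪ ⁅ q ⁆)
      H⊆ : H ⊆ U
      H⊆ (inj₁ c) = P⊆ c
      H⊆ (inj₂ (inj₁ refl)) = proj₁ LU
      H⊆ (inj₂ (inj₂ refl)) = proj₁ (proj₂ (proj₂ LU))
      H⊆X : ∀ {t} → t ∈ H → t ∈ P ⊎ t ∈ (⁅ a ⁆ ∪ ⁅ b ⁆)
      H⊆X (inj₁ c) = inj₁ c
      H⊆X (inj₂ (inj₁ refl)) = inj₂ p∈X
      H⊆X (inj₂ (inj₂ refl)) = inj₂ q∈X
      toH : ∀ {t} → t ∈ (⁅ a ⁆ ∪ ⁅ b ⁆) → t ≡ p ⊎ t ≡ q
      toH {t} s = go s p∈X q∈X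
        where
        go : t ≡ a ⊎ t ≡ b → p ≡ a ⊎ p ≡ b → q ≡ a ⊎ q ≡ b → t ≡ p ⊎ t ≡ q
        go (inj₁ s) (inj₁ u) _ = inj₁ (trans s (≡-sym u))
        go (inj₁ s) _ (inj₁ u) = inj₂ (trans s (≡-sym u))
        go (inj₂ s) (inj₂ u) _ = inj₁ (trans s (≡-sym u))
        go (inj₂ s) _ (inj₂ u) = inj₂ (trans s (≡-sym u))
        go _ (inj₁ u) (inj₁ w) = ⊥-elim (p≢q (trans u (≡-sym w)))
        go _ (inj₂ u) (inj₂ w) = ⊥-elim (p≢q (trans u (≡-sym w)))
      o∉H : o ∉ H
      o∉H c = Data.Sum.[ o∉ , Data.Sum.[ oa , ob ]′ ]′ (H⊆X c)
      R : Rooted E H p q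
      R w u (inj₂ (inj₁ refl)) ne = inj₁ (here refl (inj₂ (inj₁ refl) , ne))
      R w u (inj₂ (inj₂ refl)) ne = inj₂ (here refl (inj₂ (inj₂ refl) , ne))
      R w u (inj₁ uP) ne with exit P (⁅ a ⁆ ∪ ⁅ b ⁆) x∉ y∉ nbP w uP (P⊆ uP) ne
      ... | r , rX , rU , rw , r∉ , wk with toH rX
      ... | inj₁ refl = inj₁ (walk-mono (λ { (inj₁ c , n) → inj₁ c , n ; (inj₂ c , n) → inj₂ (inj₁ c) , n }) wk)
      ... | inj₂ refl = inj₂ (walk-mono (λ { (inj₁ c , n) → inj₁ c , n ; (inj₂ c , n) → inj₂ (inj₂ c) , n }) wk)
      dg : ∀ {v} → v ∈ H → v ≢ p → v ≢ q → v ≢ z → suc k ≤ # (nb E v ∩ H)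
      dg (inj₂ (inj₁ s)) n₁ n₂ _ = ⊥-elim (n₁ s)
      dg (inj₂ (inj₂ s)) n₁ n₂ _ = ⊥-elim (n₂ s)
      dg (inj₁ vP) _ _ nz = deg-in H (P⊆ vP) (λ { refl → x∉ vP }) (λ { refl → y∉ vP }) nz
        λ bU vb → Data.Sum.map₂ toH (nbP vP bU vb)
      ad : Adm (e E) (has H) k p q
      ad = sub-adm k≥1 H H⊆ oU o∉H p q z (inj₂ (inj₁ refl)) (inj₂ (inj₂ refl)) p≢q R dg (inj₁ vP)
             (∈≢ {P} vP (proj₁ (proj₂ LU))) (∈≢ {P} vP (proj₂ (proj₂ (proj₂ LU)))) v≢z

    other : ∀ {a b w : V} → a ≢ b → a ≢ w ⊎ b ≢ w
    other {a} {b} {w} ab with a ≟ w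
    ... | no ne = inj₁ ne
    ... | yes refl = inj₂ λ { refl → ab refl }

    -- The attachment a usually comes from a cut whose position is unknown; of two different
    -- vertices outside P at least one is not a.
    two-attachments' : ∀ (P : Sub) → P ⊆ U → x ∉ P → y ∉ P → ∀ a b → Nb P (⁅ a ⁆ ∪ ⁅ b ⁆) →
          ∀ {o o'} → o ≢ o' → o ∈ U → o' ∈ U → o ∉ P → o' ∉ P → o ≢ b → o' ≢ b → ∀ {v} → v ∈ P → v ≢ z → Done
    two-attachments' P P⊆ x∉ y∉ a b nbP {o} {o'} oo oU o'U o∉ o'∉ ob o'b vP v≢ with other {o} {o'} {a} oo
    ... | inj₁ oa = two-attachments P P⊆ x∉ y∉ a b nbP oU o∉ oa ob vP v≢
    ... | inj₂ oa = two-attachments P P⊆ x∉ y∉ a b nbP o'U o'∉ oa o'b vP v≢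

    -- The attachment that is not used as a root becomes the exceptional vertex.
    three-attachments : ∀ (P : Sub) → P ⊆ U → x ∉ P → y ∉ P → z ∉ P → ∀ a b c → Nb P (⁅ a ⁆ ∪ (⁅ b ⁆ ∪ ⁅ c ⁆)) →
         ∀ {o} → o ∈ U → o ∉ P → o ≢ a → o ≢ b → o ≢ c → ∀ {v v'} → v ∈ P → v' ∈ P → v ≢ v' → Done
    three-attachments P P⊆ x∉ y∉ z∉ a b c nbP {o} oU o∉ oa ob oc {v} {v'} vP v'P vv' = main
      where
      X : Sub
      X = ⁅ a ⁆ ∪ (⁅ b ⁆ ∪ ⁅ c ⁆)
      L : Link P X
      L = link P X x∉ y∉ nbP vP (P⊆ vP)
      open Link L
      LU = link-U L
      pU = proj₁ LU
      p∉ = proj₁ (proj₂ LU)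
      qU = proj₁ (proj₂ (proj₂ LU))
      q∉ = proj₂ (proj₂ (proj₂ LU))
      ≢z : ∀ {v} → v ∈ P → v ≢ z
      ≢z a refl = z∉ a
      third : ∀ {p q a b c : V} → p ≢ q → p ≡ a ⊎ (p ≡ b ⊎ p ≡ c) → q ≡ a ⊎ (q ≡ b ⊎ q ≡ c) →
              ∃ λ l → (l ≡ a ⊎ (l ≡ b ⊎ l ≡ c)) × (∀ {t} → t ≡ a ⊎ (t ≡ b ⊎ t ≡ c) → t ≡ p ⊎ (t ≡ q ⊎ t ≡ l))
      third pq (inj₁ refl) (inj₁ refl) = ⊥-elim (pq refl)
      third {c = c} pq (inj₁ refl) (inj₂ (inj₁ refl)) = c , inj₂ (inj₂ refl) , λ t → t
      third {b = b} pq (inj₁ refl) (inj₂ (inj₂ refl)) = b , inj₂ (inj₁ refl) , λ { (inj₁ s) → inj₁ s ; (inj₂ (inj₁ s)) → inj₂ (inj₂ s) ; (inj₂ (inj₂ s)) → inj₂ (inj₁ s) }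
      third {c = c} pq (inj₂ (inj₁ refl)) (inj₁ refl) = c , inj₂ (inj₂ refl) , λ { (inj₁ s) → inj₂ (inj₁ s) ; (inj₂ (inj₁ s)) → inj₁ s ; (inj₂ (inj₂ s)) → inj₂ (inj₂ s) }
      third pq (inj₂ (inj₁ refl)) (inj₂ (inj₁ refl)) = ⊥-elim (pq refl)
      third {a = a} pq (inj₂ (inj₁ refl)) (inj₂ (inj₂ refl)) = a , inj₁ refl , λ { (inj₁ s) → inj₂ (inj₂ s) ; (inj₂ (inj₁ s)) → inj₁ s ; (inj₂ (inj₂ s)) → inj₂ (inj₁ s) }
      third {b = b} pq (inj₂ (inj₂ refl)) (inj₁ refl) = b , inj₂ (inj₁ refl) , λ { (inj₁ s) → inj₂ (inj₁ s) ; (inj₂ (inj₁ s)) → inj₂ (inj₂ s) ; (inj₂ (inj₂ s)) → inj₁ s }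
      third {a = a} pq (inj₂ (inj₂ refl)) (inj₂ (inj₁ refl)) = a , inj₁ refl , λ { (inj₁ s) → inj₂ (inj₂ s) ; (inj₂ (inj₁ s)) → inj₂ (inj₁ s) ; (inj₂ (inj₂ s)) → inj₁ s }
      third pq (inj₂ (inj₂ refl)) (inj₂ (inj₂ refl)) = ⊥-elim (pq refl)
      T = third p≢q p∈X q∈X
      l = proj₁ T
      toPQL : ∀ {t} → t ∈ X → t ≡ p ⊎ (t ≡ q ⊎ t ≡ l)
      toPQL = proj₂ (proj₂ T)
      o∉X : ∀ {t} → t ∈ X → o ≢ t
      o∉X (inj₁ refl) = oa
      o∉X (inj₂ (inj₁ refl)) = ob
      o∉X (inj₂ (inj₂ refl)) = oc
      -- Used when l is no third attachment: it is outside U, inside P, or equal to p or q.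
      viaM1 : (∀ {b} → b ∈ U → b ≡ l → b ∈ P ⊎ (b ≡ p ⊎ b ≡ q)) → Done
      viaM1 f = two-attachments P P⊆ x∉ y∉ p q nb2 oU o∉ (o∉X p∈X) (o∉X q∈X) vP (≢z vP)
        where
        nb2 : Nb P (⁅ p ⁆ ∪ ⁅ q ⁆)
        nb2 aP bU ab with nbP aP bU ab
        ... | inj₁ bP = inj₁ bP
        ... | inj₂ bX with toPQL bX
        ... | inj₁ s = inj₂ (inj₁ s)
        ... | inj₂ (inj₁ s) = inj₂ (inj₂ s)
        ... | inj₂ (inj₂ s) = f bU s

      module Proper (lU : l ∈ U) (l∉ : l ∉ P) (lp : l ≢ p) (lq : l ≢ q) where
        H H₂ : Sub
        H = P ∪ (⁅ p ⁆ ∪ (⁅ q ⁆ ∪ ⁅ l ⁆))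
        H₂ = P ∪ (⁅ p ⁆ ∪ ⁅ q ⁆)
        H₂H : H₂ ⊆ H
        H₂H (inj₁ t) = inj₁ t
        H₂H (inj₂ (inj₁ t)) = inj₂ (inj₁ t)
        H₂H (inj₂ (inj₂ t)) = inj₂ (inj₂ (inj₁ t))
        H⊆ : H ⊆ U
        H⊆ (inj₁ c) = P⊆ c
        H⊆ (inj₂ (inj₁ refl)) = pU
        H⊆ (inj₂ (inj₂ (inj₁ refl))) = qU
        H⊆ (inj₂ (inj₂ (inj₂ refl))) = lU
        H⊆X : ∀ {t} → t ∈ H → t ∈ P ⊎ t ∈ X
        H⊆X (inj₁ c) = inj₁ c
        H⊆X (inj₂ (inj₁ refl)) = inj₂ p∈X
        H⊆X (inj₂ (inj₂ (inj₁ refl))) = inj₂ q∈X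
        H⊆X (inj₂ (inj₂ (inj₂ refl))) = inj₂ (proj₁ (proj₂ T))
        o∉H : o ∉ H
        o∉H c = Data.Sum.[ o∉ , (λ s → o∉X s refl) ]′ (H⊆X c)
        P≢ : ∀ {v r} → v ∈ P → r ∉ P → v ≢ r
        P≢ a b refl = b a
        inH : ∀ {a b} → a ∈ P → b ∈ U → e E a b → b ∈ H
        inH aP bU ab = Data.Sum.map₂ toPQL (nbP aP bU ab)

        deg-H : ∀ {v} → v ∈ H → v ≢ p → v ≢ q → v ≢ l → suc k ≤ # (nb E v ∩ H)
        deg-H (inj₂ (inj₁ s)) n₁ n₂ n₃ = ⊥-elim (n₁ s)
        deg-H (inj₂ (inj₂ (inj₁ s))) n₁ n₂ n₃ = ⊥-elim (n₂ s)
        deg-H (inj₂ (inj₂ (inj₂ s))) n₁ n₂ n₃ = ⊥-elim (n₃ s)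
        deg-H (inj₁ vP) _ _ _ = deg-in H (P⊆ vP) (P≢ vP x∉) (P≢ vP y∉) (≢z vP) (inH vP)

        good : Rooted E H p q → Done
        good R = bridge L (sub-adm k≥1 H H⊆ oU o∉H p q l (inj₂ (inj₁ refl)) (inj₂ (inj₂ (inj₁ refl))) p≢q R deg-H
                   (inj₁ vP) (P≢ vP p∉) (P≢ vP q∉) (P≢ vP l∉)) (λ {t} → H⊆ {t}) (λ {t} → H⊆X {t})

        -- l is a pendant vertex of H. Dropping it costs only w a neighbour, so w becomes the
        -- exceptional vertex.
        module Stuck (w : V) (leaf : ∀ {b} → b ∈ H → e E l b → b ≡ w) where
          done : Rooted E H₂ p q ⊎ Piece E H₂ p q → Done
          done (inj₁ R) = bridge L (fin (other {w = w} vv')) (λ {t} a → H⊆ {t} (H₂H {t} a)) (λ {t} a → H⊆X {t} (H₂H {t} a))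
            where
            dg : ∀ {v} → v ∈ H₂ → v ≢ p → v ≢ q → v ≢ w → suc k ≤ # (nb E v ∩ H₂)
            dg (inj₂ (inj₁ s)) n₁ n₂ n₃ = ⊥-elim (n₁ s)
            dg (inj₂ (inj₂ s)) n₁ n₂ n₃ = ⊥-elim (n₂ s)
            dg {v} (inj₁ vP) _ _ nw = deg-in H₂ (P⊆ vP) (P≢ vP x∉) (P≢ vP y∉) (≢z vP) f
              where
              f : ∀ {b} → b ∈ U → e E v b → b ∈ H₂
              f bU vb with inH vP bU vb
              ... | inj₁ s = inj₁ s
              ... | inj₂ (inj₁ s) = inj₂ (inj₁ s)
              ... | inj₂ (inj₂ (inj₁ s)) = inj₂ (inj₂ s)
              ... | inj₂ (inj₂ (inj₂ refl)) = ⊥-elim (nw (leaf (inj₁ vP) (e-sym E vb)))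
            fin : v ≢ w ⊎ v' ≢ w → Adm (e E) (has H₂) k p q
            fin (inj₁ ne) = sub-adm k≥1 H₂ (λ {t} a → H⊆ {t} (H₂H {t} a)) oU (λ a → o∉H (H₂H a)) p q w (inj₂ (inj₁ refl)) (inj₂ (inj₂ refl)) p≢q R dg
                   (inj₁ vP) (P≢ vP p∉) (P≢ vP q∉) ne
            fin (inj₂ ne) = sub-adm k≥1 H₂ (λ {t} a → H⊆ {t} (H₂H {t} a)) oU (λ a → o∉H (H₂H a)) p q w (inj₂ (inj₁ refl)) (inj₂ (inj₂ refl)) p≢q R dg
                   (inj₁ v'P) (P≢ v'P p∉) (P≢ v'P q∉) ne
          done (inj₂ Π) = two-attachments' K (λ a → P⊆ (KP a)) (λ a → x∉ (KP a)) (λ a → y∉ (KP a)) w' l nb3 p≢q pU qU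
                            x∉K y∉K (λ s → lp (≡-sym s)) (λ s → lq (≡-sym s)) (proj₂ some) (≢z (KP (proj₂ some)))
            where
            open Piece Π renaming (w to w')
            KP : ∀ {t} → t ∈ K → t ∈ P
            KP a with K⊆U a
            ... | inj₁ c = c
            ... | inj₂ (inj₁ refl) = ⊥-elim (x∉K a)
            ... | inj₂ (inj₂ refl) = ⊥-elim (y∉K a)
            nb3 : Nb K (⁅ w' ⁆ ∪ ⁅ l ⁆)
            nb3 aK bU ab with inH (KP aK) bU ab
            ... | inj₁ s = Data.Sum.map₂ inj₁ (closed aK (inj₁ s) ab)
            ... | inj₂ (inj₁ s) = Data.Sum.map₂ inj₁ (closed aK (inj₂ (inj₁ s)) ab)
            ... | inj₂ (inj₂ (inj₁ s)) = Data.Sum.map₂ inj₁ (closed aK (inj₂ (inj₂ s)) ab)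
            ... | inj₂ (inj₂ (inj₂ s)) = inj₂ (inj₂ s)

        done : Rooted E H p q ⊎ Piece E H p q → Done
        done (inj₁ R) = good R
        -- A piece with further vertices is, without l, attached only to w and l. A piece that is
        -- just l makes l pendant.
        done (inj₂ Π) with ∃? (has? (Piece.K Π - l))
        ... | yes (t , tK) = two-attachments' K' (λ a → P⊆ (KP a)) (λ a → x∉ (KP a)) (λ a → y∉ (KP a)) w l nb3 p≢q pU qU
                            (λ a → x∉K (proj₁ a)) (λ a → y∉K (proj₁ a)) (λ s → lp (≡-sym s)) (λ s → lq (≡-sym s)) tK (≢z (KP tK))
          where
          open Piece Π
          K' : Sub
          K' = K - l
          KP : ∀ {t} → t ∈ K' → t ∈ P
          KP (a , ne) with K⊆U a
          ... | inj₁ c = c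
          ... | inj₂ (inj₁ refl) = ⊥-elim (x∉K a)
          ... | inj₂ (inj₂ (inj₁ refl)) = ⊥-elim (y∉K a)
          ... | inj₂ (inj₂ (inj₂ s)) = ⊥-elim (ne s)
          nb3 : Nb K' (⁅ w ⁆ ∪ ⁅ l ⁆)
          nb3 {b = b} aK bU ab with closed (proj₁ aK) (inH (KP aK) bU ab) ab | b ≟ l
          ... | _ | yes s = inj₂ (inj₂ s)
          ... | inj₁ bK | no ne = inj₁ (bK , ne)
          ... | inj₂ s | no _ = inj₂ (inj₁ s)
        ... | no ¬K' = Stuck.done w leaf (rooted? E H₂ p q)
          where
          open Piece Π
          only : ∀ {t} → t ∈ K → t ≡ l
          only {t} a with t ≟ l
          ... | yes s = s
          ... | no ne = ⊥-elim (¬K' (t , a , ne))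
          lK : l ∈ K
          lK = subst (_∈ K) (only (proj₂ some)) (proj₂ some)
          leaf : ∀ {b} → b ∈ H → e E l b → b ≡ w
          leaf bH lb with closed lK bH lb
          ... | inj₂ s = s
          ... | inj₁ bK = ⊥-elim (e-≢ E lb (≡-sym (only bK)))

      main : Done
      main with has? U l | has? P l | l ≟ p | l ≟ q
      ... | no ¬U | _ | _ | _ = viaM1 (λ { bU refl → ⊥-elim (¬U bU) })
      ... | yes _ | yes lP | _ | _ = viaM1 (λ { bU refl → inj₁ lP })
      ... | yes _ | no _ | yes s | _ = viaM1 (λ { bU refl → inj₂ (inj₁ s) })
      ... | yes _ | no _ | no _ | yes s = viaM1 (λ { bU refl → inj₂ (inj₂ s) })
      ... | yes lU | no l∉ | no lp | no lq = Proper.done lU l∉ lp lq (rooted? E (Proper.H lU l∉ lp lq) p q)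

    ordinary : V → Set
    ordinary v = v ∈ U × v ≢ x × v ≢ y × v ≢ z

    deg-ord : ∀ {v} → ordinary v → suc k ≤ # (nb E v ∩ U)
    deg-ord (a , b , c , d) = deg a b c d

    third-neighbour : ∀ {v} → ordinary v → ∀ a b → ∃ λ t → t ∈ U × e E v t × t ≢ a × t ≢ b
    third-neighbour {v} o a b with #-> {nb E v ∩ U} {⁅ a ⁆ ∪ ⁅ b ⁆}
        (≤-trans (s≤s (#-two {⁅ a ⁆ ∪ ⁅ b ⁆} a b (λ t → t))) (≤-trans (s≤s k≥2) (deg-ord o)))
    ... | t , (vt , tU) , n = t , tU , vt , (λ s → n (inj₁ s)) , (λ s → n (inj₂ s))

    adm₂ : ∀ {A : V → Set} {u v b d} → k ≡ 2 → 2 ≤ b → d ≡ 1 ⊎ d ≡ 2 → Path (e E) A u v b → Path (e E) A u v (b + d) → Adm (e E) A k u v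
    adm₂ {A} {u} {v} {b} {d} refl b≥ d≡ p q = adm b d b≥ d≡ h
      where
      h : ∀ i → i < 2 → Path (e E) A u v (b + i * d)
      h zero _ = subst (Path (e E) A u v) (≡-sym (+-identityʳ b)) p
      h (suc zero) _ = subst (λ t → Path (e E) A u v (b + t)) (≡-sym (+-identityʳ d)) q
      h (suc (suc _)) (s≤s (s≤s ()))

    path₂ : ∀ {A : V → Set} {a b c} → A a → A b → A c → a ≢ b → a ≢ c → b ≢ c → e E a b → e E b c → Path (e E) A a c 2
    path₂ Aa Ab Ac ab ac bc p q = cons Aa p (cons (Ab , ≢-sym ab) q (nil refl ((Ac , ≢-sym ac) , ≢-sym bc)))

    path₃ : ∀ {A : V → Set} {a b c d} → A a → A b → A c → A d → a ≢ b → a ≢ c → a ≢ d → b ≢ c → b ≢ d → c ≢ d →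
            e E a b → e E b c → e E c d → Path (e E) A a d 3
    path₃ Aa Ab Ac Ad ab ac ad bc bd cd p q r =
      cons Aa p (path₂ (Ab , ≢-sym ab) (Ac , ≢-sym ac) (Ad , ≢-sym ad) bc bd cd q r)

    -- c has degree exactly 3, which forces k = 2. Length 2 is realised through c, length 3 through
    -- c and z.
    small : ∀ {c} → ordinary c → (∀ {b} → b ∈ U → e E c b → b ≡ x ⊎ (b ≡ y ⊎ b ≡ z)) → z ∈ U → z ≢ x → z ≢ y →
            e E z x ⊎ e E z y → Done
    small {c} oc@(cU , cx , cy , cz) nbc zU zx zy zxy = go (e? E c x) (e? E c y) (e? E c z) zxy
      where
      d≥3 : 3 ≤ # (nb E c ∩ U)
      d≥3 = ≤-trans (s≤s k≥2) (deg-ord oc)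
      not2 : ∀ a b → ¬ (∀ {t} → t ∈ (nb E c ∩ U) → t ≡ a ⊎ t ≡ b)
      not2 a b f = <⇒≱ (s≤s (#-two {nb E c ∩ U} a b f)) d≥3
      k≡2 : k ≡ 2
      k≡2 = ≤-antisym (s≤s⁻¹ (≤-trans (deg-ord oc) (≤-trans (#-∪ {⁅ x ⁆} {⁅ y ⁆ ∪ ⁅ z ⁆} (λ (a , b) → nbc b a))
              (+-mono-≤ (#-one {⁅ x ⁆} x (λ t → t)) (#-two {⁅ y ⁆ ∪ ⁅ z ⁆} y z (λ t → t)))))) k≥2
      go : Dec (e E c x) → Dec (e E c y) → Dec (e E c z) → e E z x ⊎ e E z y → Done
      go (no n) _ _ _ = ⊥-elim (not2 y z (λ (a , b) → Data.Sum.[ (λ { refl → ⊥-elim (n a) }) , (λ s → s) ]′ (nbc b a)))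
      go _ (no n) _ _ = ⊥-elim (not2 x z (λ (a , b) → Data.Sum.map₂ Data.Sum.[ (λ { refl → ⊥-elim (n a) }) , (λ s → s) ]′ (nbc b a)))
      go _ _ (no n) _ = ⊥-elim (not2 x y (λ (a , b) → Data.Sum.map₂ Data.Sum.[ (λ s → s) , (λ { refl → ⊥-elim (n a) }) ]′ (nbc b a)))
      go (yes p) (yes q) (yes r) s = adm₂ k≡2 ≤-refl (inj₁ refl)
        (path₂ x∈U cU y∈U (≢-sym cx) x≢y cy (e-sym E p) q) (three s)
        where
        three : e E z x ⊎ e E z y → Path (e E) (has U) x y 3
        three (inj₁ zx') = path₃ x∈U zU cU y∈U (≢-sym zx) (≢-sym cx) x≢y (≢-sym cz) zy cy (e-sym E zx') (e-sym E r) q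
        three (inj₂ zy') = path₃ x∈U cU zU y∈U (≢-sym cx) (≢-sym zx) x≢y cz cy zy (e-sym E p) r zy'

    -- P is deleted along with z. Apart from the roots only c loses neighbours, so c takes over the
    -- role of z. The neighbours c₁ and c₂ prevent a single cut vertex from isolating c.
    attached-to-roots : ∀ (P : Sub) → P ⊆ U → x ∉ P → y ∉ P → z ∈ P → ∀ c → Nb P (⁅ x ⁆ ∪ (⁅ y ⁆ ∪ ⁅ c ⁆)) →
         ∀ {c₁ c₂} → c₁ ∈ U → c₂ ∈ U → c₁ ∉ P → c₂ ∉ P → c₁ ≢ c₂ → e E c c₁ → e E c c₂ →
         ∀ {o} → o ∈ U → o ∉ P → o ≢ x → o ≢ y → o ≢ c → Done
    attached-to-roots P P⊆ x∉ y∉ zP c nbP {c₁} {c₂} c₁U c₂U c₁∉ c₂∉ c₁₂ cc₁ cc₂ {o} oU o∉ ox oy oc = done (rooted? E H x y)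
      where
      H : Sub
      H = U ∖ P
      done : Rooted E H x y ⊎ Piece E H x y → Done
      done (inj₁ R) = adm-mono proj₁ (sub-adm k≥1 H proj₁ (P⊆ zP) (λ a → proj₂ a zP) x y c (x∈U , x∉) (y∈U , y∉) x≢y R dg (oU , o∉) ox oy oc)
        where
        dg : ∀ {v} → v ∈ H → v ≢ x → v ≢ y → v ≢ c → suc k ≤ # (nb E v ∩ H)
        dg {v} (vU , v∉) vx vy vc = deg-in H vU vx vy (λ { refl → v∉ zP }) λ {b} bU vb → bU , λ bP →
          Data.Sum.[ v∉ , Data.Sum.[ vx , Data.Sum.[ vy , vc ]′ ]′ ]′ (nbP bP vU (e-sym E vb))
      done (inj₂ Π) = rest (has? K c)
        where
        open Piece Π
        KU : ∀ {t} → t ∈ K → t ∈ U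
        KU a = proj₁ (K⊆U a)
        nbK : ∀ {a b} → a ∈ K → b ∈ U → e E a b → b ∈ K ⊎ (b ≡ w ⊎ a ≡ c)
        nbK {a} {b} aK bU ab with has? P b
        ... | no b∉ = Data.Sum.map₂ inj₁ (closed aK (bU , b∉) ab)
        ... | yes bP with nbP bP (KU aK) (e-sym E ab)
        ... | inj₁ aP = ⊥-elim (proj₂ (K⊆U aK) aP)
        ... | inj₂ (inj₁ refl) = ⊥-elim (x∉K aK)
        ... | inj₂ (inj₂ (inj₁ refl)) = ⊥-elim (y∉K aK)
        ... | inj₂ (inj₂ (inj₂ s)) = inj₂ (inj₂ s)
        K≢z : ∀ {t} → t ∈ K → t ≢ z
        K≢z a refl = proj₂ (K⊆U a) zP
        rest : Dec (c ∈ K) → Done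
        rest (no c∉) = two-attachments' K KU x∉K y∉K w (proj₁ some) nb2 x≢y x∈U y∈U x∉K y∉K (≢-sym (∈≢ {K} (proj₂ some) x∉K)) (≢-sym (∈≢ {K} (proj₂ some) y∉K)) (proj₂ some) (K≢z (proj₂ some))
          where
          nb2 : Nb K (⁅ w ⁆ ∪ ⁅ proj₁ some ⁆)
          nb2 aK bU ab with nbK aK bU ab
          ... | inj₁ s = inj₁ s
          ... | inj₂ (inj₁ s) = inj₂ (inj₁ s)
          ... | inj₂ (inj₂ refl) = ⊥-elim (c∉ aK)
        rest (yes cK) with ∃? (has? (K - c))
        ... | yes (t , tK) = two-attachments' (K - c) (λ a → KU (proj₁ a)) (λ a → x∉K (proj₁ a)) (λ a → y∉K (proj₁ a)) w c nb2
                               x≢y x∈U y∈U (λ a → x∉K (proj₁ a)) (λ a → y∉K (proj₁ a)) (≢-sym (∈≢ {K} cK x∉K)) (≢-sym (∈≢ {K} cK y∉K)) tK (K≢z (proj₁ tK))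
          where
          nb2 : Nb (K - c) (⁅ w ⁆ ∪ ⁅ c ⁆)
          nb2 {a} {b} (aK , ac) bU ab with nbK aK bU ab | b ≟ c
          ... | _ | yes s = inj₂ (inj₂ s)
          ... | inj₁ s | no n = inj₁ (s , n)
          ... | inj₂ (inj₁ s) | no _ = inj₂ (inj₁ s)
          ... | inj₂ (inj₂ s) | no _ = ⊥-elim (ac s)
        ... | no none = ⊥-elim (c₁₂ (trans (is c₁U c₁∉ cc₁) (≡-sym (is c₂U c₂∉ cc₂))))
          where
          is : ∀ {t} → t ∈ U → t ∉ P → e E c t → t ≡ w
          is {t} tU t∉ ct with closed cK (tU , t∉) ct
          ... | inj₂ s = s
          ... | inj₁ tK = ⊥-elim (none (t , tK , λ { refl → e-irr E ct }))

    -- z is deleted by means of `attached-to-roots`, which wants a vertex left over; if c has no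
    -- neighbour besides x, y and z, the situation is that of `small`.
    exceptional-near-roots : z ∈ U → z ≢ x → z ≢ y → ∀ c → ordinary c → (∀ {b} → b ∈ U → e E z b → b ≡ x ⊎ (b ≡ y ⊎ b ≡ c)) → Done
    exceptional-near-roots zU zx zy c oc nbz with ∃? (λ t → has? U t ×-dec (e? E c t ×-dec (¬? (t ≟ x) ×-dec (¬? (t ≟ y) ×-dec ¬? (t ≟ z)))))
    ... | yes (o , oU , co , ox , oy , oz) with third-neighbour oc z z
    ... | c₁ , c₁U , cc₁ , c₁z , _ with third-neighbour oc z c₁
    ... | c₂ , c₂U , cc₂ , c₂z , c₂₁ = attached-to-roots ⁅ z ⁆ (λ { refl → zU }) (≢-sym zx) (≢-sym zy) refl c
      (λ { refl bU zb → inj₂ (nbz bU zb) }) c₁U c₂U c₁z c₂z (≢-sym c₂₁) cc₁ cc₂ oU oz ox oy (≢-sym (e-≢ E co))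
    exceptional-near-roots zU zx zy c oc nbz | no none = small oc nbc zU zx zy (Data.Sum.[ first (≢-sym zx) , (λ w → first (≢-sym zy) w) ]′ (rooted c z zU (≢-sym (proj₂ (proj₂ (proj₂ oc))))))
      where
      nbc : ∀ {b} → b ∈ U → e E c b → b ≡ x ⊎ (b ≡ y ⊎ b ≡ z)
      nbc {b} bU cb with b ≟ x | b ≟ y | b ≟ z
      ... | yes s | _ | _ = inj₁ s
      ... | no _ | yes s | _ = inj₂ (inj₁ s)
      ... | no _ | no _ | yes s = inj₂ (inj₂ s)
      ... | no n₁ | no n₂ | no n₃ = ⊥-elim (none (b , bU , cb , n₁ , n₂ , n₃))
      -- A walk from z to a root that avoids c enters a root at its very first step.
      first : ∀ {r} → r ≢ z → Walk (e E) (has (U - c)) z r → e E z x ⊎ e E z y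
      first rz (here s _) = ⊥-elim (rz (≡-sym s))
      first rz (step _ zb w) with nbz (proj₁ (walk-start w)) zb
      ... | inj₁ refl = inj₁ zb
      ... | inj₂ (inj₁ refl) = inj₂ zb
      ... | inj₂ (inj₂ s) = ⊥-elim (proj₂ (walk-start w) s)

    -- The neighbour q can serve as a root instead of y.
    near-pendant-root : ¬ e E x y → ∀ q → (∀ {b} → b ∈ U → e E y b → b ≡ q ⊎ b ≡ z) → Done
    near-pendant-root nxy q nby = choose (has? U q ×-dec e? E y q)
      where
      module Root (q : V) (qU : q ∈ U) (yq : e E y q) (nby : ∀ {b} → b ∈ U → e E y b → b ≡ q ⊎ b ≡ z) where
        H : Sub
        H = U - y
        q≢x : q ≢ x
        q≢x refl = nxy (e-sym E yq)
        q≢y : q ≢ y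
        q≢y = ≢-sym (e-≢ E yq)
        done : Rooted E H x q ⊎ Piece E H x q → Done
        done (inj₁ R) with ∃? (λ v → has? U v ×-dec (¬? (v ≟ x) ×-dec (¬? (v ≟ y) ×-dec (¬? (v ≟ q) ×-dec ¬? (v ≟ z)))))
        ... | yes (v , vU , vx , vy , vq , vz) =
              sandwich (sub-adm k≥1 H proj₁ y∈U (λ a → proj₂ a refl) x q z (x∈U , x≢y) (qU , q≢y) (≢-sym q≢x) R dg (vU , vy) vx vq vz)
                (0 , nil {A = _≡ x} refl refl)
                (1 , path-edge E {A = λ t → t ≡ y ⊎ t ≡ q} (inj₁ refl) (inj₂ refl) yq)
                proj₁ (λ { refl → x∈U , λ _ → refl })
                (λ { (inj₁ refl) → y∈U , (λ a → ⊥-elim (proj₂ a refl)) ; (inj₂ refl) → qU , λ _ → refl })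
                (λ { refl (inj₁ s) → x≢y s ; refl (inj₂ s) → q≢x (≡-sym s) })
          where
          -- The deletion of y costs only q and z a neighbour; the former is now a root, the latter
          -- is exempt.
          dg : ∀ {v} → v ∈ H → v ≢ x → v ≢ q → v ≢ z → suc k ≤ # (nb E v ∩ H)
          dg (vU , vy) vx vq vz = deg-in H vU vx vy vz λ bU vb → bU , λ { refl → Data.Sum.[ vq , vz ]′ (nby vU (e-sym E vb)) }
        ... | no none = tiny (proj₂ inner) (q ≟ z)
          where
          all : ∀ {v} → v ∈ U → v ≢ x → v ≢ y → v ≢ q → v ≡ z
          all {v} vU vx vy vq with v ≟ z
          ... | yes s = s
          ... | no n = ⊥-elim (none (v , vU , vx , vy , vq , n))
          tiny : (proj₁ inner ∈ U × proj₁ inner ≢ x × proj₁ inner ≢ y × proj₁ inner ≢ z) → Dec (q ≡ z) → Done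
          tiny (vU , vx , vy , vz) (yes refl) = ⊥-elim (vz (all vU vx vy vz))
          tiny _ (no qz) = small oq nbq zU zx zy zn
            where
            oq : ordinary q
            oq = qU , q≢x , q≢y , qz
            nbq : ∀ {b} → b ∈ U → e E q b → b ≡ x ⊎ (b ≡ y ⊎ b ≡ z)
            nbq {b} bU qb with b ≟ x | b ≟ y
            ... | yes s | _ = inj₁ s
            ... | no _ | yes s = inj₂ (inj₁ s)
            ... | no n₁ | no n₂ = inj₂ (inj₂ (all bU n₁ n₂ (≢-sym (e-≢ E qb))))
            t = third-neighbour oq x y
            tz : proj₁ t ≡ z
            tz = all (proj₁ (proj₂ t)) (proj₁ (proj₂ (proj₂ (proj₂ t)))) (proj₂ (proj₂ (proj₂ (proj₂ t)))) (≢-sym (e-≢ E (proj₁ (proj₂ (proj₂ t)))))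
            zU : z ∈ U
            zU = subst (_∈ U) tz (proj₁ (proj₂ t))
            zx : z ≢ x
            zx s = proj₁ (proj₂ (proj₂ (proj₂ t))) (trans tz s)
            zy : z ≢ y
            zy s = proj₂ (proj₂ (proj₂ (proj₂ t))) (trans tz s)
            first : ∀ {r} → r ≢ z → Walk (e E) (has (U - q)) z r → e E z x ⊎ e E z y
            first rz (here s _) = ⊥-elim (rz (≡-sym s))
            first rz (step {w = b} _ zb w) with b ≟ x | b ≟ y
            ... | yes refl | _ = inj₁ zb
            ... | no _ | yes refl = inj₂ zb
            ... | no n₁ | no n₂ = ⊥-elim (e-≢ E zb (≡-sym (all (proj₁ (walk-start w)) n₁ n₂ (proj₂ (walk-start w)))))
            zn : e E z x ⊎ e E z y
            zn = Data.Sum.[ first (≢-sym zx) , first (≢-sym zy) ]′ (rooted q z zU (≢-sym qz))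
        done (inj₂ Π) with ∃? (has? (Piece.K Π - z))
        ... | yes (t , tK , tz) = two-attachments' K (λ a → proj₁ (K⊆U a)) x∉K (λ a → proj₂ (K⊆U a) refl) w y nbK
                                  (≢-sym q≢x) x∈U qU x∉K y∉K x≢y q≢y tK tz
          where
          open Piece Π
          nbK : Nb K (⁅ w ⁆ ∪ ⁅ y ⁆)
          nbK {b = b} aK bU ab with b ≟ y
          ... | yes s = inj₂ (inj₂ s)
          ... | no n = Data.Sum.map₂ inj₁ (closed aK (bU , n) ab)
        ... | no none = zdone (has? U w ×-dec (¬? (w ≟ x) ×-dec ¬? (w ≟ y)))
          where
          open Piece Π
          is-z : ∀ {t} → t ∈ K → t ≡ z
          is-z {t} a with t ≟ z
          ... | yes s = s
          ... | no n = ⊥-elim (none (t , a , n))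
          zK : z ∈ K
          zK = subst (_∈ K) (is-z (proj₂ some)) (proj₂ some)
          nbz : ∀ {b} → b ∈ U → e E z b → b ≡ y ⊎ b ≡ w
          nbz {b} bU zb with b ≟ y
          ... | yes s = inj₁ s
          ... | no n with closed zK (bU , n) zb
          ... | inj₁ bK = ⊥-elim (e-≢ E zb (≡-sym (is-z bK)))
          ... | inj₂ s = inj₂ s
          zU = proj₁ (K⊆U zK)
          zx = ∈≢ {K} zK x∉K
          zy = proj₂ (K⊆U zK)
          zdone : Dec (w ∈ U × w ≢ x × w ≢ y) → Done
          zdone (yes (wU , wx , wy)) = exceptional-near-roots zU zx zy w (wU , wx , wy , ≢-sym (∈≢ {K} zK w∉K)) (λ bU zb → inj₂ (nbz bU zb))
          zdone (no n) = exceptional-near-roots zU zx zy q (qU , q≢x , q≢y , ≢-sym (∈≢ {K} zK y∉K)) f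
            where
            f : ∀ {b} → b ∈ U → e E z b → b ≡ x ⊎ (b ≡ y ⊎ b ≡ q)
            f {b} bU zb with nbz bU zb
            ... | inj₁ s = inj₂ (inj₁ s)
            ... | inj₂ refl with b ≟ x | b ≟ y
            ... | yes s | _ = inj₁ s
            ... | no _ | yes s = inj₂ (inj₁ s)
            ... | no n₁ | no n₂ = ⊥-elim (n (bU , n₁ , n₂))
      choose : Dec (q ∈ U × e E y q) → Done
      choose (yes (qU , yq)) = Root.done q qU yq nby (rooted? E (U - y) x q)
      -- All neighbours of y in U are then equal to z, so z itself serves as the new root.
      choose (no n) = Root.done z (proj₁ ny) (proj₂ ny) (λ bU yb → inj₁ (only bU yb)) (rooted? E (U - y) x z)
        where
        only : ∀ {b} → b ∈ U → e E y b → b ≡ z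
        only bU yb with nby bU yb
        ... | inj₁ refl = ⊥-elim (n (bU , yb))
        ... | inj₂ s = s
        first : ∀ {r} → r ≢ y → Walk (e E) (has U) y r → z ∈ U × e E y z
        first ry (here s _) = ⊥-elim (ry (≡-sym s))
        first ry (step _ yb w) with only (walk-start w) yb
        ... | refl = walk-start w , yb
        ny : z ∈ U × e E y z
        ny = first x≢y reach-xy

    deg-loss₁ : ∀ {v} (H : Sub) u → ordinary v → (∀ {b} → b ∈ U → e E v b → b ∈ H ⊎ b ≡ u) → k ≤ # (nb E v ∩ H)
    deg-loss₁ {v} H u o f = s≤s⁻¹ (≤-trans (deg-ord o) (≤-trans
      (#-∪ {nb E v ∩ H} {⁅ u ⁆} λ (vb , bU) → Data.Sum.map₁ (vb ,_) (f bU vb))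
      (≤-trans (+-monoʳ-≤ _ (#-one {⁅ u ⁆} u (λ t → t))) (≤-reflexive (+-comm _ 1)))))

    -- One path less is needed inside K ∪ {x, h}, because the two continuations to y supply one more length.
    behind-three : ∀ (K : Sub) → K ⊆ U → x ∉ K → y ∉ K → z ∈ K → ∀ h u → h ∈ U → h ≢ x → h ≢ y → h ∉ K →
             u ∉ K → u ≢ x → u ≢ y → u ≢ h → Nb K (⁅ x ⁆ ∪ (⁅ h ⁆ ∪ ⁅ u ⁆)) →
             (∀ {v} → v ∈ K → Walk (e E) (has K) z v) → ∀ {v₀} → v₀ ∈ K → v₀ ≢ z →
             (∀ {v} → v ∈ K → e E v x → e E v h → ⊥) →
             ∀ (A : V → Set) → (∀ {t} → A t → t ∈ U × t ∉ K × t ≢ x) →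
             ∀ {n d} → d ≡ 1 ⊎ d ≡ 2 → Path (e E) A h y n → Path (e E) A h y (n + d) → Done
    behind-three K K⊆ x∉ y∉ zK h u hU hx hy h∉ u∉ ux uy uh nbK conn {v₀} v₀K v₀z excl A A⊆ {n} {d} d≡ p₁ p₂ =
      done (rooted? E H x h)
      where
      H : Sub
      H = K ∪ (⁅ x ⁆ ∪ ⁅ h ⁆)
      H⊆ : H ⊆ U
      H⊆ (inj₁ a) = K⊆ a
      H⊆ (inj₂ (inj₁ refl)) = x∈U
      H⊆ (inj₂ (inj₂ refl)) = hU
      y∉H : y ∉ H
      y∉H (inj₁ a) = y∉ a
      y∉H (inj₂ (inj₁ s)) = x≢y (≡-sym s)
      y∉H (inj₂ (inj₂ s)) = hy (≡-sym s)
      ord : ∀ {v} → v ∈ K → v ≢ z → ordinary v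
      ord a b = K⊆ a , ∈≢ {K} a x∉ , ∈≢ {K} a y∉ , b
      in-H : ∀ {v} → v ∈ K → ∀ {b} → b ∈ U → e E v b → b ∈ H ⊎ b ≡ u
      in-H vK bU vb with nbK vK bU vb
      ... | inj₁ s = inj₁ (inj₁ s)
      ... | inj₂ (inj₁ s) = inj₁ (inj₂ (inj₁ s))
      ... | inj₂ (inj₂ (inj₁ s)) = inj₁ (inj₂ (inj₂ s))
      ... | inj₂ (inj₂ (inj₂ s)) = inj₂ s
      k₁ : ℕ
      k₁ = k ∸ 1
      k≡ : suc k₁ ≡ k
      k≡ = m+[n∸m]≡n k≥1
      k₁≥ : 1 ≤ k₁
      k₁≥ = ∸-monoˡ-≤ 1 k≥2

      finish : Adm (e E) (has H) k₁ x h → Done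
      finish (adm b f b≥ f≡ P) with progression-sum (Path (e E) (has U) x y) {k₁} {2} {b} {n} {f} {d} f≡ d≡ k₁≥ (s≤s z≤n) F
        where
        glue : ∀ {m l} → Path (e E) (has H) x h m → Path (e E) A h y l → Path (e E) (has U) x y (m + l)
        glue p q = path-mono (λ { (inj₁ a) → H⊆ a ; (inj₂ a) → proj₁ (A⊆ a) })
          (path-append p q λ { (inj₁ a) c → ⊥-elim (proj₁ (proj₂ (A⊆ c)) a)
                             ; (inj₂ (inj₁ s)) c → ⊥-elim (proj₂ (proj₂ (A⊆ c)) s) ; (inj₂ (inj₂ s)) c → s })
        F : ∀ i j → i < k₁ → j < 2 → Path (e E) (has U) x y ((b + i * f) + (n + j * d))
        F i zero i< _ = subst (λ t → Path (e E) (has U) x y ((b + i * f) + t)) (≡-sym (+-identityʳ n)) (glue (P i i<) p₁)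
        F i (suc zero) i< _ = subst (λ t → Path (e E) (has U) x y ((b + i * f) + (n + t))) (≡-sym (+-identityʳ d)) (glue (P i i<) p₂)
        F i (suc (suc _)) _ (s≤s (s≤s ()))
      ... | g , g≡ , Q = adm (b + n) g (≤-trans b≥ (m≤m+n b n)) g≡ λ t t< →
            Q t (≤-trans (s≤s t<) (≤-reflexive (trans (cong suc (≡-sym k≡)) (+-comm 2 k₁))))

      KofH : ∀ {t} → t ∈ H → t ≢ x → t ≢ h → t ∈ K
      KofH (inj₁ a) _ _ = a
      KofH (inj₂ (inj₁ s)) n _ = ⊥-elim (n s)
      KofH (inj₂ (inj₂ s)) _ n = ⊥-elim (n s)

      -- z is pendant at w in H, since u is outside H. It is dropped, and w becomes exceptional.
      module Pend (w : V) (w∈K : w ∈ K) (wz : w ≢ z) (nbz : ∀ {b} → b ∈ U → e E z b → b ≡ w ⊎ b ≡ u) where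
        K₀ H₂ : Sub
        K₀ = K - z
        H₂ = K₀ ∪ (⁅ x ⁆ ∪ ⁅ h ⁆)
        H₂H : H₂ ⊆ H
        H₂H (inj₁ a) = inj₁ (proj₁ a)
        H₂H (inj₂ a) = inj₂ a
        nb₀ : ∀ {v} → v ∈ K₀ → ∀ {b} → b ∈ U → e E v b → (b ∈ H₂ ⊎ b ≡ u) ⊎ (b ≡ z × v ≡ w)
        nb₀ {v} vK {b} bU vb with in-H (proj₁ vK) bU vb
        ... | inj₂ s = inj₁ (inj₂ s)
        ... | inj₁ (inj₂ s) = inj₁ (inj₁ (inj₂ s))
        ... | inj₁ (inj₁ bK) with b ≟ z
        ... | no nz = inj₁ (inj₁ (inj₁ (bK , nz)))
        ... | yes refl with nbz (K⊆ (proj₁ vK)) (e-sym E vb)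
        ... | inj₁ s = inj₂ (refl , s)
        ... | inj₂ refl = ⊥-elim (u∉ (proj₁ vK))
        done₂ : Rooted E H₂ x h ⊎ Piece E H₂ x h → Done
        done₂ (inj₁ R) with ∃? (has? (K₀ - w))
        ... | yes (t , tK , tw) = finish (adm-mono (λ {t} a → H₂H {t} a)
                (sub-adm k₁≥ H₂ (λ {t} a → H⊆ {t} (H₂H {t} a)) y∈U (λ a → y∉H (H₂H a)) x h w (inj₂ (inj₁ refl)) (inj₂ (inj₂ refl)) (≢-sym hx) R dg
                  (inj₁ tK) (∈≢ {K} (proj₁ tK) x∉) (∈≢ {K} (proj₁ tK) h∉) tw))
          where
          dg : ∀ {v} → v ∈ H₂ → v ≢ x → v ≢ h → v ≢ w → suc k₁ ≤ # (nb E v ∩ H₂)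
          dg (inj₂ (inj₁ s)) n _ _ = ⊥-elim (n s)
          dg (inj₂ (inj₂ s)) _ n _ = ⊥-elim (n s)
          dg (inj₁ vK) _ _ vw = ≤-trans (≤-reflexive k≡) (deg-loss₁ H₂ u (ord (proj₁ vK) (proj₂ vK)) λ bU vb →
            Data.Sum.[ (λ s → s) , (λ (_ , s) → ⊥-elim (vw s)) ]′ (nb₀ vK bU vb))
        ... | no none = two (e? E w x)
          where
          all : ∀ {t} → t ∈ K → t ≡ z ⊎ t ≡ w
          all {t} a with t ≟ z | t ≟ w
          ... | yes s | _ = inj₁ s
          ... | no _ | yes s = inj₂ s
          ... | no n₁ | no n₂ = ⊥-elim (none (t , (a , n₁) , n₂))
          -- K is just z and w. By `excl` w is adjacent to at most one of x and h, so K has only two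
          -- attachments, one of them u.
          two : Dec (e E w x) → Done
          two (yes wx) = two-attachments K K⊆ x∉ y∉ x u nbw y∈U y∉ (≢-sym x≢y) (≢-sym uy) w∈K wz
            where
            nbw : Nb K (⁅ x ⁆ ∪ ⁅ u ⁆)
            nbw aK bU ab with nbK aK bU ab | all aK
            ... | inj₁ s | _ = inj₁ s
            ... | inj₂ (inj₁ s) | _ = inj₂ (inj₁ s)
            ... | inj₂ (inj₂ (inj₂ s)) | _ = inj₂ (inj₂ s)
            ... | inj₂ (inj₂ (inj₁ refl)) | inj₁ refl = Data.Sum.[ (λ { refl → ⊥-elim (h∉ w∈K) }) , (λ s → inj₂ (inj₂ s)) ]′ (nbz bU ab)
            ... | inj₂ (inj₂ (inj₁ refl)) | inj₂ refl = ⊥-elim (excl w∈K wx ab)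
          two (no nwx) = two-attachments K K⊆ x∉ y∉ h u nbw y∈U y∉ (≢-sym hy) (≢-sym uy) w∈K wz
            where
            nbw : Nb K (⁅ h ⁆ ∪ ⁅ u ⁆)
            nbw aK bU ab with nbK aK bU ab | all aK
            ... | inj₁ s | _ = inj₁ s
            ... | inj₂ (inj₂ s) | _ = inj₂ s
            ... | inj₂ (inj₁ refl) | inj₁ refl = Data.Sum.[ (λ { refl → ⊥-elim (x∉ w∈K) }) , (λ s → inj₂ (inj₂ s)) ]′ (nbz bU ab)
            ... | inj₂ (inj₁ refl) | inj₂ refl = ⊥-elim (nwx ab)
        done₂ (inj₂ Π) = rest (has? K'' w)
          where
          open Piece Π renaming (K to K'' ; w to w₃ ; K⊆U to K''⊆)
          inK : ∀ {t} → t ∈ K'' → t ∈ K₀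
          inK {t} a with K''⊆ a
          ... | inj₁ b = b
          ... | inj₂ (inj₁ refl) = ⊥-elim (x∉K a)
          ... | inj₂ (inj₂ refl) = ⊥-elim (y∉K a)
          rest : Dec (w ∈ K'') → Done
          rest (no w∉'') = two-attachments' K'' (λ a → K⊆ (proj₁ (inK a))) x∉K (λ a → y∉ (proj₁ (inK a))) w₃ u nb₃ x≢y x∈U y∈U x∉K
                            (λ a → y∉ (proj₁ (inK a))) (≢-sym ux) (≢-sym uy) (proj₂ some) (proj₂ (inK (proj₂ some)))
            where
            nb₃ : Nb K'' (⁅ w₃ ⁆ ∪ ⁅ u ⁆)
            nb₃ aK bU ab with nb₀ (inK aK) bU ab
            ... | inj₁ (inj₁ bH) = Data.Sum.map₂ inj₁ (closed aK bH ab)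
            ... | inj₁ (inj₂ s) = inj₂ (inj₂ s)
            ... | inj₂ (_ , refl) = ⊥-elim (w∉'' aK)
          rest (yes w∈'') = two-attachments' P P⊆ x∉P y∉P w₃ u nb₃ x≢y x∈U y∈U x∉P y∉P (≢-sym ux) (≢-sym uy) {w} (inj₁ w∈'') wz
            where
            P : Sub
            P = K'' ∪ ⁅ z ⁆
            PK : ∀ {t} → t ∈ P → t ∈ K
            PK (inj₁ a) = proj₁ (inK a)
            PK (inj₂ refl) = zK
            P⊆ : P ⊆ U
            P⊆ a = K⊆ (PK a)
            x∉P : x ∉ P
            x∉P a = x∉ (PK a)
            y∉P : y ∉ P
            y∉P a = y∉ (PK a)
            nb₃ : Nb P (⁅ w₃ ⁆ ∪ ⁅ u ⁆)
            nb₃ (inj₁ aK) bU ab with nb₀ (inK aK) bU ab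
            ... | inj₁ (inj₁ bH) = Data.Sum.map inj₁ inj₁ (closed aK bH ab)
            ... | inj₁ (inj₂ s) = inj₂ (inj₂ s)
            ... | inj₂ (s , _) = inj₁ (inj₂ s)
            nb₃ (inj₂ refl) bU ab with nbz bU ab
            ... | inj₁ refl = inj₁ (inj₁ w∈'')
            ... | inj₂ s = inj₂ (inj₂ s)

      done : Rooted E H x h ⊎ Piece E H x h → Done
      done (inj₁ R) = finish (sub-adm k₁≥ H H⊆ y∈U y∉H x h z (inj₂ (inj₁ refl)) (inj₂ (inj₂ refl)) (≢-sym hx) R dg
                        (inj₁ v₀K) (∈≢ {K} v₀K x∉) (∈≢ {K} v₀K h∉) v₀z)
        where
        dg : ∀ {v} → v ∈ H → v ≢ x → v ≢ h → v ≢ z → suc k₁ ≤ # (nb E v ∩ H)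
        dg (inj₂ (inj₁ s)) n _ _ = ⊥-elim (n s)
        dg (inj₂ (inj₂ s)) _ n _ = ⊥-elim (n s)
        dg (inj₁ vK) _ _ vz = ≤-trans (≤-reflexive k≡) (deg-loss₁ H u (ord vK vz) (in-H vK))
      done (inj₂ Π) with ∃? (has? (Piece.K Π - z))
      ... | yes (t , tK , tz) = two-attachments' K' (λ a → K⊆ (inK a)) x∉K (λ a → y∉ (inK a)) w u nb₃ x≢y x∈U y∈U x∉K (λ a → y∉ (inK a)) (≢-sym ux) (≢-sym uy) tK tz
        where
        open Piece Π renaming (K to K')
        inK : ∀ {t} → t ∈ K' → t ∈ K
        inK a = KofH (K⊆U a) (∈≢ {K'} a x∉K) (∈≢ {K'} a y∉K)
        nb₃ : Nb K' (⁅ w ⁆ ∪ ⁅ u ⁆)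
        nb₃ aK bU ab with in-H (inK aK) bU ab
        ... | inj₁ bH = Data.Sum.map₂ inj₁ (closed aK bH ab)
        ... | inj₂ s = inj₂ (inj₂ s)
      ... | no none = step-out (conn v₀K)
        where
        open Piece Π renaming (K to K')
        is-z : ∀ {t} → t ∈ K' → t ≡ z
        is-z {t} a with t ≟ z
        ... | yes s = s
        ... | no n = ⊥-elim (none (t , a , n))
        zK' : z ∈ K'
        zK' = subst (_∈ K') (is-z (proj₂ some)) (proj₂ some)
        nbz : ∀ {b} → b ∈ U → e E z b → b ≡ w ⊎ b ≡ u
        nbz bU zb with in-H zK bU zb
        ... | inj₂ s = inj₂ s
        ... | inj₁ bH with closed zK' bH zb
        ... | inj₁ bK = ⊥-elim (e-≢ E zb (≡-sym (is-z bK)))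
        ... | inj₂ s = inj₁ s
        step-out : Walk (e E) (has K) z v₀ → Done
        step-out (here s _) = ⊥-elim (v₀z (≡-sym s))
        step-out (step {w = b} _ zb wk) with nbz (K⊆ (walk-start wk)) zb
        ... | inj₂ refl = ⊥-elim (u∉ (walk-start wk))
        ... | inj₁ refl = Pend.done₂ b (walk-start wk) (≢-sym (e-≢ E zb)) nbz (rooted? E (Pend.H₂ b (walk-start wk) (≢-sym (e-≢ E zb)) nbz) x h)

    -- Prefix structures

    -- From x one reaches every vertex of S outside Q through Q, by p paths whose lengths form an arithmetic progression.
    record Prefix : Set₁ where
      field
        Q S    : Sub
        p len₀ dif : ℕ
        Q⊆U    : Q ⊆ U
        x∈Q    : x ∈ Q
        y∉Q    : y ∉ Q
        extra  : ∃ λ o → o ∈ Q × o ≢ x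
        p≥1    : 1 ≤ p
        len₀≥1  : 1 ≤ len₀
        dif≡   : dif ≡ 1 ⊎ dif ≡ 2
        prefix : ∀ {s} → s ∈ S → s ∈ U → s ∉ Q → ∀ j → j < p → Path (e E) (λ t → t ∈ Q ⊎ t ≡ s) x s (len₀ + j * dif)
      D : Sub
      D = comp E (U ∖ Q) y
      G : Rel
      G = star E x S
      D⊆U : D ⊆ U
      D⊆U a = proj₁ (walk-end a)
      D∌Q : ∀ {v} → v ∈ D → v ∉ Q
      D∌Q a = proj₂ (walk-end a)
      y∈D : y ∈ D
      y∈D = here refl (y∈U , y∉Q)
      D∌x : ∀ {v} → v ∈ D → v ≢ x
      D∌x a refl = D∌Q a x∈Q
      D-closed : ∀ {v b} → v ∈ D → b ∈ U → e E v b → b ∈ D ⊎ b ∈ Q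
      D-closed {v} {b} vD bU vb with has? Q b
      ... | yes q = inj₂ q
      ... | no n = inj₁ (comp-closed E {U ∖ Q} vD (bU , n) vb)

    module _ (Π : Prefix) where
      open Prefix Π

      -- What a vertex can afford to lose in `star`: a vertex of S regains one neighbour, the
      -- contracted root, so it may lose p; the others may lose p - 1.
      LowDeg : V → Set
      LowDeg v = (v ∈ S → # (nb E v ∩ Q) ≤ p) × (v ∉ S → # (nb E v ∩ Q) < p)

      star-edge : ∀ {u v} → u ≢ x → v ≢ x → e G u v → e E u v
      star-edge ux vx (inj₁ (_ , _ , a)) = a
      star-edge ux vx (inj₂ (inj₁ (s , _))) = ⊥-elim (ux s)
      star-edge ux vx (inj₂ (inj₂ (s , _))) = ⊥-elim (vx s)

      star-root : ∀ {s} → e G x s → s ∈ S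
      star-root (inj₁ (a , _)) = ⊥-elim (a refl)
      star-root (inj₂ (inj₁ (_ , _ , a))) = a
      star-root (inj₂ (inj₂ (_ , a , _))) = ⊥-elim (a refl)

      abstract
       -- A path of the contracted graph leaves x towards some s in S, and this edge is replaced by
       -- each of the p prefixes to s; k + 1 - p lengths and p lengths combine to k. The exit ρ and
       -- its path to y allow R to be only a part of the component of y.
       lift : p ≤ k → (R : Sub) → R ⊆ U → (∀ {v} → v ∈ R → v ∉ Q) → ∀ {ρ} → ρ ∈ R →
             ∀ (T : V → Set) → SomePath (e E) T ρ y → (∀ {t} → T t → t ∈ U × t ∉ Q × (t ∈ R → t ≡ ρ)) →
             ∀ ζ → Rooted G (R ∪ ⁅ x ⁆) x ρ →
             (∀ {v} → v ∈ R → v ≢ ρ → v ≢ ζ → ordinary v × LowDeg v × (∀ {b} → b ∈ U → e E v b → b ∈ R ⊎ b ∈ Q)) →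
             ∀ {v} → v ∈ R → v ≢ ρ → v ≢ ζ → Done
       lift p≤k R R⊆ R∌Q {ρ} ρR T (n , pT) T⊆ ζ rt ok {v₀} v₀R v₀ρ v₀ζ = finish sub-done
        where
        R∌x : ∀ {v} → v ∈ R → v ≢ x
        R∌x a refl = R∌Q a x∈Q
        H : Sub
        H = R ∪ ⁅ x ⁆
        k' : ℕ
        k' = suc k ∸ p
        k'≥ : 1 ≤ k'
        k'≥ = m<n⇒0<n∸m (s≤s p≤k)
        H⊆ : H ⊆ U
        H⊆ (inj₁ a) = R⊆ a
        H⊆ (inj₂ refl) = x∈U
        dg : ∀ {v} → v ∈ H → v ≢ x → v ≢ ρ → v ≢ ζ → suc k' ≤ # (nb G v ∩ H)
        dg (inj₂ s) n _ _ = ⊥-elim (n s)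
        dg {v} (inj₁ vR) vx vρ vζ with ok vR vρ vζ
        ... | o , (low₁ , low₂) , cl = go (has? S v)
          where
          total : suc k ≤ # (nb E v ∩ R) + # (nb E v ∩ Q)
          total = ≤-trans (deg-ord o) (#-∪ {nb E v ∩ R} {nb E v ∩ Q} λ (vb , bU) → Data.Sum.map (vb ,_) (vb ,_) (cl bU vb))
          inc : (nb E v ∩ R) ⊆ (nb G v ∩ H)
          inc (a , b) = inj₁ (vx , R∌x b , a) , inj₁ b
          go : Dec (v ∈ S) → suc k' ≤ # (nb G v ∩ H)
          go (yes vS) = ≤-trans (s≤s (≤-trans (∸-monoˡ-≤ p (≤-trans total (+-monoʳ-≤ _ (low₁ vS)))) (≤-reflexive (m+n∸n≡m _ p))))
            (#-< {nb E v ∩ R} {nb G v ∩ H} {x} inc (inj₂ (inj₂ (refl , vx , vS)) , inj₂ refl) (λ (_ , b) → R∌x b refl))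
          go (no vS) = ≤-trans (≤-reflexive (≡-sym (+-∸-assoc 1 (m≤n⇒m≤1+n p≤k))))
            (≤-trans (≤-trans (∸-monoˡ-≤ p (≤-trans (s≤s total) (≤-trans (≤-reflexive (≡-sym (+-suc _ _))) (+-monoʳ-≤ _ (low₂ vS)))))
              (≤-reflexive (m+n∸n≡m _ p))) (#-mono {nb E v ∩ R} {nb G v ∩ H} inc))
        sub-done : Adm (e G) (has H) k' x ρ
        sub-done = ih k'≥ (record { E = G ; U = H ; x = x ; y = ρ ; z = ζ ; x∈U = inj₂ refl ; y∈U = inj₁ ρR ; x≢y = ≢-sym (R∌x ρR)
                                  ; rooted = rt ; deg = dg ; inner = v₀ , inj₁ v₀R , R∌x v₀R , v₀ρ , v₀ζ })
                     (#-< {H} {U} H⊆ (Q⊆U (proj₁ (proj₂ extra))) λ { (inj₁ a) → R∌Q a (proj₁ (proj₂ extra)) ; (inj₂ s) → proj₂ (proj₂ extra) s })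
        finish : Adm (e G) (has H) k' x ρ → Done
        -- The first edge is removed from a path of length at least 2, so at least one edge remains;
        -- with a prefix of length at least 1 the sum is again at least 2.
        finish (adm (suc (suc b)) f (s≤s (s≤s z≤n)) f≡ P) with
          progression-sum (Path (e E) (has U) x y) {k'} {p} {suc b} {len₀ + n} {f} {dif} f≡ dif≡ k'≥ p≥1 F
          where
          F : ∀ i j → i < k' → j < p → Path (e E) (has U) x y ((suc b + i * f) + (len₀ + n + j * dif))
          F i j i< j< with P i i<
          ... | cons {w = s} xH xs rest = subst (Path (e E) (has U) x y) lem
                (path-mono (λ { (inj₁ (inj₁ (inj₁ a))) → Q⊆U a ; (inj₁ (inj₁ (inj₂ refl))) → R⊆ sR ; (inj₁ (inj₂ a)) → R⊆ a ; (inj₂ a) → proj₁ (T⊆ a) })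
                  (path-append (path-append (prefix sS (R⊆ sR) (R∌Q sR) j j<) rest' λ { (inj₁ a) c → ⊥-elim (R∌Q c a) ; (inj₂ s) _ → s })
                    pT λ { (inj₁ (inj₁ a)) c → ⊥-elim (proj₁ (proj₂ (T⊆ c)) a) ; (inj₁ (inj₂ refl)) c → proj₂ (proj₂ (T⊆ c)) sR
                         ; (inj₂ a) c → proj₂ (proj₂ (T⊆ c)) a }))
            where
            sS : s ∈ S
            sS = star-root xs
            unx : ∀ {t} → t ∈ H × t ≢ x → t ∈ R
            unx (inj₁ a , _) = a
            unx (inj₂ s , n) = ⊥-elim (n s)
            rest' : Path (e E) (has R) s ρ (suc b + i * f)
            rest' = path-map (λ a c → star-edge (proj₂ a) (proj₂ c)) unx rest
            sR : s ∈ R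
            sR = path-start rest'
            lem : (len₀ + j * dif + (suc b + i * f)) + n ≡ (suc b + i * f) + (len₀ + n + j * dif)
            lem = solve 4 (λ l jd c n → (l :+ jd :+ c) :+ n := c :+ (l :+ n :+ jd)) refl len₀ (j * dif) (suc b + i * f) n
              where open +-*-Solver
        ... | g , g≡ , W = adm (suc b + (len₀ + n)) g (+-mono-≤ {1} {suc b} {1} (s≤s z≤n) (≤-trans len₀≥1 (m≤m+n len₀ n))) g≡
              λ t t< → W t (≤-trans (s≤s t<) (≤-reflexive (≡-sym (m∸n+n≡m (m≤n⇒m≤1+n p≤k)))))

      -- With at least k prefix lengths any continuation will do.
      direct : k ≤ p → 2 ≤ len₀ → ∀ {s} → s ∈ S → s ∈ D → Done
      direct k≤p len₀≥ {s} sS sD with walk-path (walk-sym E (comp-conn E {U ∖ Q} sD))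
      ... | n , q = adm (len₀ + n) dif (≤-trans len₀≥ (m≤m+n len₀ n)) dif≡ λ i i< →
        subst (Path (e E) (has U) x y) (lem i)
          (path-mono (λ { (inj₁ (inj₁ a)) → Q⊆U a ; (inj₁ (inj₂ refl)) → D⊆U sD ; (inj₂ a) → D⊆U a })
            (path-append (prefix sS (D⊆U sD) (D∌Q sD) i (≤-trans i< k≤p)) q λ { (inj₁ a) c → ⊥-elim (D∌Q c a) ; (inj₂ r) _ → r }))
        where
        lem : ∀ i → len₀ + i * dif + n ≡ len₀ + n + i * dif
        lem i = solve 3 (λ l t n → l :+ t :+ n := l :+ n :+ t) refl len₀ (i * dif) n
          where open +-*-Solver

      -- A part that the contracted graph joins only to w: it misses S, so there is no edge to the
      -- contracted root, although the original graph may join it to Q.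
      record Hang : Set₁ where
        field
          w      : V
          K      : Sub
          w∈D    : w ∈ D
          K⊆D    : K ⊆ D
          some   : ∃ λ v → v ∈ K
          y∉K    : y ∉ K
          w∉K    : w ∉ K
          S∌     : ∀ {v} → v ∈ K → v ∉ S
          closed : ∀ {a b} → a ∈ K → b ∈ U → e E a b → b ∈ K ⊎ (b ≡ w ⊎ b ∈ Q)

      -- What the contraction leaves open: D has at most y and z, or D is a hanging part containing
      -- z with its cut vertex and y. How these cases end depends on the choice of Q.
      data Outcome : Set₁ where
        done   : Done → Outcome
        tiny   : (∀ {v} → v ∈ D → v ≡ y ⊎ v ≡ z) → Outcome
        hangY  : (h : Hang) → let open Hang h in z ∈ K → (∀ {v} → v ∈ K → Walk (e E) (has K) z v) → w ≡ y →
                 (∀ {v} → v ∈ D → v ∈ K ⊎ v ≡ y) → Outcome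
        hangW  : (h : Hang) → let open Hang h in z ∈ K → (∀ {v} → v ∈ K → Walk (e E) (has K) z v) → w ≢ y → w ∈ S → e E y w →
                 (∀ {v} → v ∈ D → v ∈ K ⊎ (v ≡ w ⊎ v ≡ y)) → Outcome

      -- `hyp` disposes of hanging parts without z. One that contains z is chosen as large as
      -- possible, so that the rest of D cannot be cut around it again.
      module Core (p≤k : p ≤ k) (low : ∀ {v} → ordinary v → v ∉ Q → LowDeg v)
                  (hyp : (h : Hang) → z ∉ Hang.K h → Done) where

        conn-D : ∀ {v} → v ∈ D → Walk (e E) (has D) y v
        conn-D = comp-conn E {U ∖ Q}

        no-closed : ∀ (K : V → Set) → ∀ {v} → K v → v ∈ D → ¬ K y → (∀ {a b} → K a → a ∈ D → b ∈ D → e E a b → K b) → ⊥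
        no-closed K kv vD ny cl = ny (walk-stays E {K = K} cl kv (walk-sym E (conn-D vD)))

        C : V → Sub
        C w = comp E (D - w) z

        C⊆D : ∀ {w} → C w ⊆ D
        C⊆D a = proj₁ (walk-end a)

        -- The cut vertices of D behind which z hangs, away from y and from S.
        Cand : V → Set
        Cand w = w ∈ D × w ≢ z × z ∈ D × y ∉ C w × (∀ t → ¬ (t ∈ C w × t ∈ S))

        cand? : ∀ w → Dec (Cand w)
        cand? w = has? D w ×-dec (¬? (w ≟ z) ×-dec (has? D z ×-dec (¬? (has? (C w) y) ×-dec free)))
          where
          free : Dec (∀ t → ¬ (t ∈ C w × t ∈ S))
          free with ∃? (λ t → has? (C w) t ×-dec has? S t)
          ... | yes (t , a) = no λ f → f t a
          ... | no n = yes λ t a → n (t , a)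

        cand-from : ∀ (K : Sub) w → w ∈ D → w ≢ z → z ∈ K → z ∈ D → y ∉ K → (∀ {t} → t ∈ K → t ∉ S) →
                    (∀ {a b} → a ∈ K → a ∈ D → b ∈ D → e E a b → b ∈ K ⊎ b ≡ w) → Cand w
        cand-from K w wD wz zK zD yK SK cl = wD , wz , zD , (λ c → yK (inK c)) , λ t (c , s) → SK (inK c) s
          where
          inK : ∀ {t} → t ∈ C w → t ∈ K
          inK c = walk-stays E {K = has K} (λ a p q ab → Data.Sum.[ (λ s → s) , (λ s → ⊥-elim (proj₂ q s)) ]′ (cl a (proj₁ p) (proj₁ q) ab)) zK c

        C-closed : ∀ {w a b} → a ∈ C w → b ∈ D → e E a b → b ∈ C w ⊎ b ≡ w
        C-closed {w} {a} {b} c bD ab with b ≟ w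
        ... | yes s = inj₂ s
        ... | no n = inj₁ (comp-closed E {D - w} c (bD , n) ab)

        C-closedU : ∀ {w a b} → a ∈ C w → b ∈ U → e E a b → b ∈ C w ⊎ (b ≡ w ⊎ b ∈ Q)
        C-closedU {w} c bU ab with D-closed (C⊆D {w} c) bU ab
        ... | inj₁ bD = Data.Sum.map₂ inj₁ (C-closed {w} c bD ab)
        ... | inj₂ q = inj₂ (inj₂ q)

        touch : ∀ {w} → Cand w → ∃ λ a → a ∈ C w × e E a w
        touch {w} (wD , wz , zD , _) = go (here refl (zD , ≢-sym wz)) (walk-trans (walk-sym E (conn-D zD)) (conn-D wD))
          where
          go : ∀ {a} → a ∈ C w → Walk (e E) (has D) a w → ∃ λ a → a ∈ C w × e E a w
          go c (here refl _) = ⊥-elim (proj₂ (walk-end c) refl)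
          go c (step {w = b} _ ab wk) with C-closed {w} c (walk-start wk) ab
          ... | inj₁ bC = go bC wk
          ... | inj₂ refl = _ , c , ab

        -- If w' lies beyond w as seen from z, then everything behind w, and w itself, is behind w'.
        bigger : ∀ {w w'} → Cand w → w' ∈ D → w' ∉ C w → w' ≢ w → # (C w) < # (C w')
        bigger {w} {w'} cw w'D w'∉ ne = #-< {C w} {C w'} {w} incl w∈ (λ c → proj₂ (walk-end c) refl)
          where
          incl : C w ⊆ C w'
          incl {t} c = walk-mono (λ {s} d → C⊆D {w} d , (λ { refl → w'∉ d })) (comp-conn E {D - w} c)
          w∈ : w ∈ C w'
          w∈ with touch cw
          ... | a , aC , aw = comp-closed E {D - w'} (incl aC) (proj₁ cw , ≢-sym ne) aw

        hang-of : ∀ w → Cand w → Hang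
        hang-of w (wD , wz , zD , yC , free) = record
          { w = w ; K = C w ; w∈D = wD ; K⊆D = C⊆D {w} ; some = z , here refl (zD , ≢-sym wz) ; y∉K = yC
          ; w∉K = λ c → proj₂ (walk-end c) refl ; S∌ = λ a s → free _ (a , s) ; closed = C-closedU {w} }

        plain : ∀ {v} → v ∈ D → v ≢ y → v ≢ z → ordinary v × LowDeg v
        plain vD vy vz = let o = D⊆U vD , D∌x vD , vy , vz in o , low o (D∌Q vD)

        -- K is removed together with z. In the rest only w loses neighbours, so w is the new
        -- exceptional vertex.
        module Cut (w : V) (cw : Cand w) (mx : ∀ u → Cand u → # (C u) ≤ # (C w)) where
          K R H : Sub
          K = C w
          R = D ∖ K
          H = R ∪ ⁅ x ⁆
          wD = proj₁ cw
          wz = proj₁ (proj₂ cw)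
          zD = proj₁ (proj₂ (proj₂ cw))
          yK = proj₁ (proj₂ (proj₂ (proj₂ cw)))
          free = proj₂ (proj₂ (proj₂ (proj₂ cw)))
          zK : z ∈ K
          zK = here refl (zD , ≢-sym wz)
          R≢z : ∀ {v} → v ∈ R → v ≢ z
          R≢z a refl = proj₂ a zK
          fromK : ∀ {a b} → a ∈ K → b ∈ R → e E a b → b ≡ w
          fromK aK (bD , b∉) ab with C-closed {w} aK bD ab
          ... | inj₁ s = ⊥-elim (b∉ s)
          ... | inj₂ s = s
          h : Hang
          h = hang-of w cw

          outcome : Rooted G H x y ⊎ Piece G H x y → Outcome
          outcome (inj₁ rt) with ∃? (λ v → has? R v ×-dec (¬? (v ≟ y) ×-dec ¬? (v ≟ w)))
          ... | yes (v , vR , vy , vw) = done (lift p≤k R (λ a → D⊆U (proj₁ a)) (λ a → D∌Q (proj₁ a)) (y∈D , yK) (_≡ y) (0 , nil refl refl)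
                  (λ { refl → y∈U , y∉Q , λ _ → refl }) w rt ok vR vy vw)
            where
            ok : ∀ {v} → v ∈ R → v ≢ y → v ≢ w → ordinary v × LowDeg v × (∀ {b} → b ∈ U → e E v b → b ∈ R ⊎ b ∈ Q)
            ok {v} vR vy vw = let (a , b) = plain (proj₁ vR) vy (R≢z vR) in a , b , cl
              where
              cl : ∀ {b} → b ∈ U → e E v b → b ∈ R ⊎ b ∈ Q
              cl {b} bU vb with D-closed (proj₁ vR) bU vb
              ... | inj₂ q = inj₂ q
              ... | inj₁ bD = inj₁ (bD , λ bK → vw (fromK bK vR (e-sym E vb)))
          ... | no none = which (w ≟ y)
            where
            all : ∀ {v} → v ∈ D → v ∈ K ⊎ (v ≡ w ⊎ v ≡ y)
            all {v} vD with has? K v | v ≟ w | v ≟ y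
            ... | yes a | _ | _ = inj₁ a
            ... | no _ | yes s | _ = inj₂ (inj₁ s)
            ... | no _ | no _ | yes s = inj₂ (inj₂ s)
            ... | no n | no n₁ | no n₂ = ⊥-elim (none (v , (vD , n) , n₂ , n₁))
            which : Dec (w ≡ y) → Outcome
            which (yes s) = hangY h zK (comp-conn E {D - w}) s λ vD →
              Data.Sum.map₂ Data.Sum.[ (λ r → trans r s) , (λ r → r) ]′ (all vD)
            which (no wy) = inS (has? S w)
              where
              y~w : e E y w
              y~w with conn-D wD
              ... | here s _ = ⊥-elim (wy (≡-sym s))
              ... | step {w = b} _ yb wk with all (walk-start wk)
              ... | inj₁ bK = ⊥-elim (wy (≡-sym (fromK bK (y∈D , yK) (e-sym E yb))))
              ... | inj₂ (inj₁ refl) = yb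
              ... | inj₂ (inj₂ s) = ⊥-elim (e-≢ E yb (≡-sym s))
              inS : Dec (w ∈ S) → Outcome
              inS (yes wS) = hangW h zK (comp-conn E {D - w}) wy wS y~w all
              -- If w is not in S, then w hangs at y along with K, against the maximality of K.
              inS (no wS) = ⊥-elim (<⇒≱ (bigger cw y∈D yK (≢-sym wy)) (mx y cy))
                where
                Kw : Sub
                Kw = K ∪ ⁅ w ⁆
                cl : ∀ {a b} → a ∈ Kw → a ∈ D → b ∈ D → e E a b → b ∈ Kw ⊎ b ≡ y
                cl _ _ bD _ with all bD
                ... | inj₁ s = inj₁ (inj₁ s)
                ... | inj₂ (inj₁ s) = inj₁ (inj₂ s)
                ... | inj₂ (inj₂ s) = inj₂ s
                cy : Cand y
                cy = cand-from Kw y y∈D (λ { refl → yK zK }) (inj₁ zK) zD (λ { (inj₁ a) → yK a ; (inj₂ s) → wy (≡-sym s) })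
                       (λ { (inj₁ a) s → free _ (a , s) ; (inj₂ refl) s → wS s }) cl
          outcome (inj₂ Π') = go (has? R w')
            where
            open Piece Π' renaming (K to K' ; w to w' ; K⊆U to K'⊆ ; closed to closed' ; w∉K to w'∉K')
            K'R : ∀ {t} → t ∈ K' → t ∈ R
            K'R a with K'⊆ a
            ... | inj₁ r = r
            ... | inj₂ refl = ⊥-elim (x∉K a)
            v₁K' = proj₂ some
            stepR : ∀ {a b} → a ∈ K' → b ∈ R → e E a b → b ∈ K' ⊎ b ≡ w'
            stepR aK bR ab = closed' aK (inj₁ bR) (inj₁ (D∌x (proj₁ (K'R aK)) , D∌x (proj₁ bR) , ab))
            Big : Sub
            Big = K' ∪ K
            y∉Big : y ∉ Big
            y∉Big (inj₁ a) = y∉K a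
            y∉Big (inj₂ a) = yK a
            outBig : w ∈ K' → ∀ {a b} → a ∈ Big → b ∈ D → e E a b → b ∈ Big ⊎ b ≡ w'
            outBig wK' {a} {b} aB bD ab with has? K b
            ... | yes bK = inj₁ (inj₂ bK)
            outBig wK' (inj₁ aK') bD ab | no b∉ = Data.Sum.map₁ inj₁ (stepR aK' (bD , b∉) ab)
            outBig wK' (inj₂ aK) bD ab | no b∉ with fromK aK (bD , b∉) ab
            ... | refl = inj₁ (inj₁ wK')
            outK' : w ∉ K' → ∀ {a b} → a ∈ K' → b ∈ D → e E a b → b ∈ K' ⊎ b ≡ w'
            outK' w∉ {a} {b} aK' bD ab with has? K b
            ... | no b∉ = stepR aK' (bD , b∉) ab
            ... | yes bK = ⊥-elim (w∉ (subst (_∈ K') (fromK bK (K'R aK') (e-sym E ab)) aK'))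
            go : Dec (w' ∈ R) → Outcome
            -- A cut vertex outside R leaves a set that is closed in D and misses y, although D is
            -- connected.
            go (no w'∉R) with has? K' w
            ... | yes wK' = ⊥-elim (no-closed (has Big) (inj₁ v₁K') (proj₁ (K'R v₁K')) y∉Big cl)
              where
              cl : ∀ {a b} → a ∈ Big → a ∈ D → b ∈ D → e E a b → b ∈ Big
              cl {a} {b} aB _ bD ab with outBig wK' aB bD ab | has? K b
              ... | inj₁ s | _ = s
              ... | inj₂ _ | yes bK = inj₂ bK
              ... | inj₂ refl | no b∉ = ⊥-elim (w'∉R (bD , b∉))
            ... | no wK' = ⊥-elim (no-closed (has K') v₁K' (proj₁ (K'R v₁K')) y∉K cl)
              where
              cl : ∀ {a b} → a ∈ K' → a ∈ D → b ∈ D → e E a b → b ∈ K'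
              cl {a} {b} aB _ bD ab with outK' wK' aB bD ab | has? K b
              ... | inj₁ s | _ = s
              ... | inj₂ _ | yes bK = ⊥-elim (wK' (subst (_∈ K') (fromK bK (K'R aB) (e-sym E ab)) aB))
              ... | inj₂ refl | no b∉ = ⊥-elim (w'∉R (bD , b∉))
            go (yes w'R) = inner-case (has? K' w)
              where
              freeK' : ∀ {t} → t ∈ K' → t ∉ S
              freeK' aK' s with closed' aK' (inj₂ refl) (inj₂ (inj₂ (refl , D∌x (proj₁ (K'R aK')) , s)))
              ... | inj₁ b = x∉K b
              ... | inj₂ refl = D∌x (proj₁ w'R) refl
              inner-case : Dec (w ∈ K') → Outcome
              inner-case (no w∉) = done (hyp record
                { w = w' ; K = K' ; w∈D = proj₁ w'R ; K⊆D = λ a → proj₁ (K'R a) ; some = some ; y∉K = y∉K ; w∉K = w'∉K'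
                ; S∌ = freeK' ; closed = cl } (λ a → proj₂ (K'R a) zK))
                where
                cl : ∀ {a b} → a ∈ K' → b ∈ U → e E a b → b ∈ K' ⊎ (b ≡ w' ⊎ b ∈ Q)
                cl aK' bU ab with D-closed (proj₁ (K'R aK')) bU ab
                ... | inj₂ q = inj₂ (inj₂ q)
                ... | inj₁ bD = Data.Sum.map₂ inj₁ (outK' w∉ aK' bD ab)
              -- K' and K together hang at w', against the maximality of K.
              inner-case (yes wK') = ⊥-elim (<⇒≱ (bigger cw (proj₁ w'R) (proj₂ w'R) (λ { refl → w'∉K' wK' })) (mx w' c'))
                where
                c' : Cand w'
                c' = cand-from Big w' (proj₁ w'R) (R≢z w'R) (inj₂ zK) zD y∉Big
                       (λ { (inj₁ a) → freeK' a ; (inj₂ a) s → free _ (a , s) }) (λ a _ bD ab → outBig wK' a bD ab)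

        abstract
         core : Outcome
         core = start (rooted? G (D ∪ ⁅ x ⁆) x y)
          where
          start : Rooted G (D ∪ ⁅ x ⁆) x y ⊎ Piece G (D ∪ ⁅ x ⁆) x y → Outcome
          start (inj₁ rt) with ∃? (λ v → has? D v ×-dec (¬? (v ≟ y) ×-dec ¬? (v ≟ z)))
          ... | yes (v , vD , vy , vz) = done (lift p≤k D D⊆U D∌Q y∈D (_≡ y) (0 , nil refl refl) (λ { refl → y∈U , y∉Q , λ _ → refl }) z rt
                  (λ vD vy vz → let (a , b) = plain vD vy vz in a , b , D-closed vD) vD vy vz)
          ... | no none = tiny all
            where
            all : ∀ {v} → v ∈ D → v ≡ y ⊎ v ≡ z
            all {v} vD with v ≟ y | v ≟ z
            ... | yes s | _ = inj₁ s
            ... | no _ | yes s = inj₂ s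
            ... | no n₁ | no n₂ = ⊥-elim (none (v , vD , n₁ , n₂))
          start (inj₂ Π') = go (has? D w')
            where
            open Piece Π' renaming (K to K' ; w to w' ; K⊆U to K'⊆ ; closed to closed' ; w∉K to w'∉K')
            K'D : ∀ {t} → t ∈ K' → t ∈ D
            K'D a with K'⊆ a
            ... | inj₁ r = r
            ... | inj₂ refl = ⊥-elim (x∉K a)
            out : ∀ {a b} → a ∈ K' → b ∈ D → e E a b → b ∈ K' ⊎ b ≡ w'
            out aK bD ab = closed' aK (inj₁ bD) (inj₁ (D∌x (K'D aK) , D∌x bD , ab))
            go : Dec (w' ∈ D) → Outcome
            go (no n) = ⊥-elim (no-closed (has K') (proj₂ some) (K'D (proj₂ some)) y∉K
              (λ a _ bD ab → Data.Sum.[ (λ s → s) , (λ { refl → ⊥-elim (n bD) }) ]′ (out a bD ab)))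
            go (yes w'D) = hasz (has? K' z)
              where
              freeK' : ∀ {t} → t ∈ K' → t ∉ S
              freeK' aK' s with closed' aK' (inj₂ refl) (inj₂ (inj₂ (refl , D∌x (K'D aK') , s)))
              ... | inj₁ b = x∉K b
              ... | inj₂ refl = D∌x w'D refl
              hasz : Dec (z ∈ K') → Outcome
              hasz (no z∉) = done (hyp record
                { w = w' ; K = K' ; w∈D = w'D ; K⊆D = K'D ; some = some ; y∉K = y∉K ; w∉K = w'∉K' ; S∌ = freeK' ; closed = cl } z∉)
                where
                cl : ∀ {a b} → a ∈ K' → b ∈ U → e E a b → b ∈ K' ⊎ (b ≡ w' ⊎ b ∈ Q)
                cl aK' bU ab with D-closed (K'D aK') bU ab
                ... | inj₂ q = inj₂ (inj₂ q)
                ... | inj₁ bD = Data.Sum.map₂ inj₁ (out aK' bD ab)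
              hasz (yes zK') with argmax cand? (λ w → # (C w)) (# D) (λ w → #-mono {C w} {D} (C⊆D {w}))
                   (w' , cand-from K' w' w'D (λ { refl → w'∉K' zK' }) zK' (K'D zK') y∉K freeK' (λ a _ bD ab → out a bD ab))
              ... | w , cw , mx = Cut.outcome w cw mx (rooted? G (Cut.H w cw mx) x y)

    module HangFacts (Π : Prefix) (h : Hang Π) where
      open Prefix Π
      open Hang h

      K⊆U : K ⊆ U
      K⊆U a = D⊆U (K⊆D a)
      x∉K : x ∉ K
      x∉K a = D∌x (K⊆D a) refl
      K∌Q : ∀ {v} → v ∈ K → v ∉ Q
      K∌Q a = D∌Q (K⊆D a)
      K-ord : ∀ {v} → v ∈ K → v ≢ z → ordinary v
      K-ord a n = K⊆U a , ∈≢ {K} a x∉K , ∈≢ {K} a y∉K , n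
      wU : w ∈ U
      wU = D⊆U w∈D
      w∉Q : w ∉ Q
      w∉Q = D∌Q w∈D
      Q∉K : ∀ {v} → v ∈ Q → v ∉ K
      Q∉K q a = K∌Q a q

      -- Of its three or more neighbours one is neither r nor w, and this one can only be in K.
      second : ∀ {v} → v ∈ K → v ≢ z → ∀ r → (∀ {t} → t ∈ Q → e E v t → t ≡ r) → ∃ λ v' → v' ∈ K × v ≢ v'
      second vK vz r only with third-neighbour (K-ord vK vz) r w
      ... | t , tU , vt , tr , tw with closed vK tU vt
      ... | inj₁ tK = t , tK , e-≢ E vt
      ... | inj₂ (inj₁ s) = ⊥-elim (tw s)
      ... | inj₂ (inj₂ q) = ⊥-elim (tr (only q vt))

      nb-y : ∀ {t} → w ≢ y → t ∈ U → e E y t → t ∉ K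
      nb-y wy tU yt tK with closed tK y∈U (e-sym E yt)
      ... | inj₁ a = y∉K a
      ... | inj₂ (inj₁ s) = wy (≡-sym s)
      ... | inj₂ (inj₂ q) = y∉Q q

    -- A root in a triangle

    adm₃ : ∀ {b} → k ≤ 3 → 2 ≤ b → Path (e E) (has U) x y b → Path (e E) (has U) x y (suc b) → Path (e E) (has U) x y (suc (suc b)) → Done
    adm₃ {b} k≤3 b≥ p₀ p₁ p₂ = adm b 1 b≥ (inj₁ refl) λ i i< → h i (≤-trans i< k≤3)
      where
      h : ∀ i → i < 3 → Path (e E) (has U) x y (b + i * 1)
      h zero _ = subst (Path (e E) (has U) x y) (≡-sym (+-identityʳ b)) p₀
      h (suc zero) _ = subst (Path (e E) (has U) x y) (+-comm 1 b) p₁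
      h (suc (suc zero)) _ = subst (Path (e E) (has U) x y) (+-comm 2 b) p₂
      h (suc (suc (suc _))) (s≤s (s≤s (s≤s ())))

    -- Q is the edge from x to b, with prefixes of lengths 1 and 2 to the common neighbours of its
    -- ends. A vertex with two neighbours in Q belongs to S, so the balance holds with p = 2; the
    -- vertex c ensures that there is something outside.
    module Triangle (nxy : ¬ e E x y) (b c : V) (bU : b ∈ U) (cU : c ∈ U) (xb : e E x b) (xc : e E x c) (bc : e E b c) where
      x≢b = e-≢ E xb
      x≢c = e-≢ E xc
      b≢c = e-≢ E bc
      b≢y : b ≢ y
      b≢y refl = nxy xb
      c≢y : c ≢ y
      c≢y refl = nxy xc

      Π : Prefix
      Π = record
        { Q = ⁅ x ⁆ ∪ ⁅ b ⁆ ; S = nb E x ∩ nb E b ; p = 2 ; len₀ = 1 ; dif = 1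
        ; Q⊆U = λ { (inj₁ refl) → x∈U ; (inj₂ refl) → bU }
        ; x∈Q = inj₁ refl ; y∉Q = λ { (inj₁ s) → x≢y (≡-sym s) ; (inj₂ s) → b≢y (≡-sym s) }
        ; extra = b , inj₂ refl , ≢-sym x≢b ; p≥1 = s≤s z≤n ; len₀≥1 = s≤s z≤n ; dif≡ = inj₁ refl
        ; prefix = pre }
        where
        pre : ∀ {s} → s ∈ (nb E x ∩ nb E b) → s ∈ U → s ∉ (⁅ x ⁆ ∪ ⁅ b ⁆) → ∀ j → j < 2 →
              Path (e E) (λ t → t ∈ (⁅ x ⁆ ∪ ⁅ b ⁆) ⊎ t ≡ s) x s (1 + j * 1)
        pre (xs , bs) _ _ zero _ = path-edge E (inj₁ (inj₁ refl)) (inj₂ refl) xs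
        pre (xs , bs) _ _ (suc zero) _ = path₂ (inj₁ (inj₁ refl)) (inj₁ (inj₂ refl)) (inj₂ refl) x≢b (e-≢ E xs) (e-≢ E bs) xb bs
        pre _ _ _ (suc (suc _)) (s≤s (s≤s ()))
      open Prefix Π

      c∈S : c ∈ S
      c∈S = xc , bc

      low : ∀ {v} → ordinary v → v ∉ Q → LowDeg Π v
      low {v} _ _ = (λ _ → #-two {nb E v ∩ Q} x b proj₂) , λ n → s≤s (one n (e? E v x))
        where
        one : v ∉ S → Dec (e E v x) → # (nb E v ∩ Q) ≤ 1
        one n (yes vx) = #-one {nb E v ∩ Q} x λ { (_ , inj₁ s) → s ; (vb , inj₂ refl) → ⊥-elim (n (e-sym E vx , e-sym E vb)) }
        one n (no nvx) = #-one {nb E v ∩ Q} b λ { (vx , inj₁ refl) → ⊥-elim (nvx vx) ; (_ , inj₂ s) → s }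

      hyp : (h : Hang Π) → z ∉ Hang.K h → Done
      hyp h z∉ with proj₂ (Hang.some h)
      ... | vK = two vK (snd (e? E (proj₁ some) x))
        where
        open Hang h
        open HangFacts Π h
        ≢z : ∀ {v} → v ∈ K → v ≢ z
        ≢z a refl = z∉ a
        snd : Dec (e E (proj₁ some) x) → ∃ λ v' → v' ∈ K × proj₁ some ≢ v'
        snd (yes vx) = second vK (≢z vK) x λ { (inj₁ s) _ → s ; (inj₂ refl) vb → ⊥-elim (S∌ vK (e-sym E vx , e-sym E vb)) }
        snd (no nvx) = second vK (≢z vK) b λ { (inj₁ refl) vx → ⊥-elim (nvx vx) ; (inj₂ s) _ → s }
        nbK : Nb K (⁅ x ⁆ ∪ (⁅ b ⁆ ∪ ⁅ w ⁆))
        nbK aK tU at with closed aK tU at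
        ... | inj₁ s = inj₁ s
        ... | inj₂ (inj₁ s) = inj₂ (inj₂ (inj₂ s))
        ... | inj₂ (inj₂ (inj₁ s)) = inj₂ (inj₁ s)
        ... | inj₂ (inj₂ (inj₂ s)) = inj₂ (inj₂ (inj₁ s))
        two : ∀ {v} → v ∈ K → (∃ λ v' → v' ∈ K × v ≢ v') → Done
        two vK (v' , v'K , ne) with c ≟ w
        ... | no cw = three-attachments K K⊆U x∉K y∉K z∉ x b w nbK cU (λ a → S∌ a c∈S) (≢-sym x≢c) (≢-sym b≢c) cw vK v'K ne
        ... | yes refl = three-attachments K K⊆U x∉K y∉K z∉ x b w nbK y∈U y∉K (≢-sym x≢y) (≢-sym b≢y) (≢-sym c≢y) vK v'K ne

      finish : Outcome Π → Done
      finish (done d) = d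
      finish (tiny f) = near-pendant-root nxy b nby
        where
        nby : ∀ {t} → t ∈ U → e E y t → t ≡ b ⊎ t ≡ z
        nby tU yt with D-closed y∈D tU yt
        ... | inj₂ (inj₁ refl) = ⊥-elim (nxy (e-sym E yt))
        ... | inj₂ (inj₂ s) = inj₁ s
        ... | inj₁ tD with f tD
        ... | inj₁ s = ⊥-elim (e-≢ E yt (≡-sym s))
        ... | inj₂ s = inj₂ s
      finish (hangY h zK _ w≡y _) = attached-to-roots K K⊆U x∉K y∉K zK b nbK x∈U cU x∉K (λ a → S∌ a c∈S) x≢c (e-sym E xb) bc
                                      cU (λ a → S∌ a c∈S) (≢-sym x≢c) c≢y (≢-sym b≢c)
        where
        open Hang h
        open HangFacts Π h
        nbK : Nb K (⁅ x ⁆ ∪ (⁅ y ⁆ ∪ ⁅ b ⁆))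
        nbK aK tU at with closed aK tU at
        ... | inj₁ s = inj₁ s
        ... | inj₂ (inj₁ s) = inj₂ (inj₂ (inj₁ (trans s w≡y)))
        ... | inj₂ (inj₂ (inj₁ s)) = inj₂ (inj₁ s)
        ... | inj₂ (inj₂ (inj₂ s)) = inj₂ (inj₂ (inj₂ s))
      finish (hangW h zK conn w≢y (xw , bw) yw cover) = yb? (e? E y b)
        where
        open Hang h
        open HangFacts Π h
        nby : ∀ {t} → t ∈ U → e E y t → t ≡ w ⊎ t ≡ b
        nby tU yt with D-closed y∈D tU yt
        ... | inj₂ (inj₁ refl) = ⊥-elim (nxy (e-sym E yt))
        ... | inj₂ (inj₂ s) = inj₂ s
        ... | inj₁ tD with cover tD
        ... | inj₁ tK = ⊥-elim (nb-y w≢y tU yt tK)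
        ... | inj₂ (inj₁ s) = inj₁ s
        ... | inj₂ (inj₂ s) = ⊥-elim (e-≢ E yt (≡-sym s))
        w≢x = D∌x w∈D
        b≢w = e-≢ E bw
        nbK : Nb K (⁅ x ⁆ ∪ (⁅ b ⁆ ∪ ⁅ w ⁆))
        nbK aK tU at with closed aK tU at
        ... | inj₁ s = inj₁ s
        ... | inj₂ (inj₁ s) = inj₂ (inj₂ (inj₂ s))
        ... | inj₂ (inj₂ (inj₁ s)) = inj₂ (inj₁ s)
        ... | inj₂ (inj₂ (inj₂ s)) = inj₂ (inj₂ (inj₁ s))
        b∉K : b ∉ K
        b∉K = Q∉K (inj₂ refl)
        yb? : Dec (e E y b) → Done
        yb? (no nyb) = near-pendant-root nxy w λ tU yt → Data.Sum.[ inj₁ , (λ { refl → ⊥-elim (nyb yt) }) ]′ (nby tU yt)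
        yb? (yes yb) with ∃? (has? (K - z))
        -- From b to y there are paths of lengths 1 and 2, the edge and the path through w.
        ... | yes (v , vK , vz) = behind-three K K⊆U x∉K y∉K zK b w bU (≢-sym x≢b) b≢y b∉K w∉K w≢x w≢y (≢-sym b≢w) nbK conn vK vz
                (λ vK vx vb → S∌ vK (e-sym E vx , e-sym E vb)) (λ t → (t ≡ b ⊎ t ≡ w) ⊎ t ≡ y)
                (λ { (inj₁ (inj₁ refl)) → bU , b∉K , ≢-sym x≢b ; (inj₁ (inj₂ refl)) → wU , w∉K , w≢x ; (inj₂ refl) → y∈U , y∉K , ≢-sym x≢y })
                (inj₁ refl) (path-edge E (inj₁ (inj₁ refl)) (inj₂ refl) (e-sym E yb))
                (path₂ (inj₁ (inj₁ refl)) (inj₁ (inj₂ refl)) (inj₂ refl) b≢w b≢y w≢y bw (e-sym E yw))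
        ... | no none = single (e? E z b) (e? E w z)
          where
          is-z : ∀ {t} → t ∈ K → t ≡ z
          is-z {t} a with t ≟ z
          ... | yes s = s
          ... | no n = ⊥-elim (none (t , a , n))
          w≢z : w ≢ z
          w≢z refl = w∉K zK
          zU = K⊆U zK
          z≢x = ∈≢ {K} zK x∉K
          z≢y = ∈≢ {K} zK y∉K
          z≢b = ∈≢ {K} zK b∉K
          ow : ordinary w
          ow = wU , w≢x , w≢y , w≢z
          nbw : ∀ {t} → t ∈ (nb E w ∩ U) → (t ≡ x ⊎ t ≡ b) ⊎ (t ≡ y ⊎ t ≡ z)
          nbw (wt , tU) with D-closed w∈D tU wt
          ... | inj₂ q = inj₁ q
          ... | inj₁ tD with cover tD
          ... | inj₁ tK = inj₂ (inj₂ (is-z tK))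
          ... | inj₂ (inj₁ s) = ⊥-elim (e-≢ E wt (≡-sym s))
          ... | inj₂ (inj₂ s) = inj₂ (inj₁ s)
          p₂ : Path (e E) (has U) x y 2
          p₂ = path₂ x∈U bU y∈U x≢b x≢y b≢y xb (e-sym E yb)
          p₃ : Path (e E) (has U) x y 3
          p₃ = path₃ x∈U bU wU y∈U x≢b (≢-sym w≢x) x≢y b≢w b≢y w≢y xb bw (e-sym E yw)
          -- K is just z, and the neighbours of w are among x, b, y and z. So k is at most 3, and
          -- explicit paths of lengths 2, 3 and 4 suffice.
          single : Dec (e E z b) → Dec (e E w z) → Done
          single (no nzb) _ = exceptional-near-roots zU z≢x z≢y w ow nbz
            where
            nbz : ∀ {t} → t ∈ U → e E z t → t ≡ x ⊎ (t ≡ y ⊎ t ≡ w)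
            nbz tU zt with closed zK tU zt
            ... | inj₁ tK = ⊥-elim (e-≢ E zt (≡-sym (is-z tK)))
            ... | inj₂ (inj₁ s) = inj₂ (inj₂ s)
            ... | inj₂ (inj₂ (inj₁ s)) = inj₁ s
            ... | inj₂ (inj₂ (inj₂ refl)) = ⊥-elim (nzb zt)
          single (yes zb) (no nwz) = adm₂ k≡2 ≤-refl (inj₁ refl) p₂ p₃
            where
            k≡2 : k ≡ 2
            k≡2 = ≤-antisym (s≤s⁻¹ (≤-trans (deg-ord ow) (≤-trans (#-∪ {⁅ x ⁆ ∪ ⁅ b ⁆} {⁅ y ⁆} λ a →
               Data.Sum.map₂ Data.Sum.[ (λ s → s) , (λ { refl → ⊥-elim (nwz (proj₁ a)) }) ]′ (nbw a))
               (+-mono-≤ (#-two {⁅ x ⁆ ∪ ⁅ b ⁆} x b (λ s → s)) (#-one {⁅ y ⁆} y (λ s → s)))))) k≥2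
          single (yes zb) (yes wz) = adm₃ k≤3 ≤-refl p₂ p₃
              (cons x∈U xb (path₃ (bU , ≢-sym x≢b) (zU , z≢x) (wU , w≢x) (y∈U , ≢-sym x≢y) (≢-sym z≢b) b≢w b≢y (≢-sym w≢z) z≢y w≢y
                (e-sym E zb) (e-sym E wz) (e-sym E yw)))
            where
            k≤3 : k ≤ 3
            k≤3 = s≤s⁻¹ (≤-trans (deg-ord ow) (≤-trans (#-∪ {⁅ x ⁆ ∪ ⁅ b ⁆} {⁅ y ⁆ ∪ ⁅ z ⁆} nbw)
               (+-mono-≤ (#-two {⁅ x ⁆ ∪ ⁅ b ⁆} x b (λ s → s)) (#-two {⁅ y ⁆ ∪ ⁅ z ⁆} y z (λ s → s)))))

      result : Done
      result = finish (Core.core Π k≥2 low hyp)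

    -- A neighbour of the root in a triangle

    NoTri : V → Set
    NoTri r = ∀ {b c} → b ∈ U → c ∈ U → e E r b → e E r c → e E b c → ⊥

    N[_] : Sub → Sub
    N[ C ] = sub (λ v → ∃ λ c → c ∈ C × e E c v) (λ v → ∃? (λ c → has? C c ×-dec e? E c v))

    #-strict : ∀ (C : Sub) v → NotAll E C v → # (nb E v ∩ C) < # C
    #-strict C v (c , cC , n) = #-< {nb E v ∩ C} {C} {c} proj₂ cC (λ a → n (proj₁ a))

    -- y and z are deleted, q replaces y as a root, and c becomes exceptional. Since k is at least
    -- 3, c has a neighbour besides y, z and any single cut vertex, so it cannot be cut off alone.
    near-two-neighbours : 3 ≤ k → ∀ q c → q ∈ U → q ≢ x → q ≢ y → q ≢ z → ordinary c → e E y q →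
         (∀ {t} → t ∈ U → e E y t → t ≡ q ⊎ (t ≡ c ⊎ t ≡ z)) → z ∈ U → z ≢ x → (∀ {t} → t ∈ U → e E z t → t ≡ x ⊎ (t ≡ q ⊎ (t ≡ c ⊎ t ≡ y))) →
         ∀ {v₀} → v₀ ∈ U → v₀ ≢ x → v₀ ≢ y → v₀ ≢ z → v₀ ≢ q → v₀ ≢ c → Done
    near-two-neighbours k≥3 q c qU qx qy qz oc@(cU , cx , cy , cz) yq nby zU zx nbz {v₀} v₀U v₀x v₀y v₀z v₀q v₀c = go (rooted? E H x q)
      where
      H : Sub
      H = (U - y) - z
      sp : ∀ {v} → v ∈ H → v ≢ x → v ≢ q → v ≢ c → ∀ {t} → t ∈ U → e E v t → t ∈ H
      sp ((vU , vy) , vz) vx vq vc {t} tU vt = (tU , ty) , tz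
        where
        ty : t ≢ y
        ty refl with nby vU (e-sym E vt)
        ... | inj₁ s = vq s
        ... | inj₂ (inj₁ s) = vc s
        ... | inj₂ (inj₂ s) = vz s
        tz : t ≢ z
        tz refl with nbz vU (e-sym E vt)
        ... | inj₁ s = vx s
        ... | inj₂ (inj₁ s) = vq s
        ... | inj₂ (inj₂ (inj₁ s)) = vc s
        ... | inj₂ (inj₂ (inj₂ s)) = vy s
      go : Rooted E H x q ⊎ Piece E H x q → Done
      go (inj₁ R) = sandwich
          (sub-adm k≥1 H (λ a → proj₁ (proj₁ a)) y∈U (λ a → proj₂ (proj₁ a) refl) x q c ((x∈U , x≢y) , ≢-sym zx) ((qU , qy) , qz) (≢-sym qx) R
            (λ vH vx vq vc → deg-in H (proj₁ (proj₁ vH)) vx (proj₂ (proj₁ vH)) (proj₂ vH) (λ tU vt → sp vH vx vq vc tU vt))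
            ((v₀U , v₀y) , v₀z) v₀x v₀q v₀c)
          (0 , nil {A = _≡ x} refl refl)
          (1 , path-edge E {A = λ t → t ≡ y ⊎ t ≡ q} (inj₁ refl) (inj₂ refl) yq)
          (λ a → proj₁ (proj₁ a)) (λ { refl → x∈U , λ _ → refl })
          (λ { (inj₁ refl) → y∈U , (λ a → ⊥-elim (proj₂ (proj₁ a) refl)) ; (inj₂ refl) → qU , λ _ → refl })
          (λ { refl (inj₁ s) → x≢y s ; refl (inj₂ s) → qx (≡-sym s) })
      go (inj₂ Π) = rest (has? K c)
        where
        open Piece Π
        nbK : ∀ {a t} → a ∈ K → a ≢ c → t ∈ U → e E a t → t ∈ K ⊎ t ≡ w
        nbK aK ac tU at = closed aK (sp (K⊆U aK) (∈≢ {K} aK x∉K) (∈≢ {K} aK y∉K) ac tU at) at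
        KU : ∀ {t} → t ∈ K → t ∈ U
        KU a = proj₁ (proj₁ (K⊆U a))
        y∉K' : y ∉ K
        y∉K' a = proj₂ (proj₁ (K⊆U a)) refl
        rest : Dec (c ∈ K) → Done
        rest (no c∉) = two-attachments' K KU x∉K y∉K' w y (λ aK tU at → Data.Sum.map₂ inj₁ (nbK aK (∈≢ {K} aK c∉) tU at)) (≢-sym qx) x∈U qU x∉K y∉K x≢y qy
                         (proj₂ some) (proj₂ (K⊆U (proj₂ some)))
        rest (yes cK) with ∃? (has? (K - c))
        ... | yes (t , tK , tc) = two-attachments' (K - c) (λ a → KU (proj₁ a)) (λ a → x∉K (proj₁ a)) (λ a → y∉K' (proj₁ a)) w c nb'
                                   (≢-sym qx) x∈U qU (λ a → x∉K (proj₁ a)) (λ a → y∉K (proj₁ a)) (≢-sym cx) (≢-sym (∈≢ {K} cK y∉K)) (tK , tc) (proj₂ (K⊆U tK))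
          where
          nb' : Nb (K - c) (⁅ w ⁆ ∪ ⁅ c ⁆)
          nb' {b = b} (aK , ac) bU ab with b ≟ c | nbK aK ac bU ab
          ... | yes s | _ = inj₂ (inj₂ s)
          ... | no n | inj₁ s = inj₁ (s , n)
          ... | no _ | inj₂ s = inj₂ (inj₁ s)
        ... | no none = ⊥-elim (<⇒≱ k≥3 (s≤s⁻¹ (≤-trans (deg-ord oc) (≤-trans (#-∪ {⁅ y ⁆} {⁅ z ⁆ ∪ ⁅ w ⁆} λ {t} (ct , tU) → nbc t tU ct)
                 (+-mono-≤ (#-one {⁅ y ⁆} y (λ s → s)) (#-two {⁅ z ⁆ ∪ ⁅ w ⁆} z w (λ s → s)))))))
          where
          nbc : ∀ t → t ∈ U → e E c t → t ≡ y ⊎ (t ≡ z ⊎ t ≡ w)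
          nbc t tU ct with t ≟ y | t ≟ z
          ... | yes s | _ = inj₁ s
          ... | no _ | yes s = inj₂ (inj₁ s)
          ... | no n₁ | no n₂ with closed cK ((tU , n₁) , n₂) ct
          ... | inj₂ s = inj₂ (inj₂ s)
          ... | inj₁ tK = ⊥-elim (none (t , tK , ≢-sym (e-≢ E ct)))

    -- Prefixes run through b into C and use any number of its vertices, hence p = r. An ordinary
    -- vertex outside Q is adjacent to at most one of x and b, as x is in no triangle. If it is
    -- adjacent to one of them, it misses a vertex of C, by `no-b'` for x and by maximality for b.
    module Pendant (nxy : ¬ e E x y) (ntx : NoTri x) (nty : NoTri y) (b : V) (bU : b ∈ U) (xb : e E x b)
                   (C : Sub) (C⊆ : C ⊆ (nb E b ∩ U)) (x∉C : x ∉ C) (y∉C : y ∉ C) (cl : Clique E C) (r≥2 : 2 ≤ # C)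
                   (mx : ∀ {v} → v ∈ U → e E b v → v ≢ x → v ≢ y → v ∉ C → NotAll E C v)
                   (no-b' : ∀ {v} → v ∈ U → e E x v → v ≢ b → NotAll E C v) where
      r : ℕ
      r = # C
      x≢b = e-≢ E xb
      b≢y : b ≢ y
      b≢y refl = nxy xb
      b~ : ∀ {c} → c ∈ C → e E b c
      b~ a = proj₁ (C⊆ a)
      CU : ∀ {c} → c ∈ C → c ∈ U
      CU a = proj₂ (C⊆ a)
      b∉C : b ∉ C
      b∉C a = e-irr E (b~ a)

      pathC : ∀ {q} → q ∈ C → ∀ j → j < r → Path (e E) (λ t → t ∈ ((⁅ x ⁆ ∪ ⁅ b ⁆) ∪ C)) x q (2 + j)
      pathC qC j j< = cons (inj₁ (inj₁ refl)) xb
        (path-mono (λ { (inj₁ refl) → inj₁ (inj₂ refl) , ≢-sym x≢b ; (inj₂ a) → inj₂ a , λ { refl → x∉C a } }) (clique-path E j C b _ b~ cl qC j<))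

      Π : Prefix
      Π = record
        { Q = (⁅ x ⁆ ∪ ⁅ b ⁆) ∪ C ; S = N[ C ] ; p = r ; len₀ = 3 ; dif = 1
        ; Q⊆U = λ { (inj₁ (inj₁ refl)) → x∈U ; (inj₁ (inj₂ refl)) → bU ; (inj₂ a) → CU a }
        ; x∈Q = inj₁ (inj₁ refl) ; y∉Q = λ { (inj₁ (inj₁ s)) → x≢y (≡-sym s) ; (inj₁ (inj₂ s)) → b≢y (≡-sym s) ; (inj₂ a) → y∉C a }
        ; extra = b , inj₁ (inj₂ refl) , ≢-sym x≢b ; p≥1 = ≤-trans (s≤s z≤n) r≥2 ; len₀≥1 = s≤s z≤n ; dif≡ = inj₁ refl
        ; prefix = λ (c , cC , cs) sU s∉ j j< → subst (Path (e E) _ x _) (lem j)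
            (path-mono (λ { (inj₁ a) → inj₁ a ; (inj₂ (inj₁ refl)) → inj₁ (inj₂ cC) ; (inj₂ (inj₂ s)) → inj₂ s })
              (path-append (pathC cC j j<) (path-edge E {A = λ t → t ≡ c ⊎ t ≡ _} (inj₁ refl) (inj₂ refl) cs)
                λ { _ (inj₁ s) → s ; a (inj₂ refl) → ⊥-elim (s∉ a) })) }
        where
        lem : ∀ j → (2 + j) + 1 ≡ 3 + j * 1
        lem j = solve 1 (λ j → (con 2 :+ j) :+ con 1 := con 3 :+ j :* con 1) refl j
          where open +-*-Solver
      open Prefix Π

      S∌C : ∀ {v} → v ∉ S → ∀ {t} → t ∈ C → ¬ e E v t
      S∌C n tC vt = n (_ , tC , e-sym E vt)

      low : ∀ {v} → ordinary v → v ∉ Q → LowDeg Π v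
      low {v} (vU , vx , vy , _) v∉Q = (λ _ → ≤r (e? E v x)) , λ v∉S → ≤-trans (s≤s (one v∉S (e? E v x))) r≥2
        where
        one : v ∉ S → Dec (e E v x) → # (nb E v ∩ Q) ≤ 1
        one n (yes xv) = #-one {nb E v ∩ Q} x λ { (_ , inj₁ (inj₁ s)) → s ; (vb , inj₁ (inj₂ refl)) → ⊥-elim (ntx vU bU (e-sym E xv) xb vb)
                                              ; (vt , inj₂ t) → ⊥-elim (S∌C n t vt) }
        one n (no xv) = #-one {nb E v ∩ Q} b λ { (vx , inj₁ (inj₁ refl)) → ⊥-elim (xv vx) ; (_ , inj₁ (inj₂ s)) → s
                                              ; (vt , inj₂ t) → ⊥-elim (S∌C n t vt) }
        plus : ∀ u → (∀ {t} → t ∈ (nb E v ∩ Q) → t ≡ u ⊎ t ∈ (nb E v ∩ C)) → NotAll E C v → # (nb E v ∩ Q) ≤ r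
        plus u f na = ≤-trans (#-∪ {⁅ u ⁆} {nb E v ∩ C} f) (≤-trans (+-monoˡ-≤ _ (#-one {⁅ u ⁆} u (λ s → s))) (#-strict C v na))
        ≤r : Dec (e E v x) → # (nb E v ∩ Q) ≤ r
        ≤r (yes xv) = plus x (λ { (_ , inj₁ (inj₁ s)) → inj₁ s ; (vb , inj₁ (inj₂ refl)) → ⊥-elim (ntx vU bU (e-sym E xv) xb vb)
                                ; (vt , inj₂ t) → inj₂ (vt , t) }) (no-b' vU (e-sym E xv) λ { refl → v∉Q (inj₁ (inj₂ refl)) })
        ≤r (no xv) with e? E v b
        ... | yes vb = plus b (λ { (vx , inj₁ (inj₁ refl)) → ⊥-elim (xv vx) ; (_ , inj₁ (inj₂ s)) → inj₁ s ; (vt , inj₂ t) → inj₂ (vt , t) })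
                         (mx vU (e-sym E vb) vx vy (λ a → v∉Q (inj₂ a)))
        ... | no nvb = #-mono {nb E v ∩ Q} {C} λ { (vx , inj₁ (inj₁ refl)) → ⊥-elim (xv vx) ; (vb , inj₁ (inj₂ refl)) → ⊥-elim (nvb vb) ; (_ , inj₂ t) → t }

      c₀ = proj₁ (#-elem {C} (≤-trans (s≤s z≤n) r≥2))
      c₀C : c₀ ∈ C
      c₀C = proj₂ (#-elem {C} (≤-trans (s≤s z≤n) r≥2))

      module OnHang (h : Hang Π) where
        open Hang h
        open HangFacts Π h public
        nbK : Nb K (⁅ x ⁆ ∪ (⁅ b ⁆ ∪ ⁅ w ⁆))
        nbK aK tU at with closed aK tU at
        ... | inj₁ s = inj₁ s
        ... | inj₂ (inj₁ s) = inj₂ (inj₂ (inj₂ s))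
        ... | inj₂ (inj₂ (inj₁ (inj₁ s))) = inj₂ (inj₁ s)
        ... | inj₂ (inj₂ (inj₁ (inj₂ s))) = inj₂ (inj₂ (inj₁ s))
        ... | inj₂ (inj₂ (inj₂ t)) = ⊥-elim (S∌C (S∌ aK) t at)
        b∉K : b ∉ K
        b∉K = Q∉K (inj₁ (inj₂ refl))
        C∉K : ∀ {c} → c ∈ C → c ∉ K
        C∉K a = Q∉K (inj₂ a)
        excl : ∀ {v} → v ∈ K → e E v x → e E v b → ⊥
        excl vK vx vb = ntx (K⊆U vK) bU (e-sym E vx) xb vb
        w≢x = D∌x w∈D
        w≢b : w ≢ b
        w≢b refl = w∉Q (inj₁ (inj₂ refl))
        w∉C : w ∉ C
        w∉C a = w∉Q (inj₂ a)

      hyp : (h : Hang Π) → z ∉ Hang.K h → Done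
      hyp h z∉ = two (proj₂ some) (snd (proj₂ some) (e? E (proj₁ some) x))
        where
        open Hang h
        open OnHang h
        snd : ∀ {v} → v ∈ K → Dec (e E v x) → ∃ λ v' → v' ∈ K × v ≢ v'
        snd vK (yes vx) = second vK (∈≢ {K} vK z∉) x λ { (inj₁ (inj₁ s)) _ → s ; (inj₁ (inj₂ refl)) vb → ⊥-elim (excl vK vx vb)
                                                       ; (inj₂ t) vt → ⊥-elim (S∌C (S∌ vK) t vt) }
        snd vK (no nvx) = second vK (∈≢ {K} vK z∉) b λ { (inj₁ (inj₁ refl)) vx → ⊥-elim (nvx vx) ; (inj₁ (inj₂ s)) _ → s
                                                       ; (inj₂ t) vt → ⊥-elim (S∌C (S∌ vK) t vt) }
        two : ∀ {v} → v ∈ K → (∃ λ v' → v' ∈ K × v ≢ v') → Done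
        two vK (v' , v'K , ne) = three-attachments K K⊆U x∉K y∉K z∉ x b w nbK (CU c₀C) (C∉K c₀C) (λ { s → x∉C (subst (_∈ C) s c₀C) })
          (λ s → b∉C (subst (_∈ C) s c₀C)) (λ s → w∉C (subst (_∈ C) s c₀C)) vK v'K ne

      -- y lies in no triangle.
      y-nbr : ∃ λ q → (q ≡ b ⊎ q ∈ C) × (∀ {t} → t ∈ Q → e E y t → t ≡ q)
      y-nbr with e? E y b
      ... | yes yb = b , inj₁ refl , λ { (inj₁ (inj₁ refl)) yx → ⊥-elim (nxy (e-sym E yx)) ; (inj₁ (inj₂ s)) _ → s
                                       ; (inj₂ t) yt → ⊥-elim (nty bU (CU t) yb yt (b~ t)) }
      ... | no nyb with ∃? (λ t → has? C t ×-dec e? E y t)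
      ... | no none = b , inj₁ refl , λ { (inj₁ (inj₁ refl)) yx → ⊥-elim (nxy (e-sym E yx)) ; (inj₁ (inj₂ s)) _ → s
                                        ; (inj₂ t) yt → ⊥-elim (none (_ , t , yt)) }
      ... | yes (q , qC , yq) = q , inj₂ qC , f
        where
        f : ∀ {t} → t ∈ Q → e E y t → t ≡ q
        f (inj₁ (inj₁ refl)) yx = ⊥-elim (nxy (e-sym E yx))
        f (inj₁ (inj₂ refl)) yb = ⊥-elim (nyb yb)
        f {t} (inj₂ tC) yt with t ≟ q
        ... | yes s = s
        ... | no n = ⊥-elim (nty (CU tC) (CU qC) yt yq (cl tC qC n))

      finish : r ≤ k → Outcome Π → Done
      finish r≤k (done d) = d
      finish r≤k (tiny f) = near-pendant-root nxy (proj₁ y-nbr) nby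
        where
        nby : ∀ {t} → t ∈ U → e E y t → t ≡ proj₁ y-nbr ⊎ t ≡ z
        nby tU yt with D-closed y∈D tU yt
        ... | inj₂ tQ = inj₁ (proj₂ (proj₂ y-nbr) tQ yt)
        ... | inj₁ tD with f tD
        ... | inj₁ s = ⊥-elim (e-≢ E yt (≡-sym s))
        ... | inj₂ s = inj₂ s
      finish r≤k (hangY h zK _ w≡y _) = attached-to-roots K K⊆U x∉K y∉K zK b nb' x∈U (CU c₀C) x∉K (C∉K c₀C) (λ s → x∉C (subst (_∈ C) (≡-sym s) c₀C)) (e-sym E xb) (b~ c₀C)
          (CU c₀C) (C∉K c₀C) (λ s → x∉C (subst (_∈ C) s c₀C)) (λ s → y∉C (subst (_∈ C) s c₀C)) (λ s → b∉C (subst (_∈ C) s c₀C))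
        where
        open Hang h
        open OnHang h
        nb' : Nb K (⁅ x ⁆ ∪ (⁅ y ⁆ ∪ ⁅ b ⁆))
        nb' aK tU at with nbK aK tU at
        ... | inj₁ s = inj₁ s
        ... | inj₂ (inj₁ s) = inj₂ (inj₁ s)
        ... | inj₂ (inj₂ (inj₁ s)) = inj₂ (inj₂ (inj₂ s))
        ... | inj₂ (inj₂ (inj₂ s)) = inj₂ (inj₂ (inj₁ (trans s w≡y)))
      finish r≤k (hangW h zK conn w≢y wS@(s₀ , s₀C , s₀w) yw cover) = yq? (e? E y q)
        where
        open Hang h
        open OnHang h
        q = proj₁ y-nbr
        q∈ = proj₁ (proj₂ y-nbr)
        nby : ∀ {t} → t ∈ U → e E y t → t ≡ w ⊎ t ≡ q
        nby tU yt with D-closed y∈D tU yt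
        ... | inj₂ tQ = inj₂ (proj₂ (proj₂ y-nbr) tQ yt)
        ... | inj₁ tD with cover tD
        ... | inj₁ tK = ⊥-elim (nb-y w≢y tU yt tK)
        ... | inj₂ (inj₁ s) = inj₁ s
        ... | inj₂ (inj₂ s) = ⊥-elim (e-≢ E yt (≡-sym s))
        s₀b : b ≢ s₀
        s₀b refl = b∉C s₀C
        s₀y : s₀ ≢ y
        s₀y s = y∉C (subst (_∈ C) s s₀C)
        A : V → Set
        A t = (t ≡ b ⊎ t ∈ C) ⊎ (t ≡ w ⊎ t ≡ y)
        A⊆ : ∀ {t} → A t → t ∈ U × t ∉ K × t ≢ x
        A⊆ (inj₁ (inj₁ refl)) = bU , b∉K , ≢-sym x≢b
        A⊆ (inj₁ (inj₂ a)) = CU a , C∉K a , λ { refl → x∉C a }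
        A⊆ (inj₂ (inj₁ refl)) = wU , w∉K , w≢x
        A⊆ (inj₂ (inj₂ refl)) = y∈U , y∉K , ≢-sym x≢y
        long : Path (e E) A b y 3
        long = path₃ (inj₁ (inj₁ refl)) (inj₁ (inj₂ s₀C)) (inj₂ (inj₁ refl)) (inj₂ (inj₂ refl)) s₀b (≢-sym w≢b) b≢y (λ s → w∉C (subst (_∈ C) s s₀C)) s₀y w≢y
                 (b~ s₀C) s₀w (e-sym E yw)
        ow : w ≢ z → ordinary w
        ow n = wU , w≢x , w≢y , n
        yq? : Dec (e E y q) → Done
        yq? (no n) = near-pendant-root nxy w λ tU yt → Data.Sum.[ inj₁ , (λ { refl → ⊥-elim (n yt) }) ]′ (nby tU yt)
        yq? (yes yq) with ∃? (has? (K - z))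
        ... | yes (v , vK , vz) = byq q∈
          where
          -- Besides `long`, of length 3, there is a path from b to y of length 1 if q is b, and of
          -- length 2 through q otherwise.
          byq : q ≡ b ⊎ q ∈ C → Done
          byq (inj₁ qb) = behind-three K K⊆U x∉K y∉K zK b w bU (≢-sym x≢b) b≢y b∉K w∉K w≢x w≢y w≢b nbK conn vK vz excl A A⊆ {1} {2} (inj₂ refl)
                           (path-edge E (inj₁ (inj₁ refl)) (inj₂ (inj₂ refl)) (e-sym E (subst (e E y) qb yq))) long
          byq (inj₂ qC) = behind-three K K⊆U x∉K y∉K zK b w bU (≢-sym x≢b) b≢y b∉K w∉K w≢x w≢y w≢b nbK conn vK vz excl A A⊆ {2} {1} (inj₁ refl)
                           (path₂ (inj₁ (inj₁ refl)) (inj₁ (inj₂ qC)) (inj₂ (inj₂ refl)) (λ s → b∉C (subst (_∈ C) (≡-sym s) qC)) b≢y (λ s → y∉C (subst (_∈ C) s qC)) (b~ qC) (e-sym E yq)) long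
        ... | no none = single (e? E z b)
          where
          is-z : ∀ {t} → t ∈ K → t ≡ z
          is-z {t} a with t ≟ z
          ... | yes s = s
          ... | no n = ⊥-elim (none (t , a , n))
          w≢z : w ≢ z
          w≢z s = w∉K (subst (_∈ K) (≡-sym s) zK)
          zU = K⊆U zK
          z≢x = ∈≢ {K} zK x∉K
          z≢y = ∈≢ {K} zK y∉K
          z≢b = ∈≢ {K} zK b∉K
          nbz : ∀ {t} → t ∈ U → e E z t → t ≡ x ⊎ (t ≡ b ⊎ t ≡ w)
          nbz tU zt with nbK zK tU zt
          ... | inj₁ tK = ⊥-elim (e-≢ E zt (≡-sym (is-z tK)))
          ... | inj₂ s = s
          -- Besides z and y, w has at most r neighbours, all of them in Q.
          degw : k ≤ suc r
          degw = s≤s⁻¹ (≤-trans (deg-ord (ow w≢z)) (≤-trans (#-∪ {⁅ z ⁆ ∪ ⁅ y ⁆} {nb E w ∩ Q} f)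
                   (+-mono-≤ (#-two {⁅ z ⁆ ∪ ⁅ y ⁆} z y (λ s → s)) (proj₁ (low (ow w≢z) w∉Q) wS))))
            where
            f : ∀ {t} → t ∈ (nb E w ∩ U) → (t ≡ z ⊎ t ≡ y) ⊎ t ∈ (nb E w ∩ Q)
            f (wt , tU) with D-closed w∈D tU wt
            ... | inj₂ tQ = inj₂ (wt , tQ)
            ... | inj₁ tD with cover tD
            ... | inj₁ tK = inj₁ (inj₁ (is-z tK))
            ... | inj₂ (inj₁ s) = ⊥-elim (e-≢ E wt (≡-sym s))
            ... | inj₂ (inj₂ s) = inj₁ (inj₂ s)
          single : Dec (e E z b) → Done
          single (no nzb) = exceptional-near-roots zU z≢x z≢y w (ow w≢z) λ tU zt →
            Data.Sum.map₂ Data.Sum.[ (λ { refl → ⊥-elim (nzb zt) }) , inj₂ ]′ (nbz tU zt)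
          single (yes zb) with k ≤? r
          ... | yes k≤r = direct Π k≤r (s≤s (s≤s z≤n)) wS w∈D
          ... | no k≰r = byq q∈
            where
            -- Now k = r + 1, one more than the clique offers. If q is in C, lengths 3 to r + 2 end
            -- with the edge from q to y, and length r + 3 is a longest prefix to w followed by y.
            byq : q ≡ b ⊎ q ∈ C → Done
            byq (inj₁ qb) = near-two-neighbours (≤-trans (s≤s r≥2) (≰⇒> k≰r)) b w bU (≢-sym x≢b) b≢y (≢-sym z≢b) (ow w≢z) (subst (e E y) qb yq)
                (λ tU yt → Data.Sum.[ (λ s → inj₂ (inj₁ s)) , (λ s → inj₁ (trans s qb)) ]′ (nby tU yt)) zU z≢x
                (λ tU zt → Data.Sum.map₂ (Data.Sum.map₂ inj₁) (nbz tU zt))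
                (CU s₀C) (λ { s → x∉C (subst (_∈ C) s s₀C) }) s₀y (λ s → C∉K s₀C (subst (_∈ K) (≡-sym s) zK)) (≢-sym s₀b) (λ s → w∉C (subst (_∈ C) s s₀C))
            byq (inj₂ qC) = adm 3 1 (s≤s (s≤s z≤n)) (inj₁ refl) λ i i< → P i (≤-trans i< degw)
              where
              P : ∀ i → i < suc r → Path (e E) (has U) x y (3 + i * 1)
              P i i< with suc i ≤? r
              ... | yes i<r = subst (Path (e E) (has U) x y) (lem i) (path-mono (λ { (inj₁ a) → Q⊆U a ; (inj₂ (inj₁ refl)) → CU qC ; (inj₂ (inj₂ refl)) → y∈U })
                   (path-append (pathC qC i i<r) (path-edge E {A = λ t → t ≡ q ⊎ t ≡ y} (inj₁ refl) (inj₂ refl) (e-sym E yq))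
                     λ { _ (inj₁ s) → s ; a (inj₂ refl) → ⊥-elim (y∉Q a) }))
                where
                lem : ∀ j → (2 + j) + 1 ≡ 3 + j * 1
                lem j = solve 1 (λ j → (con 2 :+ j) :+ con 1 := con 3 :+ j :* con 1) refl j
                  where open +-*-Solver
              ... | no i≮r = subst (Path (e E) (has U) x y) lem
                   (path-mono (λ { (inj₁ (inj₁ a)) → Q⊆U a ; (inj₁ (inj₂ refl)) → wU ; (inj₂ (inj₁ refl)) → wU ; (inj₂ (inj₂ refl)) → y∈U })
                     (path-append (prefix wS wU w∉Q (r ∸ 1) r-1<) (path-edge E {A = λ t → t ≡ w ⊎ t ≡ y} (inj₁ refl) (inj₂ refl) (e-sym E yw))
                       λ { _ (inj₁ s) → s ; (inj₁ a) (inj₂ refl) → ⊥-elim (y∉Q a) ; (inj₂ s) (inj₂ s') → ⊥-elim (w≢y (trans (≡-sym s) s')) }))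
                where
                i≡r : i ≡ r
                i≡r = ≤-antisym (s≤s⁻¹ i<) (s≤s⁻¹ (≰⇒> i≮r))
                r≡ : suc (r ∸ 1) ≡ r
                r≡ = m+[n∸m]≡n p≥1
                r-1< : r ∸ 1 < r
                r-1< = ≤-reflexive r≡
                lem : 3 + (r ∸ 1) * 1 + 1 ≡ 3 + i * 1
                lem = trans (solve 1 (λ j → con 3 :+ j :* con 1 :+ con 1 := con 3 :+ (con 1 :+ j) :* con 1) refl (r ∸ 1)) (cong (λ t → 3 + t * 1) (trans r≡ (≡-sym i≡r)))
                  where open +-*-Solver

      result : Done
      result with r ≤? k
      ... | yes r≤k = finish r≤k (Core.core Π r≤k low hyp)
      ... | no r≰k with ∃? (λ t → has? S t ×-dec has? D t)
      ... | yes (t , tS , tD) = direct Π (≤-trans (n≤1+n k) (≰⇒> r≰k)) (s≤s (s≤s z≤n)) tS tD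
      -- No neighbour of C is in D, so everything outside D except x and b is attached to these two
      -- only.
      ... | no none = two-attachments P (λ a → proj₁ a) (λ a → proj₂ a (inj₂ (inj₁ refl))) (λ a → proj₂ a (inj₁ y∈D)) x b nbP
                        y∈U (λ a → proj₂ a (inj₁ y∈D)) (≢-sym x≢y) (≢-sym b≢y) {proj₁ c₁}
                        (CU (proj₁ (proj₂ c₁)) , λ { (inj₁ a) → D∌Q a (inj₂ (proj₁ (proj₂ c₁))) ; (inj₂ (inj₁ s)) → x∉C (subst (_∈ C) s (proj₁ (proj₂ c₁)))
                                                   ; (inj₂ (inj₂ s)) → b∉C (subst (_∈ C) s (proj₁ (proj₂ c₁))) }) (proj₂ (proj₂ c₁))
        where
        c₁ = #-elem≢ {C} z r≥2
        P : Sub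
        P = U ∖ (D ∪ (⁅ x ⁆ ∪ ⁅ b ⁆))
        nbP : Nb P (⁅ x ⁆ ∪ ⁅ b ⁆)
        nbP {a} {t} (aU , a∉) tU at with t ≟ x | t ≟ b | has? D t
        ... | yes s | _ | _ = inj₂ (inj₁ s)
        ... | no _ | yes s | _ = inj₂ (inj₂ s)
        ... | no n₁ | no n₂ | no t∉ = inj₁ (tU , λ { (inj₁ d) → t∉ d ; (inj₂ (inj₁ s)) → n₁ s ; (inj₂ (inj₂ s)) → n₂ s })
        ... | no n₁ | no n₂ | yes tD with D-closed tD aU (e-sym E at)
        ... | inj₁ aD = ⊥-elim (a∉ (inj₁ aD))
        ... | inj₂ (inj₁ aq) = ⊥-elim (a∉ (inj₂ aq))
        ... | inj₂ (inj₂ aC) = ⊥-elim (none (t , (a , aC , at) , tD))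

    -- If w is a root or outside U, then z has no neighbours but the roots, and any ordinary c' can
    -- stand in for w.
    exceptional-near-roots' : z ∈ U → z ≢ x → z ≢ y → ∀ w → w ≢ z → ∀ {c'} → ordinary c' → (∀ {b} → b ∈ U → e E z b → b ≡ x ⊎ (b ≡ y ⊎ b ≡ w)) → Done
    exceptional-near-roots' zU zx zy w wz {c'} oc' nbz with has? U w | w ≟ x | w ≟ y
    ... | yes wU | no wx | no wy = exceptional-near-roots zU zx zy w (wU , wx , wy , wz) nbz
    ... | no wU | _ | _ = exceptional-near-roots zU zx zy c' oc' λ bU zb → Data.Sum.map₂ (Data.Sum.map₂ λ { refl → ⊥-elim (wU bU) }) (nbz bU zb)
    ... | yes _ | yes refl | _ = exceptional-near-roots zU zx zy c' oc' λ bU zb → Data.Sum.[ inj₁ , Data.Sum.[ (λ s → inj₂ (inj₁ s)) , inj₁ ]′ ]′ (nbz bU zb)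
    ... | yes _ | no _ | yes refl = exceptional-near-roots zU zx zy c' oc' λ bU zb → Data.Sum.map₂ Data.Sum.[ inj₁ , inj₁ ]′ (nbz bU zb)

    module _ (Π : Prefix) (h : Hang Π) where
      open Prefix Π
      open Hang h
      open HangFacts Π h

      -- A simple path in D that has left w cannot enter K, because the only way out of K within D
      -- leads back through w.
      exit-path : SomePath (e E) (λ t → t ∈ D × t ∉ K) w y
      exit-path with walk-path (walk-trans (walk-sym E (comp-conn E {U ∖ Q} w∈D)) (here refl y∈D))
      ... | _ , nil s _ = 0 , nil s (w∈D , w∉K)
      ... | m , cons {w = v} a wv p = _ , cons (w∈D , w∉K) wv (path-mono (λ ((d , ne) , n) → (d , n) , ne) (go (λ a → a) p))
        where
        go : ∀ {A : V → Set} {v m} → (∀ {t} → A t → t ∈ D × t ≢ w) → Path (e E) A v y m → Path (e E) (λ t → A t × t ∉ K) v y m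
        go f (nil refl a) = nil refl (a , y∉K)
        go {A} {v} f (cons a vu p) = cons (a , v∉K) vu (path-mono (λ ((c , ne) , n) → (c , n) , ne) rest)
          where
          rest = go (λ c → f (proj₁ c)) p
          v∉K : v ∉ K
          v∉K vK with closed vK (D⊆U (proj₁ (f (proj₁ (path-start p))))) vu
          ... | inj₁ uK = proj₂ (path-start rest) uK
          ... | inj₂ (inj₁ s) = proj₂ (f (proj₁ (path-start p))) s
          ... | inj₂ (inj₂ q) = D∌Q (proj₁ (f (proj₁ (path-start p)))) q

      -- A second prefix structure on the same Q, used for a hanging part that misses S.
      module Second (Π₂ : Prefix) (Q→ : ∀ {v} → v ∈ Q → v ∈ Prefix.Q Π₂) (Q← : ∀ {v} → v ∈ Prefix.Q Π₂ → v ∈ Q)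
                    (p₂≤k : Prefix.p Π₂ ≤ k)
                    (low₂ : ∀ {v} → v ∈ K → v ≢ z → LowDeg Π₂ v)
                    (free : ∀ {v} → v ∈ K → v ∉ Prefix.S Π₂ → ∀ {t} → t ∈ Q → e E v t → t ≡ x)
                    {o o' : V} (oQ : o ∈ Q) (o'Q : o' ∈ Q) (oo' : o ≢ o') (ox : o ≢ x) (o'x : o' ≢ x)
                    {c' : V} (oc' : ordinary c') where
        open Prefix Π₂ using () renaming (S to S₂ ; G to G₂)

        R H : Sub
        R = K ∪ ⁅ w ⁆
        H = R ∪ ⁅ x ⁆
        R⊆D : ∀ {v} → v ∈ R → v ∈ D
        R⊆D (inj₁ a) = K⊆D a
        R⊆D (inj₂ refl) = w∈D

        -- K itself is contracted, with roots x and w: the paths begin with prefixes of the second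
        -- kind and end with `exit-path`. If this fails, a piece misses `S₂`, so by `free` its only
        -- attachments are a cut vertex and x.
        second-lift : ∀ {v} → v ∈ K → v ≢ z → Done
        second-lift {v} vK vz = go (rooted? G₂ H x w)
          where
          go : Rooted G₂ H x w ⊎ Piece G₂ H x w → Done
          go (inj₁ rt) = lift Π₂ p₂≤k R (λ a → D⊆U (R⊆D a)) (λ a q → D∌Q (R⊆D a) (Q← q)) (inj₂ refl) _ exit-path
              (λ (tD , t∉K) → D⊆U tD , (λ q → D∌Q tD (Q← q)) , λ { (inj₁ tK) → ⊥-elim (t∉K tK) ; (inj₂ s) → s })
              z rt ok (inj₁ vK) (∈≢ {K} vK w∉K) vz
            where
            ok : ∀ {v} → v ∈ R → v ≢ w → v ≢ z → ordinary v × LowDeg Π₂ v × (∀ {b} → b ∈ U → e E v b → b ∈ R ⊎ b ∈ Prefix.Q Π₂)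
            ok (inj₂ s) n _ = ⊥-elim (n s)
            ok (inj₁ vK) _ vz = K-ord vK vz , low₂ vK vz , λ bU vb → cl (closed vK bU vb)
              where
              cl : ∀ {b} → b ∈ K ⊎ (b ≡ w ⊎ b ∈ Q) → b ∈ R ⊎ b ∈ Prefix.Q Π₂
              cl (inj₁ a) = inj₁ (inj₁ a)
              cl (inj₂ (inj₁ a)) = inj₁ (inj₂ a)
              cl (inj₂ (inj₂ a)) = inj₂ (Q→ a)
          go (inj₂ Π') = at-x (w' ≟ x)
            where
            open Piece Π' using () renaming (K to K' ; w to w' ; closed to closed' ; K⊆U to K'⊆ ; w∉K to w'∉K')
            inK : ∀ {t} → t ∈ K' → t ∈ K
            inK a with K'⊆ a
            ... | inj₁ (inj₁ b) = b
            ... | inj₁ (inj₂ refl) = ⊥-elim (y∉K' a)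
              where y∉K' = Piece.y∉K Π'
            ... | inj₂ refl = ⊥-elim (Piece.x∉K Π' a)
            xK : ∀ {t} → t ∈ R → t ≢ x
            xK a = D∌x (R⊆D a)
            out : ∀ {a b} → a ∈ K' → b ∈ R → e E a b → b ∈ K' ⊎ b ≡ w'
            out aK' bR ab = closed' aK' (inj₁ bR) (inj₁ (xK (inj₁ (inK aK')) , xK bR , ab))
            at-x : Dec (w' ≡ x) → Done
            at-x (yes refl) = ⊥-elim (y∉K (inK (walk-stays E {K = has K'} cl (proj₂ some') (walk-sym E (comp-conn E {U ∖ Q} (K⊆D (inK (proj₂ some'))))))))
              where
              some' = Piece.some Π'
              cl : ∀ {s t} → s ∈ K' → s ∈ comp E (U ∖ Q) y → t ∈ comp E (U ∖ Q) y → e E s t → t ∈ K'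
              cl sK' _ tD st with closed (inK sK') (D⊆U tD) st
              ... | inj₂ (inj₂ q) = ⊥-elim (D∌Q tD q)
              ... | inj₁ tK = Data.Sum.[ (λ a → a) , (λ s → ⊥-elim (D∌x tD s)) ]′ (out sK' (inj₁ tK) st)
              ... | inj₂ (inj₁ s) = Data.Sum.[ (λ a → a) , (λ s → ⊥-elim (D∌x tD s)) ]′ (out sK' (inj₂ s) st)
            at-x (no w'x) = fin (∃? (has? (K' - z)))
              where
              S₂∌ : ∀ {t} → t ∈ K' → t ∉ S₂
              S₂∌ tK' s with closed' tK' (inj₂ refl) (inj₂ (inj₂ (refl , xK (inj₁ (inK tK')) , s)))
              ... | inj₁ b = Piece.x∉K Π' b
              ... | inj₂ b = w'x (≡-sym b)
              nb' : ∀ {a b} → a ∈ K' → b ∈ U → e E a b → b ∈ K' ⊎ (b ≡ w' ⊎ b ≡ x)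
              nb' aK' bU ab with closed (inK aK') bU ab
              ... | inj₁ bK = Data.Sum.map₂ inj₁ (out aK' (inj₁ bK) ab)
              ... | inj₂ (inj₁ s) = Data.Sum.map₂ inj₁ (out aK' (inj₂ s) ab)
              ... | inj₂ (inj₂ q) = inj₂ (inj₂ (free (inK aK') (S₂∌ aK') q ab))
              fin : Dec (∃ λ t → t ∈ (K' - z)) → Done
              fin (yes (t , tK' , tz)) = two-attachments' K' (λ a → K⊆U (inK a)) (λ a → x∉K (inK a)) (λ a → y∉K (inK a)) w' x nb' oo' (Q⊆U oQ) (Q⊆U o'Q)
                                           (λ a → Q∉K oQ (inK a)) (λ a → Q∉K o'Q (inK a)) ox o'x tK' tz
              fin (no none) = exceptional-near-roots' (K⊆U (inK zK')) (∈≢ {K} (inK zK') x∉K) (∈≢ {K} (inK zK') y∉K) w' (≢-sym (∈≢ {K'} zK' w'∉K')) oc' nbz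
                where
                is-z : ∀ {t} → t ∈ K' → t ≡ z
                is-z {t} a with t ≟ z
                ... | yes s = s
                ... | no n = ⊥-elim (none (t , a , n))
                zK' : z ∈ K'
                zK' = subst (_∈ K') (is-z (proj₂ (Piece.some Π'))) (proj₂ (Piece.some Π'))
                nbz : ∀ {b} → b ∈ U → e E z b → b ≡ x ⊎ (b ≡ y ⊎ b ≡ w')
                nbz bU zb with nb' zK' bU zb
                ... | inj₁ bK' = ⊥-elim (e-≢ E zb (≡-sym (is-z bK')))
                ... | inj₂ (inj₁ s) = inj₂ (inj₂ s)
                ... | inj₂ (inj₂ s) = inj₁ s

    -- Here b and b' share the clique. Crossing from b to b' through C yields one more length, p = r
    -- + 1. In return a vertex outside Q may be adjacent to both b and b', but then it misses a
    -- vertex of C.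
    module TwoPendant (nxy : ¬ e E x y) (ntx : NoTri x) (nty : NoTri y) (b b' : V) (bU : b ∈ U) (b'U : b' ∈ U) (xb : e E x b) (xb' : e E x b')
                   (bb' : b ≢ b') (C : Sub) (C⊆ : C ⊆ ((nb E b ∩ nb E b') ∩ U)) (x∉C : x ∉ C) (y∉C : y ∉ C) (cl : Clique E C) (r≥2 : 2 ≤ # C)
                   (mx : ∀ {v} → v ∈ U → e E b v → e E b' v → v ≢ x → v ≢ y → v ∉ C → NotAll E C v) where
      r : ℕ
      r = # C
      b~ : ∀ {c} → c ∈ C → e E b c
      b~ a = proj₁ (proj₁ (C⊆ a))
      b'~ : ∀ {c} → c ∈ C → e E b' c
      b'~ a = proj₂ (proj₁ (C⊆ a))
      CU : ∀ {c} → c ∈ C → c ∈ U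
      CU a = proj₂ (C⊆ a)
      b≢y : b ≢ y
      b≢y refl = nxy xb
      b'≢y : b' ≢ y
      b'≢y refl = nxy xb'

      record End (β : V) : Set where
        field
          βU : β ∈ U
          xβ : e E x β
          β~ : ∀ {c} → c ∈ C → e E β c
          β∈ : β ≡ b ⊎ β ≡ b'
        β∉C : β ∉ C
        β∉C a = e-irr E (β~ a)
        x≢β : x ≢ β
        x≢β = e-≢ E xβ
      open End

      end-b : End b
      end-b = record { βU = bU ; xβ = xb ; β~ = b~ ; β∈ = inj₁ refl }
      end-b' : End b'
      end-b' = record { βU = b'U ; xβ = xb' ; β~ = b'~ ; β∈ = inj₂ refl }

      opposite : ∀ {β} → β ≡ b ⊎ β ≡ b' → End β × ∃ λ β' → End β' × β' ≢ β
      opposite (inj₁ refl) = end-b , b' , end-b' , ≢-sym bb'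
      opposite (inj₂ refl) = end-b' , b , end-b , bb'

      Q : Sub
      Q = ((⁅ x ⁆ ∪ ⁅ b ⁆) ∪ ⁅ b' ⁆) ∪ C

      inQ : ∀ {β} → End β → β ∈ Q
      inQ E' with β∈ E'
      ... | inj₁ s = inj₁ (inj₁ (inj₂ s))
      ... | inj₂ s = inj₁ (inj₂ s)

      x∈Q' : x ∈ Q
      x∈Q' = inj₁ (inj₁ (inj₁ refl))

      Q⊆ : Q ⊆ U
      Q⊆ (inj₁ (inj₁ (inj₁ refl))) = x∈U
      Q⊆ (inj₁ (inj₁ (inj₂ refl))) = bU
      Q⊆ (inj₁ (inj₂ refl)) = b'U
      Q⊆ (inj₂ a) = CU a
      y∉ : y ∉ Q
      y∉ (inj₁ (inj₁ (inj₁ s))) = x≢y (≡-sym s)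
      y∉ (inj₁ (inj₁ (inj₂ s))) = b≢y (≡-sym s)
      y∉ (inj₁ (inj₂ s)) = b'≢y (≡-sym s)
      y∉ (inj₂ a) = y∉C a

      -- x, β, then j + 1 vertices of the clique
      via : ∀ {β q} → End β → q ∈ C → ∀ j → j < r → Path (e E) (λ t → t ≡ x ⊎ (t ≡ β ⊎ t ∈ C)) x q (2 + j)
      via E' qC j j< = cons (inj₁ refl) (xβ E')
        (path-mono (λ { (inj₁ refl) → inj₂ (inj₁ refl) , ≢-sym (x≢β E') ; (inj₂ a) → inj₂ (inj₂ a) , λ { refl → x∉C a } })
          (clique-path E j C _ _ (β~ E') cl qC j<))

      viaQ : ∀ {β} → End β → ∀ {t} → t ≡ x ⊎ (t ≡ β ⊎ t ∈ C) → t ∈ Q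
      viaQ E' (inj₁ refl) = x∈Q'
      viaQ E' (inj₂ (inj₁ refl)) = inQ E'
      viaQ E' (inj₂ (inj₂ a)) = inj₂ a

      pathC : ∀ {q} → q ∈ C → ∀ j → j < suc r → Path (e E) (has Q) x q (2 + j)
      pathC {q} qC j j≤r with suc j ≤? r
      ... | yes j< = path-mono (viaQ end-b) (via end-b qC j j<)
      -- Now j = r: the path goes x, b, s, b' and then through all the rest of C.
      ... | no j≮ = subst (Path (e E) (has Q) x q) len₀≡ (path-mono inc
            (path-append first (clique-path E r₀ (C - s) b' q (λ a → b'~ (proj₁ a)) (λ a c → cl (proj₁ a) (proj₁ c)) (qC , ≢-sym sq) le) meet))
        where
        r₀ = r ∸ 2
        r≡ : suc (suc r₀) ≡ r
        r≡ = m+[n∸m]≡n r≥2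
        j≡ : j ≡ r
        j≡ = ≤-antisym (s≤s⁻¹ j≤r) (s≤s⁻¹ (≰⇒> j≮))
        ps = #-elem≢ {C} q r≥2
        s = proj₁ ps
        sC = proj₁ (proj₂ ps)
        sq = proj₂ (proj₂ ps)
        le : suc r₀ ≤ # (C - s)
        le = s≤s⁻¹ (≤-trans (≤-reflexive r≡) (#-remove {C} s))
        first : Path (e E) (λ t → t ≡ x ⊎ (t ≡ b ⊎ (t ≡ s ⊎ t ≡ b'))) x b' 3
        first = path₃ (inj₁ refl) (inj₂ (inj₁ refl)) (inj₂ (inj₂ (inj₁ refl))) (inj₂ (inj₂ (inj₂ refl))) (x≢β end-b) (λ { eq → x∉C (subst (_∈ C) (≡-sym eq) sC) })
                  (x≢β end-b') (λ eq → β∉C end-b (subst (_∈ C) (≡-sym eq) sC)) bb' (λ eq → β∉C end-b' (subst (_∈ C) eq sC)) xb (b~ sC) (e-sym E (b'~ sC))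
        meet : ∀ {t} → t ≡ x ⊎ (t ≡ b ⊎ (t ≡ s ⊎ t ≡ b')) → t ≡ b' ⊎ t ∈ (C - s) → t ≡ b'
        meet _ (inj₁ eq) = eq
        meet (inj₁ refl) (inj₂ (a , _)) = ⊥-elim (x∉C a)
        meet (inj₂ (inj₁ refl)) (inj₂ (a , _)) = ⊥-elim (β∉C end-b a)
        meet (inj₂ (inj₂ (inj₁ eq))) (inj₂ (_ , n)) = ⊥-elim (n eq)
        meet (inj₂ (inj₂ (inj₂ eq))) _ = eq
        inc : ∀ {t} → (t ≡ x ⊎ (t ≡ b ⊎ (t ≡ s ⊎ t ≡ b'))) ⊎ (t ≡ b' ⊎ t ∈ (C - s)) → t ∈ Q
        inc (inj₁ (inj₁ refl)) = x∈Q'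
        inc (inj₁ (inj₂ (inj₁ refl))) = inQ end-b
        inc (inj₁ (inj₂ (inj₂ (inj₁ refl)))) = inj₂ sC
        inc (inj₁ (inj₂ (inj₂ (inj₂ refl)))) = inQ end-b'
        inc (inj₂ (inj₁ refl)) = inQ end-b'
        inc (inj₂ (inj₂ (a , _))) = inj₂ a
        len₀≡ : 3 + suc r₀ ≡ 2 + j
        len₀≡ = cong (2 +_) (trans r≡ (≡-sym j≡))

      c₀ = proj₁ (#-elem {C} (≤-trans (s≤s z≤n) r≥2))
      c₀C : c₀ ∈ C
      c₀C = proj₂ (#-elem {C} (≤-trans (s≤s z≤n) r≥2))

      pathB : ∀ {β} → β ≡ b ⊎ β ≡ b' → ∀ j → j < r → Path (e E) (has Q) x β (3 + j)
      pathB {β} β∈' j j< with opposite β∈'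
      ... | Eβ , β' , Eβ' , ne = subst (Path (e E) (has Q) x β) (+-comm (2 + j) 1)
            (path-mono (λ { (inj₁ a) → viaQ Eβ' a ; (inj₂ (inj₁ refl)) → inj₂ c₀C ; (inj₂ (inj₂ refl)) → inQ Eβ })
              (path-append (via Eβ' c₀C j j<) (path-edge E {A = λ t → t ≡ c₀ ⊎ t ≡ β} (inj₁ refl) (inj₂ refl) (e-sym E (β~ Eβ c₀C)))
                λ { _ (inj₁ eq) → eq ; (inj₁ refl) (inj₂ eq) → ⊥-elim (x≢β Eβ eq) ; (inj₂ (inj₁ refl)) (inj₂ eq) → ⊥-elim (ne eq)
                  ; (inj₂ (inj₂ a)) (inj₂ refl) → ⊥-elim (β∉C Eβ a) }))

      grow : ∀ {T : Sub} {m} (pth : ∀ {c} → c ∈ T → ∀ j → j < m → Path (e E) (has Q) x c (2 + j)) → ∀ {s} → s ∈ N[ T ] → s ∉ Q → T ⊆ Q →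
             ∀ j → j < m → Path (e E) (λ t → t ∈ Q ⊎ t ≡ s) x s (3 + j * 1)
      grow {T} pth {s} (c , cT , cs) s∉ T⊆ j j< = subst (Path (e E) _ x s) (lem j)
            (path-mono (λ { (inj₁ a) → inj₁ a ; (inj₂ (inj₁ refl)) → inj₁ (T⊆ cT) ; (inj₂ (inj₂ eq)) → inj₂ eq })
              (path-append (pth cT j j<) (path-edge E {A = λ t → t ≡ c ⊎ t ≡ s} (inj₁ refl) (inj₂ refl) cs)
                λ { _ (inj₁ eq) → eq ; a (inj₂ refl) → ⊥-elim (s∉ a) }))
        where
        lem : ∀ j → (2 + j) + 1 ≡ 3 + j * 1
        lem j = solve 1 (λ j → (con 2 :+ j) :+ con 1 := con 3 :+ j :* con 1) refl j
          where open +-*-Solver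

      Both : Sub
      Both = ⁅ b ⁆ ∪ ⁅ b' ⁆

      -- The first leaves Q through C, the second through b or b'. Hanging parts of the first have
      -- no neighbours in C and are treated by the second.
      Π Π₂ : Prefix
      Π = record
        { Q = Q ; S = N[ C ] ; p = suc r ; len₀ = 3 ; dif = 1 ; Q⊆U = Q⊆ ; x∈Q = x∈Q' ; y∉Q = y∉
        ; extra = b , inQ end-b , ≢-sym (x≢β end-b) ; p≥1 = s≤s z≤n ; len₀≥1 = s≤s z≤n ; dif≡ = inj₁ refl
        ; prefix = λ {s} sS _ s∉ → grow {C} {suc r} pathC {s} sS s∉ inj₂ }
      Π₂ = record
        { Q = Q ; S = N[ Both ] ; p = r ; len₀ = 4 ; dif = 1 ; Q⊆U = Q⊆ ; x∈Q = x∈Q' ; y∉Q = y∉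
        ; extra = b , inQ end-b , ≢-sym (x≢β end-b) ; p≥1 = ≤-trans (s≤s z≤n) r≥2 ; len₀≥1 = s≤s z≤n ; dif≡ = inj₁ refl
        ; prefix = pre }
        where
        pre : ∀ {s} → s ∈ N[ Both ] → s ∈ U → s ∉ Q → ∀ j → j < r → Path (e E) (λ t → t ∈ Q ⊎ t ≡ s) x s (4 + j * 1)
        pre {s} (c , cB , cs) _ s∉ j j< = subst (Path (e E) _ x s) (lem j)
            (path-mono (λ { (inj₁ a) → inj₁ a ; (inj₂ (inj₁ refl)) → inj₁ (inQ (proj₁ (opposite cB))) ; (inj₂ (inj₂ eq)) → inj₂ eq })
              (path-append (pathB cB j j<) (path-edge E {A = λ t → t ≡ c ⊎ t ≡ s} (inj₁ refl) (inj₂ refl) cs)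
                λ { _ (inj₁ eq) → eq ; a (inj₂ refl) → ⊥-elim (s∉ a) }))
          where
          lem : ∀ j → (3 + j) + 1 ≡ 4 + j * 1
          lem j = solve 1 (λ j → (con 3 :+ j) :+ con 1 := con 4 :+ j :* con 1) refl j
            where open +-*-Solver
      open Prefix Π hiding (Q ; Q⊆U)

      S∌C : ∀ {v} → v ∉ S → ∀ {t} → t ∈ C → ¬ e E v t
      S∌C n tC vt = n (_ , tC , e-sym E vt)

      x-excl : ∀ {v β} → v ∈ U → End β → e E v x → e E v β → ⊥
      x-excl vU Eβ vx vβ = ntx vU (βU Eβ) (e-sym E vx) (xβ Eβ) vβ

      low : ∀ {v} → ordinary v → v ∉ Q → LowDeg Π v
      low {v} (vU , vx , vy , _) v∉Q = (λ _ → all (e? E v x) (e? E v b) (e? E v b')) , λ v∉S → s≤s (≤-trans (two v∉S (e? E v x)) r≥2)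
        where
        two : v ∉ S → Dec (e E v x) → # (nb E v ∩ Q) ≤ 2
        two n (yes xv) = ≤-trans (#-one {nb E v ∩ Q} x λ { (_ , inj₁ (inj₁ (inj₁ s))) → s ; (vb , inj₁ (inj₁ (inj₂ refl))) → ⊥-elim (x-excl vU end-b xv vb)
                                                         ; (vb , inj₁ (inj₂ refl)) → ⊥-elim (x-excl vU end-b' xv vb) ; (vt , inj₂ t) → ⊥-elim (S∌C n t vt) }) (s≤s z≤n)
        two n (no xv) = #-two {nb E v ∩ Q} b b' λ { (vx , inj₁ (inj₁ (inj₁ refl))) → ⊥-elim (xv vx) ; (_ , inj₁ (inj₁ (inj₂ s))) → inj₁ s
                                                  ; (_ , inj₁ (inj₂ s)) → inj₂ s ; (vt , inj₂ t) → ⊥-elim (S∌C n t vt) }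
        plus : ∀ u → (∀ {t} → t ∈ (nb E v ∩ Q) → t ≡ u ⊎ t ∈ C) → # (nb E v ∩ Q) ≤ suc r
        plus u f = ≤-trans (#-∪ {⁅ u ⁆} {C} f) (+-monoˡ-≤ r (#-one {⁅ u ⁆} u (λ s → s)))
        all : Dec (e E v x) → Dec (e E v b) → Dec (e E v b') → # (nb E v ∩ Q) ≤ suc r
        all (yes xv) _ _ = plus x λ { (_ , inj₁ (inj₁ (inj₁ s))) → inj₁ s ; (vb , inj₁ (inj₁ (inj₂ refl))) → ⊥-elim (x-excl vU end-b xv vb)
                                    ; (vb , inj₁ (inj₂ refl)) → ⊥-elim (x-excl vU end-b' xv vb) ; (_ , inj₂ t) → inj₂ t }
        all (no xv) (no nb₁) _ = plus b' λ { (vx , inj₁ (inj₁ (inj₁ refl))) → ⊥-elim (xv vx) ; (vb , inj₁ (inj₁ (inj₂ refl))) → ⊥-elim (nb₁ vb)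
                                           ; (_ , inj₁ (inj₂ s)) → inj₁ s ; (_ , inj₂ t) → inj₂ t }
        all (no xv) (yes _) (no nb₂) = plus b λ { (vx , inj₁ (inj₁ (inj₁ refl))) → ⊥-elim (xv vx) ; (_ , inj₁ (inj₁ (inj₂ s))) → inj₁ s
                                           ; (vb , inj₁ (inj₂ refl)) → ⊥-elim (nb₂ vb) ; (_ , inj₂ t) → inj₂ t }
        all (no xv) (yes vb) (yes vb') = ≤-trans (#-∪ {⁅ b ⁆ ∪ ⁅ b' ⁆} {nb E v ∩ C} λ { (vx , inj₁ (inj₁ (inj₁ refl))) → ⊥-elim (xv vx)
                                           ; (_ , inj₁ (inj₁ (inj₂ s))) → inj₁ (inj₁ s) ; (_ , inj₁ (inj₂ s)) → inj₁ (inj₂ s) ; (vt , inj₂ t) → inj₂ (vt , t) })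
              (≤-trans (+-monoˡ-≤ _ (#-two {⁅ b ⁆ ∪ ⁅ b' ⁆} b b' (λ s → s)))
                (s≤s (#-strict C v (mx vU (e-sym E vb) (e-sym E vb') vx vy λ a → v∉Q (inj₂ a)))))

      module OnHang (r<k : suc r ≤ k) (h : Hang Π) where
        open Hang h
        open HangFacts Π h public

        low₂ : ∀ {v} → v ∈ K → v ≢ z → LowDeg Π₂ v
        low₂ {v} vK vz = (λ { s → ≤-trans (#-two {nb E v ∩ Q} b b' (f s)) r≥2 }) , λ n → ≤-trans (s≤s (#-one {nb E v ∩ Q} x (g n))) r≥2
          where
          f : v ∈ N[ Both ] → ∀ {t} → t ∈ (nb E v ∩ Q) → t ≡ b ⊎ t ≡ b'
          f (c , cB , cv) (vx , inj₁ (inj₁ (inj₁ refl))) = ⊥-elim (x-excl (K⊆U vK) (proj₁ (opposite cB)) vx (e-sym E cv))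
          f _ (_ , inj₁ (inj₁ (inj₂ s))) = inj₁ s
          f _ (_ , inj₁ (inj₂ s)) = inj₂ s
          f _ (vt , inj₂ t) = ⊥-elim (S∌C (S∌ vK) t vt)
          g : v ∉ N[ Both ] → ∀ {t} → t ∈ (nb E v ∩ Q) → t ≡ x
          g n (_ , inj₁ (inj₁ (inj₁ s))) = s
          g n (vb , inj₁ (inj₁ (inj₂ refl))) = ⊥-elim (n (b , inj₁ refl , e-sym E vb))
          g n (vb , inj₁ (inj₂ refl)) = ⊥-elim (n (b' , inj₂ refl , e-sym E vb))
          g n (vt , inj₂ t) = ⊥-elim (S∌C (S∌ vK) t vt)

        free : ∀ {v} → v ∈ K → v ∉ N[ Both ] → ∀ {t} → t ∈ Q → e E v t → t ≡ x
        free vK n (inj₁ (inj₁ (inj₁ s))) _ = s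
        free vK n (inj₁ (inj₁ (inj₂ refl))) vb = ⊥-elim (n (b , inj₁ refl , e-sym E vb))
        free vK n (inj₁ (inj₂ refl)) vb = ⊥-elim (n (b' , inj₂ refl , e-sym E vb))
        free vK n (inj₂ t) vt = ⊥-elim (S∌C (S∌ vK) t vt)

        c₁ = #-elem≢ {C} z r≥2

        big : ∀ {v} → v ∈ K → v ≢ z → Done
        big = Second.second-lift Π h Π₂ (λ a → a) (λ a → a) (≤-trans (n≤1+n r) r<k) low₂ free (inQ end-b) (inQ end-b') bb'
                (≢-sym (x≢β end-b)) (≢-sym (x≢β end-b'))
                (CU (proj₁ (proj₂ c₁)) , (λ s → x∉C (subst (_∈ C) s (proj₁ (proj₂ c₁)))) , (λ s → y∉C (subst (_∈ C) s (proj₁ (proj₂ c₁)))) , proj₂ (proj₂ c₁))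

      -- The outcome that x alone does not settle; when the swapped instance ends in the same way,
      -- `both` applies.
      Info : Set
      Info = ∀ {t} → t ∈ U → e E y t → t ≡ b ⊎ (t ≡ b' ⊎ t ≡ z)

      y-nbr : (∃ λ q → ∀ {t} → t ∈ Q → e E y t → t ≡ q) ⊎ (∀ {t} → t ∈ Q → e E y t → t ≡ b ⊎ t ≡ b')
      y-nbr with ∃? (λ t → has? C t ×-dec e? E y t)
      ... | no none = inj₂ λ { (inj₁ (inj₁ (inj₁ refl))) yx → ⊥-elim (nxy (e-sym E yx)) ; (inj₁ (inj₁ (inj₂ s))) _ → inj₁ s
                             ; (inj₁ (inj₂ s)) _ → inj₂ s ; (inj₂ t) yt → ⊥-elim (none (_ , t , yt)) }
      ... | yes (q , qC , yq) = inj₁ (q , f)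
        where
        f : ∀ {t} → t ∈ Q → e E y t → t ≡ q
        f (inj₁ (inj₁ (inj₁ refl))) yx = ⊥-elim (nxy (e-sym E yx))
        f (inj₁ (inj₁ (inj₂ refl))) yb = ⊥-elim (nty bU (CU qC) yb yq (b~ qC))
        f (inj₁ (inj₂ refl)) yb = ⊥-elim (nty b'U (CU qC) yb yq (b'~ qC))
        f {t} (inj₂ tC) yt with t ≟ q
        ... | yes s = s
        ... | no n = ⊥-elim (nty (CU tC) (CU qC) yt yq (cl tC qC n))

      from-tiny : (∀ {v} → v ∈ D → v ≡ y ⊎ v ≡ z) → Done ⊎ Info
      from-tiny f = go y-nbr
        where
        nby : ∀ {t} → t ∈ U → e E y t → t ∈ Q ⊎ t ≡ z
        nby tU yt with D-closed y∈D tU yt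
        ... | inj₂ q = inj₁ q
        ... | inj₁ tD with f tD
        ... | inj₁ s = ⊥-elim (e-≢ E yt (≡-sym s))
        ... | inj₂ s = inj₂ s
        go : _ → Done ⊎ Info
        go (inj₁ (q , g)) = inj₁ (near-pendant-root nxy q λ tU yt → Data.Sum.map₁ (λ tQ → g tQ yt) (nby tU yt))
        go (inj₂ g) = inj₂ λ tU yt → Data.Sum.[ (λ tQ → Data.Sum.map₂ inj₁ (g tQ yt)) , (λ s → inj₂ (inj₂ s)) ]′ (nby tU yt)

      finish : suc r ≤ k → Outcome Π → Done ⊎ Info
      finish r<k (done d) = inj₁ d
      finish r<k (tiny f) = from-tiny f
      finish r<k (hangY h zK _ w≡y cover) with ∃? (has? (Hang.K h - z))
      ... | yes (v , vK , vz) = inj₁ (OnHang.big r<k h vK vz)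
      ... | no none = from-tiny λ vD → Data.Sum.swap (Data.Sum.map₁ is-z (cover vD))
        where
        is-z : ∀ {t} → t ∈ Hang.K h → t ≡ z
        is-z {t} a with t ≟ z
        ... | yes s = s
        ... | no n = ⊥-elim (none (t , a , n))
      finish r<k (hangW h zK conn w≢y wS yw cover) with ∃? (has? (Hang.K h - z))
      ... | yes (v , vK , vz) = inj₁ (OnHang.big r<k h vK vz)
      ... | no none = inj₁ (single (e? E z b) (e? E z b'))
        where
        open Hang h
        open OnHang r<k h
        is-z : ∀ {t} → t ∈ K → t ≡ z
        is-z {t} a with t ≟ z
        ... | yes s = s
        ... | no n = ⊥-elim (none (t , a , n))
        w≢x = D∌x w∈D
        w≢z : w ≢ z
        w≢z s = w∉K (subst (_∈ K) (≡-sym s) zK)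
        ow : ordinary w
        ow = wU , w≢x , w≢y , w≢z
        zU = K⊆U zK
        z≢x = ∈≢ {K} zK x∉K
        z≢y = ∈≢ {K} zK y∉K
        z∉Q = K∌Q zK
        zD = K⊆D zK
        degw : k ≤ suc (suc r)
        degw = s≤s⁻¹ (≤-trans (deg-ord ow) (≤-trans (#-∪ {⁅ z ⁆ ∪ ⁅ y ⁆} {nb E w ∩ Q} f)
                 (+-mono-≤ (#-two {⁅ z ⁆ ∪ ⁅ y ⁆} z y (λ s → s)) (proj₁ (low ow w∉Q) wS))))
          where
          f : ∀ {t} → t ∈ (nb E w ∩ U) → (t ≡ z ⊎ t ≡ y) ⊎ t ∈ (nb E w ∩ Q)
          f (wt , tU) with D-closed w∈D tU wt
          ... | inj₂ tQ = inj₂ (wt , tQ)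
          ... | inj₁ tD with cover tD
          ... | inj₁ tK = inj₁ (inj₁ (is-z tK))
          ... | inj₂ (inj₁ s) = ⊥-elim (e-≢ E wt (≡-sym s))
          ... | inj₂ (inj₂ s) = inj₁ (inj₂ s)
        nbz : ∀ {t} → t ∈ U → e E z t → t ∈ Q ⊎ t ≡ w
        nbz tU zt with closed zK tU zt
        ... | inj₁ tK = ⊥-elim (e-≢ E zt (≡-sym (is-z tK)))
        ... | inj₂ (inj₁ s) = inj₂ s
        ... | inj₂ (inj₂ q) = inj₁ q
        z~w : e E z w
        z~w with walk-trans (walk-sym E (comp-conn E {U ∖ Q} zD)) (comp-conn E {U ∖ Q} w∈D)
        ... | here s _ = ⊥-elim (w≢z (≡-sym s))
        ... | step _ zt wk with nbz (D⊆U (walk-start wk)) zt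
        ... | inj₁ q = ⊥-elim (D∌Q (walk-start wk) q)
        ... | inj₂ refl = zt
        -- The longest path runs through all of Q, z and w.
        long : ∀ {β} → β ≡ b ⊎ β ≡ b' → e E z β → Path (e E) (has U) x y (5 + r)
        long {β} β∈' zβ with opposite β∈'
        ... | Eβ , β' , Eβ' , ne = subst (Path (e E) (has U) x y) len₀≡ (path-mono
               (λ { (inj₁ a) → Q⊆ (viaQ Eβ' a) ; (inj₂ (inj₁ refl)) → CU c₀C ; (inj₂ (inj₂ (inj₁ refl))) → βU Eβ
                  ; (inj₂ (inj₂ (inj₂ (inj₁ refl)))) → zU ; (inj₂ (inj₂ (inj₂ (inj₂ (inj₁ refl))))) → wU ; (inj₂ (inj₂ (inj₂ (inj₂ (inj₂ refl))))) → y∈U })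
               (path-append (via Eβ' c₀C (r ∸ 1) r-1<) tail meet))
          where
          r≡ : suc (r ∸ 1) ≡ r
          r≡ = m+[n∸m]≡n (≤-trans (s≤s z≤n) r≥2)
          r-1< : r ∸ 1 < r
          r-1< = ≤-reflexive r≡
          F : V → Set
          F t = t ≡ c₀ ⊎ (t ≡ β ⊎ (t ≡ z ⊎ (t ≡ w ⊎ t ≡ y)))
          ≢Q : ∀ {s t} → s ∈ Q → t ∉ Q → s ≢ t
          ≢Q a n refl = n a
          cQ : c₀ ∈ Q
          cQ = inj₂ c₀C
          cβ : c₀ ≢ β
          cβ s = β∉C Eβ (subst (_∈ C) s c₀C)
          tail : Path (e E) F c₀ y 4
          tail = cons (inj₁ refl) (e-sym E (β~ Eβ c₀C)) (path₃ (inj₂ (inj₁ refl) , ≢-sym cβ) (inj₂ (inj₂ (inj₁ refl)) , ≢-sym (≢Q cQ z∉Q))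
                   (inj₂ (inj₂ (inj₂ (inj₁ refl))) , ≢-sym (≢Q cQ w∉Q)) (inj₂ (inj₂ (inj₂ (inj₂ refl))) , ≢-sym (≢Q cQ y∉))
                   (≢Q (inQ Eβ) z∉Q) (≢Q (inQ Eβ) w∉Q) (≢Q (inQ Eβ) y∉) (≢-sym w≢z) z≢y w≢y (e-sym E zβ) z~w (e-sym E yw))
          meet : ∀ {t} → t ≡ x ⊎ (t ≡ β' ⊎ t ∈ C) → F t → t ≡ c₀
          meet _ (inj₁ s) = s
          meet (inj₁ refl) (inj₂ (inj₁ s)) = ⊥-elim (x≢β Eβ s)
          meet (inj₂ (inj₁ refl)) (inj₂ (inj₁ s)) = ⊥-elim (ne s)
          meet (inj₂ (inj₂ a)) (inj₂ (inj₁ refl)) = ⊥-elim (β∉C Eβ a)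
          meet a (inj₂ (inj₂ (inj₁ refl))) = ⊥-elim (z∉Q (viaQ Eβ' a))
          meet a (inj₂ (inj₂ (inj₂ (inj₁ refl)))) = ⊥-elim (w∉Q (viaQ Eβ' a))
          meet a (inj₂ (inj₂ (inj₂ (inj₂ refl)))) = ⊥-elim (y∉ (viaQ Eβ' a))
          len₀≡ : (2 + (r ∸ 1)) + 4 ≡ 5 + r
          len₀≡ = trans (+-comm (2 + (r ∸ 1)) 4) (cong (5 +_) r≡)
        -- k is at most r + 2. Lengths 4 to r + 4 are prefixes to w followed by y, and length r + 5
        -- is `long`.
        finale : ∀ {β} → β ≡ b ⊎ β ≡ b' → e E z β → Done
        finale β∈' zβ = adm 4 1 (s≤s (s≤s z≤n)) (inj₁ refl) λ i i< → P i (≤-trans i< degw)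
          where
          P : ∀ i → i < suc (suc r) → Path (e E) (has U) x y (4 + i * 1)
          P i i< with suc i ≤? suc r
          ... | yes i≤ = subst (Path (e E) (has U) x y) (+-comm _ 1)
                 (path-mono (λ { (inj₁ (inj₁ a)) → Q⊆ a ; (inj₁ (inj₂ refl)) → wU ; (inj₂ (inj₁ refl)) → wU ; (inj₂ (inj₂ refl)) → y∈U })
                   (path-append (prefix wS wU w∉Q i i≤) (path-edge E {A = λ t → t ≡ w ⊎ t ≡ y} (inj₁ refl) (inj₂ refl) (e-sym E yw))
                     λ { _ (inj₁ s) → s ; (inj₁ a) (inj₂ refl) → ⊥-elim (y∉ a) ; (inj₂ s) (inj₂ s') → ⊥-elim (w≢y (trans (≡-sym s) s')) }))
          ... | no i≰ = subst (Path (e E) (has U) x y) (cong (4 +_) (≡-sym (trans (*-identityʳ i) (≤-antisym (s≤s⁻¹ i<) (s≤s⁻¹ (≰⇒> i≰)))))) (long β∈' zβ)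
        single : Dec (e E z b) → Dec (e E z b') → Done
        single (yes zb) _ = finale (inj₁ refl) zb
        single _ (yes zb') = finale (inj₂ refl) zb'
        single (no nzb) (no nzb') = exceptional-near-roots zU z≢x z≢y w ow λ tU zt → f (nbz tU zt) zt
          where
          f : ∀ {t} → t ∈ Q ⊎ t ≡ w → e E z t → t ≡ x ⊎ (t ≡ y ⊎ t ≡ w)
          f (inj₂ s) _ = inj₂ (inj₂ s)
          f (inj₁ (inj₁ (inj₁ (inj₁ s)))) _ = inj₁ s
          f (inj₁ (inj₁ (inj₁ (inj₂ refl)))) zt = ⊥-elim (nzb zt)
          f (inj₁ (inj₁ (inj₂ refl))) zt = ⊥-elim (nzb' zt)
          f (inj₁ (inj₂ t)) zt = ⊥-elim (S∌C (S∌ zK) t zt)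

      result : Done ⊎ Info
      result with suc r ≤? k
      ... | yes r<k = finish r<k (Core.core Π r<k low λ h z∉ → OnHang.big r<k h (proj₂ (Hang.some h)) (∈≢ {Hang.K h} (proj₂ (Hang.some h)) z∉))
      ... | no r≮k with ∃? (λ t → has? S t ×-dec has? D t) | ∃? (λ t → has? N[ Both ] t ×-dec has? D t)
      ... | yes (t , tS , tD) | _ = inj₁ (direct Π (≤-trans (s≤s⁻¹ (≰⇒> r≮k)) (n≤1+n r)) (s≤s (s≤s z≤n)) tS tD)
      ... | no _ | yes (t , tS , tD) = inj₁ (direct Π₂ (s≤s⁻¹ (≰⇒> r≮k)) (s≤s (s≤s z≤n)) tS tD)
      -- D would be joined to Q only through x, so x would separate b from y.
      ... | no noS | no noB = ⊥-elim (impossible (rooted x b bU (≢-sym (x≢β end-b))))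
        where
        impossible : Walk (e E) (has (U - x)) b x ⊎ Walk (e E) (has (U - x)) b y → ⊥
        impossible (inj₁ wk) = proj₂ (walk-end wk) refl
        impossible (inj₂ wk) = D∌Q (walk-stays E {K = has D} cl' y∈D (walk-sym E wk)) (inQ end-b)
          where
          cl' : ∀ {s t} → s ∈ D → s ∈ (U - x) → t ∈ (U - x) → e E s t → t ∈ D
          cl' sD _ (tU , tx) st with D-closed sD tU st
          ... | inj₁ tD = tD
          ... | inj₂ (inj₁ (inj₁ (inj₁ s))) = ⊥-elim (tx s)
          ... | inj₂ (inj₁ (inj₁ (inj₂ refl))) = ⊥-elim (noB (_ , (b , inj₁ refl , e-sym E st) , sD))
          ... | inj₂ (inj₁ (inj₂ refl)) = ⊥-elim (noB (_ , (b' , inj₂ refl , e-sym E st) , sD))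
          ... | inj₂ (inj₂ tC) = ⊥-elim (noS (_ , (_ , tC , e-sym E st) , sD))

    -- Without x and y only b, b' and z lose neighbours. The first two become the roots, each one
    -- edge away from an old root.
    both : ∀ b b' → b ∈ U → b' ∈ U → b ≢ b' → e E x b → e E y b' → ¬ e E x y →
           (∀ {t} → t ∈ U → e E x t → t ≡ b ⊎ (t ≡ b' ⊎ t ≡ z)) → (∀ {t} → t ∈ U → e E y t → t ≡ b ⊎ (t ≡ b' ⊎ t ≡ z)) →
           ∀ {c} → ordinary c → c ≢ b → c ≢ b' → Done
    both b b' bU b'U bb' xb yb' nxy nbx nby {c} oc@(cU , cx , cy , cz) cb cb' = go (rooted? E H b b')
      where
      H : Sub
      H = (U - x) - y
      bx = ≢-sym (e-≢ E xb)
      b'y = ≢-sym (e-≢ E yb')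
      by : b ≢ y
      by refl = nxy xb
      b'x : b' ≢ x
      b'x refl = nxy (e-sym E yb')
      sp : ∀ {v} → v ∈ H → v ≢ b → v ≢ b' → v ≢ z → ∀ {t} → t ∈ U → e E v t → t ∈ H
      sp ((vU , vx) , vy) vb vb' vz {t} tU vt = (tU , tx) , ty
        where
        tx : t ≢ x
        tx refl = Data.Sum.[ vb , Data.Sum.[ vb' , vz ]′ ]′ (nbx vU (e-sym E vt))
        ty : t ≢ y
        ty refl = Data.Sum.[ vb , Data.Sum.[ vb' , vz ]′ ]′ (nby vU (e-sym E vt))
      go : Rooted E H b b' ⊎ Piece E H b b' → Done
      go (inj₁ R) = sandwich
          (sub-adm k≥1 H (λ a → proj₁ (proj₁ a)) x∈U (λ a → proj₂ (proj₁ a) refl) b b' z ((bU , bx) , by) ((b'U , b'x) , b'y) bb' R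
            (λ vH n₁ n₂ n₃ → deg-in H (proj₁ (proj₁ vH)) (proj₂ (proj₁ vH)) (proj₂ vH) n₃ (sp vH n₁ n₂ n₃))
            ((cU , cx) , cy) cb cb' cz)
          (1 , path-edge E {A = λ t → t ≡ x ⊎ t ≡ b} (inj₁ refl) (inj₂ refl) xb)
          (1 , path-edge E {A = λ t → t ≡ y ⊎ t ≡ b'} (inj₁ refl) (inj₂ refl) yb')
          (λ a → proj₁ (proj₁ a))
          (λ { (inj₁ refl) → x∈U , (λ a → ⊥-elim (proj₂ (proj₁ a) refl)) ; (inj₂ refl) → bU , λ _ → refl })
          (λ { (inj₁ refl) → y∈U , (λ a → ⊥-elim (proj₂ a refl)) ; (inj₂ refl) → b'U , λ _ → refl })
          (λ { (inj₁ refl) (inj₁ s) → x≢y s ; (inj₁ refl) (inj₂ s) → b'x (≡-sym s) ; (inj₂ refl) (inj₁ s) → by s ; (inj₂ refl) (inj₂ s) → bb' s })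
      go (inj₂ Π) = rest (has? K z)
        where
        open Piece Π
        KU : ∀ {t} → t ∈ K → t ∈ U
        KU a = proj₁ (proj₁ (K⊆U a))
        xK : x ∉ K
        xK a = proj₂ (proj₁ (K⊆U a)) refl
        yK : y ∉ K
        yK a = proj₂ (K⊆U a) refl
        nbK : ∀ {a t} → a ∈ K → a ≢ z → t ∈ U → e E a t → t ∈ K ⊎ t ≡ w
        nbK aK az tU at = closed aK (sp (K⊆U aK) (∈≢ {K} aK x∉K) (∈≢ {K} aK y∉K) az tU at) at
        rest : Dec (z ∈ K) → Done
        rest (no z∉) = two-attachments' K KU xK yK w x (λ aK tU at → Data.Sum.map₂ inj₁ (nbK aK (∈≢ {K} aK z∉) tU at)) bb' bU b'U x∉K y∉K bx b'x
                         (proj₂ some) (∈≢ {K} (proj₂ some) z∉)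
        rest (yes zK) with ∃? (has? (K - z))
        ... | yes (t , tK , tz) = two-attachments' (K - z) (λ a → KU (proj₁ a)) (λ a → xK (proj₁ a)) (λ a → yK (proj₁ a)) w z nb' bb' bU b'U
                                   (λ a → x∉K (proj₁ a)) (λ a → y∉K (proj₁ a)) (≢-sym (∈≢ {K} zK x∉K)) (≢-sym (∈≢ {K} zK y∉K)) (tK , tz) tz
          where
          nb' : Nb (K - z) (⁅ w ⁆ ∪ ⁅ z ⁆)
          nb' {b = s} (aK , az) sU as with s ≟ z | nbK aK az sU as
          ... | yes q | _ = inj₂ (inj₂ q)
          ... | no n | inj₁ q = inj₁ (q , n)
          ... | no _ | inj₂ q = inj₂ (inj₁ q)
        ... | no none = exceptional-near-roots' (KU zK) (∈≢ {K} zK xK) (∈≢ {K} zK yK) w (≢-sym (∈≢ {K} zK w∉K)) oc nbz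
          where
          nbz : ∀ {t} → t ∈ U → e E z t → t ≡ x ⊎ (t ≡ y ⊎ t ≡ w)
          nbz {t} tU zt with t ≟ x | t ≟ y
          ... | yes s | _ = inj₁ s
          ... | no _ | yes s = inj₂ (inj₁ s)
          ... | no n₁ | no n₂ with closed zK ((tU , n₁) , n₂) zt
          ... | inj₂ s = inj₂ (inj₂ s)
          ... | inj₁ tK = ⊥-elim (none (t , tK , ≢-sym (e-≢ E zt)))

    -- Complete bipartite graphs at a root

    notall? : ∀ A v → Dec (NotAll E A v)
    notall? A v = ∃? (λ c → has? A c ×-dec ¬? (e? E v c))

    Com : Sub → Sub
    Com A = sub (λ v → v ∈ U × v ≢ y × ¬ NotAll E A v) (λ v → has? U v ×-dec (¬? (v ≟ y) ×-dec ¬? (notall? A v)))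

    com-adj : ∀ {A v a} → v ∈ Com A → a ∈ A → e E v a
    com-adj {A} {v} {a} (_ , _ , n) aA with e? E v a
    ... | yes p = p
    ... | no q = ⊥-elim (n (a , aA , q))

    NoTri₂ : Set
    NoTri₂ = ∀ {b u v} → b ∈ U → u ∈ U → v ∈ U → u ≢ y → v ≢ y → e E x b → e E b u → e E b v → e E u v → ⊥

    -- `few` is the extremal property behind the balance with p = `# A`: no vertex outside could
    -- join A without being covered by few neighbours in B.
    record Biclique : Set₁ where
      field
        A    : Sub
        A⊆U  : A ⊆ U
        x∈A  : x ∈ A
        y∉A  : y ∉ A
        A≤B  : # A ≤ # (Com A)
        B≥2  : 2 ≤ # (Com A)
        few  : ∀ {v} → v ∈ U → v ≢ y → v ∉ A → # (nb E v ∩ Com A) ≤ # A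
      B : Sub
      B = Com A
      BU : ∀ {b} → b ∈ B → b ∈ U
      BU a = proj₁ a
      B≢y : ∀ {b} → b ∈ B → b ≢ y
      B≢y a = proj₁ (proj₂ a)
      A≢y : ∀ {a} → a ∈ A → a ≢ y
      A≢y a refl = y∉A a
      AB : ∀ {a b} → a ∈ A → b ∈ B → e E a b
      AB aA bB = e-sym E (com-adj {A} bB aA)
      xB : ∀ {b} → b ∈ B → e E x b
      xB = AB x∈A
      A∌B : ∀ {a} → a ∈ A → a ∉ B
      A∌B aA aB = e-irr E (AB aA aB)

    -- Start with A consisting of x. A vertex with more than `# A` neighbours in the common
    -- neighbourhood is added to A; these neighbours form the new common neighbourhood, which is
    -- therefore still at least as large as A.
    biclique : ¬ e E x y → 2 ≤ # (nb E x ∩ U) → Biclique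
    biclique nxy d = go (# U) ⁅ x ⁆ (λ { refl → x∈U }) refl (λ s → x≢y (≡-sym s)) (≤-trans one (≤-trans (s≤s z≤n) B≥) ) B≥ (m≤n+m _ _)
      where
      one : # ⁅ x ⁆ ≤ 1
      one = #-one {⁅ x ⁆} x (λ s → s)
      B≥ : 2 ≤ # (Com ⁅ x ⁆)
      B≥ = ≤-trans d (#-mono {nb E x ∩ U} {Com ⁅ x ⁆} λ (xv , vU) → vU , (λ { refl → nxy xv }) , λ { (_ , refl , n) → n (e-sym E xv) })
      go : ∀ n (A : Sub) → A ⊆ U → x ∈ A → y ∉ A → # A ≤ # (Com A) → 2 ≤ # (Com A) → # U ≤ # A + n → Biclique
      go n A A⊆ xA yA A≤ B≥ le with ∃? (λ v → has? U v ×-dec (¬? (v ≟ y) ×-dec (¬? (has? A v) ×-dec (suc (# A) ≤? # (nb E v ∩ Com A)))))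
      ... | no none = record { A = A ; A⊆U = A⊆ ; x∈A = xA ; y∉A = yA ; A≤B = A≤ ; B≥2 = B≥
                             ; few = λ {v} a b c → ≮⇒≥ λ lt → none (v , a , b , c , lt) }
      ... | yes (v , vU , vy , v∉ , lt) = next n le
        where
        A₁ : Sub
        A₁ = A ∪ ⁅ v ⁆
        bigger : # A < # A₁
        bigger = #-< {A} {A₁} {v} inj₁ (inj₂ refl) v∉
        A₁⊆ : A₁ ⊆ U
        A₁⊆ (inj₁ a) = A⊆ a
        A₁⊆ (inj₂ refl) = vU
        size : # A₁ ≤ suc (# A)
        size = ≤-trans (#-∪ {⁅ v ⁆} {A} Data.Sum.swap) (+-monoˡ-≤ _ (#-one {⁅ v ⁆} v (λ s → s)))
        B₁≥ : suc (# A) ≤ # (Com A₁)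
        B₁≥ = ≤-trans lt (#-mono {nb E v ∩ Com A} {Com A₁} λ { (vb , (bU , by , n)) → bU , by ,
                λ { (c , inj₁ cA , nc) → n (c , cA , nc) ; (c , inj₂ refl , nc) → nc (e-sym E vb) } })
        next : ∀ n → # U ≤ # A + n → Biclique
        next zero le = ⊥-elim (<⇒≱ (≤-trans bigger (#-mono {A₁} {U} A₁⊆)) (≤-trans le (≤-reflexive (+-identityʳ _))))
        next (suc n) le = go n A₁ A₁⊆ (inj₁ xA) (λ { (inj₁ a) → yA a ; (inj₂ s) → vy (≡-sym s) }) (≤-trans size B₁≥)
          (≤-trans (s≤s (#-pos {A} xA)) B₁≥) (≤-trans le (≤-trans (≤-reflexive (+-suc _ n)) (+-monoˡ-≤ n bigger)))

    record Info : Set₁ where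
      field
        bic   : Biclique
      open Biclique bic public
      field
        A≥2   : 2 ≤ # A
        nby   : (∀ {t} → t ∈ U → e E y t → t ∈ A ⊎ t ∈ B) ⊎
                (∃ λ u → u ∉ A × u ∉ B × e E y u × z ∉ A × z ∉ B × (u ≡ z ⊎ (z ∈ U × z ≢ y × e E u z × ∃ λ b → b ∈ B × e E b u)) ×
                   (∀ {t} → t ∈ U → e E y t → (t ∈ A ⊎ t ∈ B) ⊎ t ≡ u))

    module Bip (nxy : ¬ e E x y) (ntx : NoTri x) (nty : NoTri y) (nt₂ : NoTri₂) (bic : Biclique) where
      open Biclique bic

      s : ℕ
      s = # A
      s≥1 : 1 ≤ s
      s≥1 = #-pos {A} x∈A
      indep : ∀ {b b'} → b ∈ B → b' ∈ B → ¬ e E b b'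
      indep a c = ntx (BU a) (BU c) (xB a) (xB c)
      x∉B : x ∉ B
      x∉B a = e-irr E (xB a)
      B≢x : ∀ {b} → b ∈ B → b ≢ x
      B≢x a refl = x∉B a
      -- A triangle on v, a and b contains b, a neighbour of x, and possibly x itself; both kinds
      -- are excluded.
      excl : ∀ {v a b} → v ∈ U → v ≢ y → a ∈ A → b ∈ B → e E v a → e E v b → ⊥
      excl {v} {a} vU vy aA bB va vb with a ≟ x
      ... | yes refl = ntx vU (BU bB) (e-sym E va) (xB bB) vb
      ... | no _ = nt₂ (BU bB) vU (A⊆U aA) vy (A≢y aA) (xB bB) (e-sym E vb) (e-sym E (AB aA bB)) va
      fewA : ∀ {v} → v ∈ U → v ≢ y → v ∉ B → # (nb E v ∩ A) < s
      fewA {v} vU vy v∉ with notall? A v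
      ... | yes na = #-strict A v na
      ... | no n = ⊥-elim (v∉ (vU , vy , n))

      Q : Sub
      Q = A ∪ B
      Q⊆ : Q ⊆ U
      Q⊆ (inj₁ a) = A⊆U a
      Q⊆ (inj₂ b) = BU b
      y∉ : y ∉ Q
      y∉ (inj₁ a) = y∉A a
      y∉ (inj₂ b) = B≢y b refl
      A₀ : Sub
      A₀ = A - x
      s≤ : s ≤ suc (# A₀)
      s≤ = #-remove {A} x

      -- Within the bipartite graph the parity of the length is determined by the side, so both path
      -- systems have difference 2.
      pathB : ∀ {b} → b ∈ B → ∀ j → j < s → Path (e E) (has Q) x b (1 + j * 2)
      pathB bB j j< = path-mono (λ { (inj₁ refl) → inj₁ x∈A ; (inj₂ (inj₁ a)) → inj₁ (proj₁ a) ; (inj₂ (inj₂ b)) → inj₂ b })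
        (zigzag E j A₀ B x _ xB (λ a → AB (proj₁ a)) (λ a → proj₂ a refl) (λ a → A∌B (proj₁ a)) bB (s≤s⁻¹ (≤-trans j< s≤)) (≤-trans j< A≤B))

      b₁∈ = #-elem {B} (≤-trans (s≤s z≤n) B≥2)
      b₁ = proj₁ b₁∈
      b₁B = proj₂ b₁∈

      pathA : ∀ {a} → a ∈ A₀ → ∀ j → j < # A₀ → Path (e E) (has Q) x a (2 + j * 2)
      pathA aA j j< = cons (inj₁ x∈A) (xB b₁B) (path-mono
          (λ { (inj₁ refl) → inj₂ b₁B , B≢x b₁B ; (inj₂ (inj₁ b)) → inj₂ (proj₁ b) , B≢x (proj₁ b) ; (inj₂ (inj₂ a)) → inj₁ (proj₁ a) , proj₂ a })
          (zigzag E j (B - b₁) A₀ b₁ _ (λ a → e-sym E (AB (proj₁ a) b₁B)) (λ b a → e-sym E (AB (proj₁ a) (proj₁ b))) (λ c → proj₂ c refl) (λ b a → A∌B (proj₁ a) (proj₁ b)) aA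
            (≤-trans (<⇒≤ j<) A₀≤) j<))
        where
        A₀≤ : # A₀ ≤ # (B - b₁)
        A₀≤ = s≤s⁻¹ (≤-trans (#-< {A₀} {A} {x} proj₁ x∈A (λ a → proj₂ a refl)) (≤-trans A≤B (#-remove {B} b₁)))

      extend : ∀ {T : Sub} {m l} → (∀ {c} → c ∈ T → ∀ j → j < m → Path (e E) (has Q) x c (l + j * 2)) → T ⊆ Q → ∀ {v} → v ∈ N[ T ] → v ∉ Q →
               ∀ j → j < m → Path (e E) (λ t → t ∈ Q ⊎ t ≡ v) x v (suc l + j * 2)
      extend {T} {m} {l} pth T⊆ {v} (c , cT , cv) v∉ j j< = subst (Path (e E) _ x v) (+-comm (l + j * 2) 1)
            (path-mono (λ { (inj₁ a) → inj₁ a ; (inj₂ (inj₁ refl)) → inj₁ (T⊆ cT) ; (inj₂ (inj₂ eq)) → inj₂ eq })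
              (path-append (pth cT j j<) (path-edge E {A = λ t → t ≡ c ⊎ t ≡ v} (inj₁ refl) (inj₂ refl) cv)
                λ { _ (inj₁ eq) → eq ; a (inj₂ refl) → ⊥-elim (v∉ a) }))

      Π : Prefix
      Π = record
        { Q = Q ; S = N[ B ] ; p = s ; len₀ = 2 ; dif = 2 ; Q⊆U = Q⊆ ; x∈Q = inj₁ x∈A ; y∉Q = y∉
        ; extra = b₁ , inj₂ b₁B , B≢x b₁B ; p≥1 = s≥1 ; len₀≥1 = s≤s z≤n ; dif≡ = inj₂ refl
        ; prefix = λ {v} vS _ v∉ → extend {B} {s} {1} pathB inj₂ {v} vS v∉ }
      open Prefix Π hiding (Q ; Q⊆U)

      S∌B : ∀ {v} → v ∉ S → ∀ {b} → b ∈ B → ¬ e E v b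
      S∌B n bB vb = n (_ , bB , e-sym E vb)

      low : ∀ {v} → ordinary v → v ∉ Q → LowDeg Π v
      low {v} (vU , vx , vy , _) v∉Q =
        (λ (b , bB , bv) → ≤-trans (#-mono {nb E v ∩ Q} {nb E v ∩ B} λ { (va , inj₁ aA) → ⊥-elim (excl vU vy aA bB va (e-sym E bv)) ; (vb , inj₂ c) → vb , c })
                             (few vU vy (λ a → v∉Q (inj₁ a)))) ,
        (λ n → ≤-trans (s≤s (#-mono {nb E v ∩ Q} {nb E v ∩ A} λ { (va , inj₁ aA) → va , aA ; (vb , inj₂ c) → ⊥-elim (S∌B n c vb) })) (fewA vU vy (λ a → v∉Q (inj₂ a))))

      module OnHang (h : Hang Π) where
        open Hang h
        open HangFacts Π h public
        nbK : ∀ {a t} → a ∈ K → t ∈ U → e E a t → t ∈ K ⊎ (t ≡ w ⊎ t ∈ A)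
        nbK aK tU at with closed aK tU at
        ... | inj₁ a = inj₁ a
        ... | inj₂ (inj₁ a) = inj₂ (inj₁ a)
        ... | inj₂ (inj₂ (inj₁ a)) = inj₂ (inj₂ a)
        ... | inj₂ (inj₂ (inj₂ b)) = ⊥-elim (S∌B (S∌ aK) b at)
        -- With A only x, a neighbour of x in K would belong to B. So K would have w as its sole
        -- attachment.
        alone : (∀ {a} → a ∈ A → a ≡ x) → ⊥
        alone only with exit K ⁅ w ⁆ x∉K y∉K nb' w (proj₂ some) (K⊆U (proj₂ some)) (∈≢ {K} (proj₂ some) w∉K)
          where
          nb' : Nb K ⁅ w ⁆
          nb' aK tU at with nbK aK tU at
          ... | inj₁ a = inj₁ a
          ... | inj₂ (inj₁ a) = inj₂ a
          ... | inj₂ (inj₂ tA) = ⊥-elim (K∌Q aK (inj₂ (K⊆U aK , ∈≢ {K} aK y∉K , λ { (c , cA , n) → n (subst (e E _) (trans (only tA) (≡-sym (only cA))) at) })))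
        ... | r , s , _ , n , _ = n s

      bz = #-elem≢ {B} z B≥2
      ord-b : ordinary (proj₁ bz)
      ord-b = BU (proj₁ (proj₂ bz)) , (λ { eq → x∉B (subst (_∈ B) eq (proj₁ (proj₂ bz))) }) , B≢y (proj₁ (proj₂ bz)) , proj₂ (proj₂ bz)
      b₂∈ = #-elem≢ {B} b₁ B≥2
      b₂B = proj₁ (proj₂ b₂∈)
      b₂≢b₁ = proj₂ (proj₂ b₂∈)

      nb-tiny : (∀ {v} → v ∈ D → v ≡ y ⊎ v ≡ z) → ∀ {t} → t ∈ U → e E y t → (t ∈ A ⊎ t ∈ B) ⊎ t ≡ z
      nb-tiny f tU yt with D-closed y∈D tU yt
      ... | inj₂ q = inj₁ q
      ... | inj₁ tD with f tD
      ... | inj₁ eq = ⊥-elim (e-≢ E yt (≡-sym eq))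
      ... | inj₂ eq = inj₂ eq

      module Wide (s≥2 : 2 ≤ s) where
        A₀≥1 : 1 ≤ # A₀
        A₀≥1 = s≤s⁻¹ (≤-trans s≥2 s≤)

        -- The way out of Q through A without x, for hanging parts: they miss the neighbours of B,
        -- so their neighbours in Q are all in A.
        Π₂ : Prefix
        Π₂ = record
          { Q = Q ; S = N[ A₀ ] ; p = # A₀ ; len₀ = 3 ; dif = 2 ; Q⊆U = Q⊆ ; x∈Q = inj₁ x∈A ; y∉Q = y∉
          ; extra = b₁ , inj₂ b₁B , B≢x b₁B ; p≥1 = A₀≥1 ; len₀≥1 = s≤s z≤n ; dif≡ = inj₂ refl
          ; prefix = λ {v} vS _ v∉ → extend {A₀} {# A₀} {2} pathA (λ a → inj₁ (proj₁ a)) {v} vS v∉ }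

        A₀<s : # A₀ < s
        A₀<s = #-< {A₀} {A} {x} proj₁ x∈A (λ a → proj₂ a refl)

        tiny-info : (∀ {v} → v ∈ D → v ≡ y ⊎ v ≡ z) → Info
        tiny-info f with e? E y z | has? A z | has? B z
        ... | yes yz | no z∉A | no z∉B = record { bic = bic ; A≥2 = s≥2 ; nby = inj₂ (z , z∉A , z∉B , yz , z∉A , z∉B , inj₁ refl , nb-tiny f) }
        ... | no nyz | _ | _ = record { bic = bic ; A≥2 = s≥2 ; nby = inj₁ λ tU yt → Data.Sum.[ (λ a → a) , (λ { refl → ⊥-elim (nyz yt) }) ]′ (nb-tiny f tU yt) }
        ... | yes _ | yes zA | _ = record { bic = bic ; A≥2 = s≥2 ; nby = inj₁ λ tU yt → Data.Sum.[ (λ a → a) , (λ { refl → inj₁ zA }) ]′ (nb-tiny f tU yt) }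
        ... | yes _ | no _ | yes zB = record { bic = bic ; A≥2 = s≥2 ; nby = inj₁ λ tU yt → Data.Sum.[ (λ a → a) , (λ { refl → inj₂ zB }) ]′ (nb-tiny f tU yt) }

        -- A vertex of K without a neighbour in `A₀` may still be adjacent to x; this one lost
        -- neighbour is affordable only if p is at least 2.
        big₃ : 2 ≤ # A₀ → s ≤ k → (h : Hang Π) → ∀ {v} → v ∈ Hang.K h → v ≢ z → Done
        big₃ A₀≥2 s≤k h = Second.second-lift Π h Π₂ (λ a → a) (λ a → a) (≤-trans (<⇒≤ A₀<s) s≤k) low₂ free (inj₂ b₁B) (inj₂ b₂B) (≢-sym b₂≢b₁)
                          (B≢x b₁B) (B≢x b₂B) ord-b
          where
          open Hang h
          open OnHang h
          toA : ∀ {v} → v ∈ K → ∀ {t} → t ∈ (nb E v ∩ Q) → t ∈ (nb E v ∩ A)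
          toA vK (va , inj₁ a) = va , a
          toA vK (vb , inj₂ b) = ⊥-elim (S∌B (S∌ vK) b vb)
          free : ∀ {v} → v ∈ K → v ∉ N[ A₀ ] → ∀ {t} → t ∈ Q → e E v t → t ≡ x
          free vK n {t} tQ vt with toA vK (vt , tQ) | t ≟ x
          ... | _ | yes eq = eq
          ... | _ , tA | no ne = ⊥-elim (n (t , (tA , ne) , e-sym E vt))
          low₂ : ∀ {v} → v ∈ K → v ≢ z → LowDeg Π₂ v
          low₂ {v} vK vz = (λ _ → s≤s⁻¹ (≤-trans (≤-trans (s≤s (#-mono {nb E v ∩ Q} {nb E v ∩ A} (toA vK))) (fewA (K⊆U vK) (∈≢ {K} vK y∉K) (λ b → K∌Q vK (inj₂ b)))) s≤)) ,
                           (λ n → ≤-trans (s≤s (#-one {nb E v ∩ Q} x λ (vt , tQ) → free vK n tQ vt)) A₀≥2)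

        single : (h : Hang Π) → let open Hang h in z ∈ K → (∀ {t} → t ∈ K → t ≡ z) → w ≢ y → w ∈ S → e E y w → (∀ {v} → v ∈ D → v ∈ K ⊎ (v ≡ w ⊎ v ≡ y)) → Info
        single h zK is-z w≢y (b , bB , bw) yw cover = record { bic = bic ; A≥2 = s≥2 ; nby = inj₂ (w , (λ a → w∉Q (inj₁ a)) , (λ a → w∉Q (inj₂ a)) , yw ,
            (λ a → K∌Q zK (inj₁ a)) , (λ a → K∌Q zK (inj₂ a)) , inj₂ (K⊆U zK , ∈≢ {K} zK y∉K , e-sym E z~w , b , bB , bw) , nby') }
          where
          open Hang h
          open OnHang h
          nby' : ∀ {t} → t ∈ U → e E y t → (t ∈ A ⊎ t ∈ B) ⊎ t ≡ w
          nby' tU yt with D-closed y∈D tU yt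
          ... | inj₂ q = inj₁ q
          ... | inj₁ tD with cover tD
          ... | inj₁ tK = ⊥-elim (nb-y w≢y tU yt tK)
          ... | inj₂ (inj₁ eq) = inj₂ eq
          ... | inj₂ (inj₂ eq) = ⊥-elim (e-≢ E yt (≡-sym eq))
          z~w : e E z w
          z~w with walk-trans (walk-sym E (comp-conn E {U ∖ Q} (K⊆D zK))) (comp-conn E {U ∖ Q} w∈D)
          ... | here eq _ = ⊥-elim (w∉K (subst (_∈ K) eq zK))
          ... | step _ zt wk with closed zK (D⊆U (walk-start wk)) zt
          ... | inj₁ tK = ⊥-elim (e-≢ E zt (≡-sym (is-z tK)))
          ... | inj₂ (inj₁ refl) = zt
          ... | inj₂ (inj₂ q) = ⊥-elim (D∌Q (walk-start wk) q)

        only-z : (K : Sub) → ¬ (∃ λ v → v ∈ (K - z)) → ∀ {t} → t ∈ K → t ≡ z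
        only-z K none {t} a with t ≟ z
        ... | yes eq = eq
        ... | no n = ⊥-elim (none (t , a , n))

        finish₃ : 2 ≤ # A₀ → s ≤ k → Outcome Π → Done ⊎ Info
        finish₃ g s≤k (done d) = inj₁ d
        finish₃ g s≤k (tiny f) = inj₂ (tiny-info f)
        finish₃ g s≤k (hangY h zK conn _ cover) with ∃? (has? (Hang.K h - z))
        ... | yes (v , vK , vz) = inj₁ (big₃ g s≤k h vK vz)
        ... | no none = inj₂ (tiny-info λ vD → Data.Sum.swap (Data.Sum.map₁ (only-z (Hang.K h) none) (cover vD)))
        finish₃ g s≤k (hangW h zK conn w≢y wS yw cover) with ∃? (has? (Hang.K h - z))
        ... | yes (v , vK , vz) = inj₁ (big₃ g s≤k h vK vz)
        ... | no none = inj₂ (single h zK (only-z (Hang.K h) none) w≢y wS yw cover)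

        -- A is x and a, so hanging parts have the attachments x, a and w, and the results on three
        -- attachments replace the second contraction.
        module Two (A₀≤1 : # A₀ ≤ 1) where
          a∈ = #-elem {A₀} A₀≥1
          a = proj₁ a∈
          aA : a ∈ A
          aA = proj₁ (proj₂ a∈)
          a≢x : a ≢ x
          a≢x = proj₂ (proj₂ a∈)
          a≢y : a ≢ y
          a≢y = A≢y aA
          isA : ∀ {t} → t ∈ A → t ≡ x ⊎ t ≡ a
          isA {t} tA with t ≟ x | t ≟ a
          ... | yes eq | _ = inj₁ eq
          ... | no _ | yes eq = inj₂ eq
          ... | no n₁ | no n₂ = ⊥-elim (<⇒≱ (≤-trans (s≤s (#-pos {A₀ - a} {t} ((tA , n₁) , n₂))) (#-< {A₀ - a} {A₀} {a} proj₁ (proj₂ a∈) (λ b → proj₂ b refl))) A₀≤1)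
          B≢a : ∀ {b} → b ∈ B → b ≢ a
          B≢a bB refl = A∌B aA bB

          module OnHang₂ (h : Hang Π) where
            open Hang h
            open OnHang h public
            nbx : Nb K (⁅ x ⁆ ∪ (⁅ a ⁆ ∪ ⁅ w ⁆))
            nbx vK tU vt with nbK vK tU vt
            ... | inj₁ c = inj₁ c
            ... | inj₂ (inj₁ eq) = inj₂ (inj₂ (inj₂ eq))
            ... | inj₂ (inj₂ tA) = inj₂ (Data.Sum.map₂ inj₁ (isA tA))
            excl₂ : ∀ {v} → v ∈ K → e E v x → e E v a → ⊥
            excl₂ {v} vK vx va = K∌Q vK (inj₂ (K⊆U vK , ∈≢ {K} vK y∉K , λ (c , cA , n) → n (Data.Sum.[ (λ eq → subst (e E v) (≡-sym eq) vx) , (λ eq → subst (e E v) (≡-sym eq) va) ]′ (isA cA))))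

          hyp₂ : (h : Hang Π) → z ∉ Hang.K h → Done
          hyp₂ h z∉ = two (proj₂ some) (snd (proj₂ some) (e? E (proj₁ some) x))
            where
            open Hang h
            open OnHang₂ h
            snd : ∀ {v} → v ∈ K → Dec (e E v x) → ∃ λ v' → v' ∈ K × v ≢ v'
            snd vK (yes vx) = second vK (∈≢ {K} vK z∉) x λ { (inj₁ tA) vt → Data.Sum.[ (λ eq → eq) , (λ { refl → ⊥-elim (excl₂ vK vx vt) }) ]′ (isA tA)
                                                           ; (inj₂ b) vb → ⊥-elim (S∌B (S∌ vK) b vb) }
            snd vK (no nvx) = second vK (∈≢ {K} vK z∉) a λ { (inj₁ tA) vt → Data.Sum.[ (λ { refl → ⊥-elim (nvx vt) }) , (λ eq → eq) ]′ (isA tA)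
                                                           ; (inj₂ b) vb → ⊥-elim (S∌B (S∌ vK) b vb) }
            two : ∀ {v} → v ∈ K → (∃ λ v' → v' ∈ K × v ≢ v') → Done
            two vK (v' , v'K , ne) = three-attachments K K⊆U x∉K y∉K z∉ x a w nbx (BU b₁B) (Q∉K (inj₂ b₁B)) (B≢x b₁B) (B≢a b₁B) (∈≢ {B} b₁B (λ c → w∉Q (inj₂ c))) vK v'K ne

          finish₂ : Outcome Π → Done ⊎ Info
          finish₂ (done d) = inj₁ d
          finish₂ (tiny f) = inj₂ (tiny-info f)
          finish₂ (hangY h zK _ w≡y _) = inj₁ (attached-to-roots K K⊆U x∉K y∉K zK a nb' (BU b₁B) (BU b₂B) (Q∉K (inj₂ b₁B)) (Q∉K (inj₂ b₂B)) (≢-sym b₂≢b₁) (AB aA b₁B) (AB aA b₂B)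
                                            (BU b₁B) (Q∉K (inj₂ b₁B)) (B≢x b₁B) (B≢y b₁B) (B≢a b₁B))
            where
            open Hang h
            open OnHang₂ h
            nb' : Nb K (⁅ x ⁆ ∪ (⁅ y ⁆ ∪ ⁅ a ⁆))
            nb' vK tU vt with nbx vK tU vt
            ... | inj₁ c = inj₁ c
            ... | inj₂ (inj₁ eq) = inj₂ (inj₁ eq)
            ... | inj₂ (inj₂ (inj₁ eq)) = inj₂ (inj₂ (inj₂ eq))
            ... | inj₂ (inj₂ (inj₂ eq)) = inj₂ (inj₂ (inj₁ (trans eq w≡y)))
          finish₂ (hangW h zK conn w≢y wS@(b , bB , bw) yw cover) with ∃? (has? (Hang.K h - z))
          ... | no none = inj₂ (single h zK (only-z (Hang.K h) none) w≢y wS yw cover)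
          ... | yes (v , vK , vz) = inj₁ (q? (∃? λ t → (has? A t ⊎-dec has? B t) ×-dec e? E y t))
            where
            open Hang h
            open OnHang₂ h
            a∉K : a ∉ K
            a∉K = Q∉K (inj₁ aA)
            w≢x = D∌x w∈D
            w≢a : w ≢ a
            w≢a eq = w∉Q (inj₁ (subst (_∈ A) (≡-sym eq) aA))
            T : V → Set
            T t = (t ≡ a ⊎ t ∈ B) ⊎ (t ≡ w ⊎ t ≡ y)
            T⊆ : ∀ {t} → T t → t ∈ U × t ∉ K × t ≢ x
            T⊆ (inj₁ (inj₁ refl)) = A⊆U aA , a∉K , a≢x
            T⊆ (inj₁ (inj₂ c)) = BU c , Q∉K (inj₂ c) , B≢x c
            T⊆ (inj₂ (inj₁ refl)) = wU , w∉K , w≢x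
            T⊆ (inj₂ (inj₂ refl)) = y∈U , y∉K , ≢-sym x≢y
            long : Path (e E) T a y 3
            long = path₃ (inj₁ (inj₁ refl)) (inj₁ (inj₂ bB)) (inj₂ (inj₁ refl)) (inj₂ (inj₂ refl)) (≢-sym (B≢a bB)) (≢-sym w≢a) a≢y (∈≢ {B} bB (λ c → w∉Q (inj₂ c))) (B≢y bB) w≢y
                     (AB aA bB) bw (e-sym E yw)
            q? : Dec (∃ λ t → (t ∈ A ⊎ t ∈ B) × e E y t) → Done
            q? (no none) = near-pendant-root nxy w nby'
              where
              nby' : ∀ {t} → t ∈ U → e E y t → t ≡ w ⊎ t ≡ z
              nby' tU yt with D-closed y∈D tU yt
              ... | inj₂ q = ⊥-elim (none (_ , q , yt))
              ... | inj₁ tD with cover tD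
              ... | inj₁ tK = ⊥-elim (nb-y w≢y tU yt tK)
              ... | inj₂ (inj₁ eq) = inj₁ eq
              ... | inj₂ (inj₂ eq) = ⊥-elim (e-≢ E yt (≡-sym eq))
            q? (yes (t , inj₁ tA , yt)) with isA tA
            ... | inj₁ refl = ⊥-elim (nxy (e-sym E yt))
            ... | inj₂ refl = behind-three K K⊆U x∉K y∉K zK a w (A⊆U aA) a≢x a≢y a∉K w∉K w≢x w≢y w≢a nbx conn vK vz excl₂ T T⊆ {1} {2} (inj₂ refl)
                  (path-edge E (inj₁ (inj₁ refl)) (inj₂ (inj₂ refl)) (e-sym E yt)) long
            q? (yes (t , inj₂ tB , yt)) = behind-three K K⊆U x∉K y∉K zK a w (A⊆U aA) a≢x a≢y a∉K w∉K w≢x w≢y w≢a nbx conn vK vz excl₂ T T⊆ {2} {1} (inj₁ refl)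
                  (path₂ (inj₁ (inj₁ refl)) (inj₁ (inj₂ tB)) (inj₂ (inj₂ refl)) (≢-sym (B≢a tB)) a≢y (B≢y tB) (AB aA tB) (e-sym E yt)) long

        result : Done ⊎ Info
        result with s ≤? k
        ... | yes s≤k = go (2 ≤? # A₀)
          where
          go : Dec (2 ≤ # A₀) → Done ⊎ Info
          go (yes g) = finish₃ g s≤k (Core.core Π s≤k low λ h z∉ → big₃ g s≤k h (proj₂ (Hang.some h)) (∈≢ {Hang.K h} (proj₂ (Hang.some h)) z∉))
          go (no g) = Two.finish₂ le (Core.core Π s≤k low (Two.hyp₂ le))
            where
            le : # A₀ ≤ 1
            le = s≤s⁻¹ (≰⇒> g)
        ... | no s≰k with ∃? (λ t → has? S t ×-dec has? D t) | ∃? (λ t → has? N[ A₀ ] t ×-dec has? D t)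
        ... | yes (t , tS , tD) | _ = inj₁ (direct Π (≤-trans (n≤1+n k) (≰⇒> s≰k)) ≤-refl tS tD)
        ... | no _ | yes (t , tS , tD) = inj₁ (direct Π₂ (s≤s⁻¹ (≤-trans (≰⇒> s≰k) s≤)) (s≤s (s≤s z≤n)) tS tD)
        ... | no noB | no noA = ⊥-elim (impossible (rooted x b₁ (BU b₁B) (B≢x b₁B)))
          where
          impossible : Walk (e E) (has (U - x)) b₁ x ⊎ Walk (e E) (has (U - x)) b₁ y → ⊥
          impossible (inj₁ wk) = proj₂ (walk-end wk) refl
          impossible (inj₂ wk) = D∌Q (walk-stays E {K = has D} cl y∈D (walk-sym E wk)) (inj₂ b₁B)
            where
            cl : ∀ {s t} → s ∈ D → s ∈ (U - x) → t ∈ (U - x) → e E s t → t ∈ D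
            cl sD _ (tU , tx) st with D-closed sD tU st
            ... | inj₁ tD = tD
            ... | inj₂ (inj₁ tA) = ⊥-elim (noA (_ , (_ , (tA , tx) , e-sym E st) , sD))
            ... | inj₂ (inj₂ tB) = ⊥-elim (noB (_ , (_ , tB , e-sym E st) , sD))

    -- A≤1 says that no 4-cycle through x avoids y.
    module Lone (nxy : ¬ e E x y) (ntx : NoTri x) (nty : NoTri y) (nt₂ : NoTri₂) (bic : Biclique) (A≤1 : # (Biclique.A bic) ≤ 1) where
      open Biclique bic
      open Bip nxy ntx nty nt₂ bic

      isx : ∀ {a} → a ∈ A → a ≡ x
      isx {a} aA with a ≟ x
      ... | yes eq = eq
      ... | no n = ⊥-elim (<⇒≱ (≤-trans (s≤s (#-pos {A - x} (aA , n))) (#-< {A - x} {A} {x} proj₁ x∈A (λ c → proj₂ c refl))) A≤1)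
      inB : ∀ {v} → v ∈ U → e E v x → v ≢ y → v ∈ B
      inB vU vx vy = vU , vy , λ (c , cA , n) → n (subst (e E _) (≡-sym (isx cA)) vx)

      -- A contraction with p = 1, so k is unchanged. The vertex c₁ of B is left out of Q₁ and
      -- becomes the exit to y. Other vertices of R have at most one neighbour in B, and this is the
      -- only one they can lose to Q₁.
      module Go (nby : ∀ {t} → t ∈ U → e E y t → t ∈ B ⊎ t ≡ z) (c₁ c₂ : V) (c₁B : c₁ ∈ B) (yc₁ : e E y c₁) (c₁z : c₁ ≢ z) (c₂B : c₂ ∈ B) (c₂₁ : c₂ ≢ c₁)
                (v₁ : V) (v₁U : v₁ ∈ U) (c₁v₁ : e E c₁ v₁) (v₁x : v₁ ≢ x) (v₁y : v₁ ≢ y) (v₁z : v₁ ≢ z) where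
        Q₁ : Sub
        Q₁ = ⁅ x ⁆ ∪ (B - c₁)
        Π₁ : Prefix
        Π₁ = record
          { Q = Q₁ ; S = N[ B - c₁ ] ; p = 1 ; len₀ = 2 ; dif = 1
          ; Q⊆U = λ { (inj₁ refl) → x∈U ; (inj₂ (b , _)) → BU b } ; x∈Q = inj₁ refl ; y∉Q = λ { (inj₁ eq) → x≢y (≡-sym eq) ; (inj₂ (b , _)) → B≢y b refl }
          ; extra = c₂ , inj₂ (c₂B , c₂₁) , B≢x c₂B ; p≥1 = s≤s z≤n ; len₀≥1 = s≤s z≤n ; dif≡ = inj₁ refl ; prefix = pre }
          where
          pre : ∀ {v} → v ∈ N[ B - c₁ ] → v ∈ U → v ∉ Q₁ → ∀ j → j < 1 → Path (e E) (λ t → t ∈ Q₁ ⊎ t ≡ v) x v (2 + j * 1)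
          pre (b , bB , bv) _ v∉ zero _ = path₂ (inj₁ (inj₁ refl)) (inj₁ (inj₂ bB)) (inj₂ refl) (≢-sym (B≢x (proj₁ bB))) (λ { refl → v∉ (inj₁ refl) }) (e-≢ E bv) (xB (proj₁ bB)) bv
          pre _ _ _ (suc _) (s≤s ())
        W R : Sub
        W = (U - y) ∖ Q₁
        R = comp E W c₁
        c₁∉Q : c₁ ∉ Q₁
        c₁∉Q (inj₁ eq) = B≢x c₁B eq
        c₁∉Q (inj₂ (_ , n)) = n refl
        c₁R : c₁ ∈ R
        c₁R = here refl ((BU c₁B , B≢y c₁B) , c₁∉Q)
        R⊆ : R ⊆ U
        R⊆ a = proj₁ (proj₁ (walk-end a))
        R≢y : ∀ {v} → v ∈ R → v ≢ y
        R≢y a = proj₂ (proj₁ (walk-end a))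
        R∌Q : ∀ {v} → v ∈ R → v ∉ Q₁
        R∌Q a = proj₂ (walk-end a)
        R≢x : ∀ {v} → v ∈ R → v ≢ x
        R≢x a refl = R∌Q a (inj₁ refl)
        R∌B : ∀ {v} → v ∈ R → v ≢ c₁ → v ∉ B
        R∌B a n b = R∌Q a (inj₂ (b , n))
        G₁ : Rel
        G₁ = Prefix.G Π₁
        H : Sub
        H = R ∪ ⁅ x ⁆

        out : ∀ {v t} → v ∈ R → t ∈ U → e E v t → t ∈ R ⊎ (t ∈ Q₁ ⊎ t ≡ y)
        out {v} {t} vR tU vt with has? Q₁ t | t ≟ y
        ... | yes q | _ = inj₂ (inj₁ q)
        ... | no _ | yes eq = inj₂ (inj₂ eq)
        ... | no n₁ | no n₂ = inj₁ (comp-closed E {W} vR ((tU , n₂) , n₁) vt)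

        y-only-z : ∀ {v} → v ∈ R → v ≢ c₁ → e E v y → v ≡ z
        y-only-z vR n vy with nby (R⊆ vR) (e-sym E vy)
        ... | inj₁ b = ⊥-elim (R∌B vR n b)
        ... | inj₂ eq = eq

        no-x : ∀ {v} → v ∈ R → v ≢ c₁ → ¬ e E v x
        no-x vR n vx = R∌B vR n (inB (R⊆ vR) vx (R≢y vR))

        go : Rooted G₁ H x c₁ ⊎ Piece G₁ H x c₁ → Done
        go (inj₁ rt) = lift Π₁ k≥1 R R⊆ R∌Q c₁R (λ t → t ≡ c₁ ⊎ t ≡ y) (1 , path-edge E (inj₁ refl) (inj₂ refl) (e-sym E yc₁))
            (λ { (inj₁ refl) → BU c₁B , c₁∉Q , (λ _ → refl) ; (inj₂ refl) → y∈U , Prefix.y∉Q Π₁ , λ r → ⊥-elim (R≢y r refl) }) z rt ok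
            (comp-closed E {W} c₁R ((v₁U , v₁y) , v₁∉Q) c₁v₁) (≢-sym (e-≢ E c₁v₁)) v₁z
          where
          v₁∉Q : v₁ ∉ Q₁
          v₁∉Q (inj₁ eq) = v₁x eq
          v₁∉Q (inj₂ (b , _)) = indep c₁B b c₁v₁
          ok : ∀ {v} → v ∈ R → v ≢ c₁ → v ≢ z → ordinary v × LowDeg Π₁ v × (∀ {b} → b ∈ U → e E v b → b ∈ R ⊎ b ∈ Q₁)
          ok {v} vR vc vz = (R⊆ vR , R≢x vR , R≢y vR , vz) ,
            ((λ _ → ≤-trans (#-mono {nb E v ∩ Q₁} {nb E v ∩ B} λ { (vx , inj₁ refl) → ⊥-elim (no-x vR vc vx) ; (vb , inj₂ (b , _)) → vb , b })
                       (≤-trans (few (R⊆ vR) (R≢y vR) (λ a → R≢x vR (isx a))) A≤1)) ,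
             (λ n → s≤s (≤-reflexive (#-zero {nb E v ∩ Q₁} λ { (vx , inj₁ refl) → no-x vR vc vx ; (vb , inj₂ b) → n (_ , b , e-sym E vb) })))) ,
            λ tU vt → Data.Sum.map₂ Data.Sum.[ (λ q → q) , (λ { refl → ⊥-elim (vz (y-only-z vR vc vt)) }) ]′ (out vR tU vt)
        go (inj₂ Π') = at-x (w ≟ x)
          where
          open Piece Π'
          inR : ∀ {t} → t ∈ K → t ∈ R
          inR a with K⊆U a
          ... | inj₁ r = r
          ... | inj₂ refl = ⊥-elim (x∉K a)
          K≢c : ∀ {t} → t ∈ K → t ≢ c₁
          K≢c a refl = y∉K a
          step' : ∀ {a b} → a ∈ K → b ∈ R → e E a b → b ∈ K ⊎ b ≡ w
          step' aK bR ab = closed aK (inj₁ bR) (inj₁ (R≢x (inR aK) , R≢x bR , ab))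
          at-x : Dec (w ≡ x) → Done
          at-x (yes refl) = ⊥-elim (y∉K (walk-stays E {K = has K} (λ sK _ tR st → Data.Sum.[ (λ a → a) , (λ eq → ⊥-elim (R≢x tR eq)) ]′ (step' sK tR st))
                                     (proj₂ some) (walk-sym E (comp-conn E {W} (inR (proj₂ some))))))
          at-x (no wx) = fin (∃? (has? (K - z)))
            where
            S∌' : ∀ {t} → t ∈ K → t ∉ N[ B - c₁ ]
            S∌' tK s with closed tK (inj₂ refl) (inj₂ (inj₂ (refl , R≢x (inR tK) , s)))
            ... | inj₁ b = x∉K b
            ... | inj₂ b = wx (≡-sym b)
            nb' : ∀ {a b} → a ∈ K → b ∈ U → e E a b → b ∈ K ⊎ (b ≡ w ⊎ b ≡ y)
            nb' aK bU ab with out (inR aK) bU ab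
            ... | inj₁ bR = Data.Sum.map₂ inj₁ (step' aK bR ab)
            ... | inj₂ (inj₁ (inj₁ refl)) = ⊥-elim (no-x (inR aK) (K≢c aK) ab)
            ... | inj₂ (inj₁ (inj₂ b)) = ⊥-elim (S∌' aK (_ , b , e-sym E ab))
            ... | inj₂ (inj₂ eq) = inj₂ (inj₂ eq)
            fin : Dec (∃ λ t → t ∈ (K - z)) → Done
            fin (yes (t , tK , tz)) = two-attachments' K (λ a → R⊆ (inR a)) x∉K (λ a → R≢y (inR a) refl) w y nb' (≢-sym (B≢x c₂B)) x∈U (BU c₂B) x∉K
                                        (λ a → R∌B (inR a) c₂₁ c₂B) x≢y (B≢y c₂B) tK tz
            fin (no none) = exceptional-near-roots' (R⊆ (inR zK)) (R≢x (inR zK)) (R≢y (inR zK)) w (≢-sym (∈≢ {K} zK w∉K)) (BU c₁B , B≢x c₁B , B≢y c₁B , c₁z) nbz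
              where
              is-z : ∀ {t} → t ∈ K → t ≡ z
              is-z {t} a with t ≟ z
              ... | yes eq = eq
              ... | no n = ⊥-elim (none (t , a , n))
              zK : z ∈ K
              zK = subst (_∈ K) (is-z (proj₂ some)) (proj₂ some)
              nbz : ∀ {t} → t ∈ U → e E z t → t ≡ x ⊎ (t ≡ y ⊎ t ≡ w)
              nbz tU zt with nb' zK tU zt
              ... | inj₁ tK = ⊥-elim (e-≢ E zt (≡-sym (is-z tK)))
              ... | inj₂ (inj₁ eq) = inj₂ (inj₂ eq)
              ... | inj₂ (inj₂ eq) = inj₂ (inj₁ eq)

        result' : Done
        result' = go (rooted? G₁ H x c₁)

      finish : Outcome Π → Done
      finish (done d) = d
      finish (hangY h _ _ _ _) = ⊥-elim (OnHang.alone h isx)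
      finish (hangW h _ _ _ _ _ _) = ⊥-elim (OnHang.alone h isx)
      finish (tiny f) = two
        where
        nby : ∀ {t} → t ∈ U → e E y t → t ∈ B ⊎ t ≡ z
        nby tU yt with nb-tiny f tU yt
        ... | inj₁ (inj₁ a) = ⊥-elim (nxy (e-sym E (subst (e E y) (isx a) yt)))
        ... | inj₁ (inj₂ b) = inj₁ b
        ... | inj₂ eq = inj₂ eq
        Cand' : V → V → Set
        Cand' q t = t ∈ U × e E y t × t ≢ q × t ≢ z
        cand? : ∀ q t → Dec (Cand' q t)
        cand? q t = has? U t ×-dec (e? E y t ×-dec (¬? (t ≟ q) ×-dec ¬? (t ≟ z)))
        none→ : ∀ q → ¬ (∃ (Cand' q)) → Done
        none→ q none = near-pendant-root nxy q λ {t} tU yt → f' t tU yt (t ≟ q) (t ≟ z)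
          where
          f' : ∀ t → t ∈ U → e E y t → Dec (t ≡ q) → Dec (t ≡ z) → t ≡ q ⊎ t ≡ z
          f' t tU yt (yes eq) _ = inj₁ eq
          f' t tU yt (no _) (yes eq) = inj₂ eq
          f' t tU yt (no n₁) (no n₂) = ⊥-elim (none (t , tU , yt , n₁ , n₂))
        toB : ∀ {t} → t ∈ U → e E y t → t ≢ z → t ∈ B
        toB tU yt n = Data.Sum.[ (λ b → b) , (λ eq → ⊥-elim (n eq)) ]′ (nby tU yt)
        Ext : V → V → Set
        Ext c v = v ∈ U × e E c v × v ≢ x × v ≢ y × v ≢ z
        ext? : ∀ c v → Dec (Ext c v)
        ext? c v = has? U v ×-dec (e? E c v ×-dec (¬? (v ≟ x) ×-dec (¬? (v ≟ y) ×-dec ¬? (v ≟ z))))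
        noext : ∀ {c} → c ∈ B → c ≢ z → ¬ (∃ (Ext c)) → e E c z × z ∈ U × z ≢ x × z ≢ y
        noext {c} cB cz none with third-neighbour (BU cB , B≢x cB , B≢y cB , cz) x y
        ... | t , tU , ct , tx , ty with t ≟ z
        ... | yes refl = ct , tU , tx , ty
        ... | no n = ⊥-elim (none (t , tU , ct , tx , ty , n))
        two : Done
        two with ∃? (cand? z)
        ... | no none = none→ z none
        ... | yes (t₁ , t₁U , yt₁ , _ , t₁z) with ∃? (cand? t₁)
        ... | no none = none→ t₁ none
        ... | yes (t₂ , t₂U , yt₂ , t₂₁ , t₂z) with ∃? (ext? t₁) | ∃? (ext? t₂)
        ... | yes (v , vU , tv , vx , vy , vz) | _ = Go.result' nby t₁ t₂ (toB t₁U yt₁ t₁z) yt₁ t₁z (toB t₂U yt₂ t₂z) t₂₁ v vU tv vx vy vz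
        ... | no _ | yes (v , vU , tv , vx , vy , vz) = Go.result' nby t₂ t₁ (toB t₂U yt₂ t₂z) yt₂ t₂z (toB t₁U yt₁ t₁z) (≢-sym t₂₁) v vU tv vx vy vz
        -- Then t₁ and t₂ are both adjacent to z, which has at most one neighbour in B.
        ... | no n₁ | no n₂ with noext (toB t₁U yt₁ t₁z) t₁z n₁ | noext (toB t₂U yt₂ t₂z) t₂z n₂
        ... | t₁z' , zU , zx , zy | t₂z' , _ = ⊥-elim (<⇒≱ lt (≤-trans (few zU zy (λ a → zx (isx a))) A≤1))
          where
          lt : 1 < # (nb E z ∩ B)
          lt = ≤-trans (s≤s (#-pos {(nb E z ∩ B) - t₂} {t₁} ((e-sym E t₁z' , toB t₁U yt₁ t₁z) , ≢-sym t₂₁)))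
                       (#-< {(nb E z ∩ B) - t₂} {nb E z ∩ B} {t₂} proj₁ (e-sym E t₂z' , toB t₂U yt₂ t₂z) (λ c → proj₂ c refl))

      result' : Done
      result' = finish (Core.core Π (≤-trans A≤1 k≥1) low λ h _ → ⊥-elim (OnHang.alone h isx))

    -- A 4-cycle at a root

    module Square (nxy : ¬ e E x y) (ntx : NoTri x) (nt₂ : NoTri₂) (a b b' : V) (aU : a ∈ U) (bU : b ∈ U) (b'U : b' ∈ U)
                  (ax : a ≢ x) (ay : a ≢ y) (xb : e E x b) (xb' : e E x b') (ab : e E a b) (ab' : e E a b') (bb' : b ≢ b') (bz : b ≢ z)
                  (nbx : ∀ {r} → r ∈ U → e E x r → ¬ e E y r → e E a r)
                  (nbxy : ∀ {r} → r ∈ U → e E x r → e E y r → ¬ e E a r → r ≡ z ⊎ (e E r z × z ∈ U × z ≢ y × z ≢ x × z ≢ a × z ≢ b'))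
                  (reach : Walk (e E) (has (U ∖ (⁅ x ⁆ ∪ (⁅ a ⁆ ∪ ⁅ b' ⁆)))) y b)
                  (tail : (∀ {t} → t ∈ U → e E x t → e E a t → t ≡ b ⊎ t ≡ b') → (∀ {t} → t ∈ U → e E y t → t ≡ a ⊎ (t ≡ b' ⊎ t ≡ b)) → a ≢ z → Done) where
      b'≢y : b' ≢ y
      b'≢y refl = nxy xb'
      by : b ≢ y
      by refl = nxy xb

      Q : Sub
      Q = ⁅ x ⁆ ∪ (⁅ a ⁆ ∪ ⁅ b' ⁆)
      -- A common neighbour of x and a is reached directly or through b' and a, in lengths 1 and 3.
      -- The fourth vertex b of the cycle stays outside Q, so that S meets D.
      Π : Prefix
      Π = record
        { Q = Q ; S = (nb E x ∩ nb E a) - b' ; p = 2 ; len₀ = 1 ; dif = 2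
        ; Q⊆U = λ { (inj₁ refl) → x∈U ; (inj₂ (inj₁ refl)) → aU ; (inj₂ (inj₂ refl)) → b'U } ; x∈Q = inj₁ refl
        ; y∉Q = λ { (inj₁ eq) → x≢y (≡-sym eq) ; (inj₂ (inj₁ eq)) → ay (≡-sym eq) ; (inj₂ (inj₂ eq)) → b'≢y (≡-sym eq) }
        ; extra = a , inj₂ (inj₁ refl) , ax ; p≥1 = s≤s z≤n ; len₀≥1 = s≤s z≤n ; dif≡ = inj₂ refl ; prefix = pre }
        where
        pre : ∀ {s} → s ∈ ((nb E x ∩ nb E a) - b') → s ∈ U → s ∉ Q → ∀ j → j < 2 → Path (e E) (λ t → t ∈ Q ⊎ t ≡ s) x s (1 + j * 2)
        pre ((xs , as) , sb') _ _ zero _ = path-edge E (inj₁ (inj₁ refl)) (inj₂ refl) xs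
        pre ((xs , as) , sb') _ _ (suc zero) _ = path₃ (inj₁ (inj₁ refl)) (inj₁ (inj₂ (inj₂ refl))) (inj₁ (inj₂ (inj₁ refl))) (inj₂ refl)
          (e-≢ E xb') (≢-sym ax) (e-≢ E xs) (≢-sym (e-≢ E ab')) (≢-sym sb') (e-≢ E as) xb' (e-sym E ab') as
        pre _ _ _ (suc (suc _)) (s≤s (s≤s ()))
      open Prefix Π hiding (Q)

      b∈S : b ∈ S
      b∈S = (xb , ab) , bb'
      bD : b ∈ D
      bD = reach

      pair : ∀ {v} → v ∈ U → v ≢ y → e E v a → e E v b' → ⊥
      pair vU vy va vb' = nt₂ b'U vU aU vy ay xb' (e-sym E vb') (e-sym E ab') va
      pairx : ∀ {v} → v ∈ U → e E v x → e E v b' → ⊥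
      pairx vU vx vb' = ntx vU b'U (e-sym E vx) xb' vb'

      low : ∀ {v} → ordinary v → v ∉ Q → LowDeg Π v
      low {v} (vU , vx , vy , _) v∉Q =
        (λ ((xv , av) , _) → #-two {nb E v ∩ Q} x a λ { (_ , inj₁ eq) → inj₁ eq ; (_ , inj₂ (inj₁ eq)) → inj₂ eq ; (vb' , inj₂ (inj₂ refl)) → ⊥-elim (pairx vU (e-sym E xv) vb') }) ,
        λ n → s≤s (one n (e? E v x) (e? E v a))
        where
        one : v ∉ S → Dec (e E v x) → Dec (e E v a) → # (nb E v ∩ Q) ≤ 1
        one n (yes p) (yes q) = ⊥-elim (n ((e-sym E p , e-sym E q) , λ { refl → v∉Q (inj₂ (inj₂ refl)) }))
        one n (yes p) (no nq) = #-one {nb E v ∩ Q} x λ { (_ , inj₁ eq) → eq ; (q , inj₂ (inj₁ refl)) → ⊥-elim (nq q) ; (vb' , inj₂ (inj₂ refl)) → ⊥-elim (pairx vU p vb') }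
        one n (no np) (yes q) = #-one {nb E v ∩ Q} a λ { (p , inj₁ refl) → ⊥-elim (np p) ; (_ , inj₂ (inj₁ eq)) → eq ; (vb' , inj₂ (inj₂ refl)) → ⊥-elim (pair vU vy q vb') }
        one n (no np) (no nq) = #-one {nb E v ∩ Q} b' λ { (p , inj₁ refl) → ⊥-elim (np p) ; (q , inj₂ (inj₁ refl)) → ⊥-elim (nq q) ; (_ , inj₂ (inj₂ eq)) → eq }

      hyp : (h : Hang Π) → z ∉ Hang.K h → Done
      hyp h z∉ = two (proj₂ some) (snd (proj₂ some) (e? E (proj₁ some) a))
        where
        open Hang h
        open HangFacts Π h
        -- A neighbour r of x in K misses S, so it is not adjacent to a; then `nbx` makes it
        -- adjacent to y and `nbxy` to z. Both y and z are outside K and Q, so both would be the cut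
        -- vertex w.
        x-free : ∀ {r} → r ∈ K → ¬ e E r x
        x-free {r} rK rx with e? E a r | e? E y r
        ... | yes ar | _ = S∌ rK ((e-sym E rx , ar) , λ { refl → K∌Q rK (inj₂ (inj₂ refl)) })
        ... | no nar | no nyr = nar (nbx (K⊆U rK) (e-sym E rx) nyr)
        ... | no nar | yes yr with nbxy (K⊆U rK) (e-sym E rx) yr nar
        ... | inj₁ refl = z∉ rK
        ... | inj₂ (rz , zU , zy , zx , za , zb') with closed rK zU rz
        ... | inj₁ zK = z∉ zK
        ... | inj₂ (inj₂ q) = Data.Sum.[ zx , Data.Sum.[ za , zb' ]′ ]′ q
        ... | inj₂ (inj₁ z≡w) with closed rK y∈U (e-sym E yr)
        ... | inj₁ yK = y∉K yK
        ... | inj₂ (inj₂ q) = y∉Q q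
        ... | inj₂ (inj₁ y≡w) = zy (trans z≡w (≡-sym y≡w))
        nbK : Nb K (⁅ a ⁆ ∪ (⁅ b' ⁆ ∪ ⁅ w ⁆))
        nbK vK tU vt with closed vK tU vt
        ... | inj₁ c = inj₁ c
        ... | inj₂ (inj₁ eq) = inj₂ (inj₂ (inj₂ eq))
        ... | inj₂ (inj₂ (inj₁ refl)) = ⊥-elim (x-free vK vt)
        ... | inj₂ (inj₂ (inj₂ (inj₁ eq))) = inj₂ (inj₁ eq)
        ... | inj₂ (inj₂ (inj₂ (inj₂ eq))) = inj₂ (inj₂ (inj₁ eq))
        snd : ∀ {v} → v ∈ K → Dec (e E v a) → ∃ λ v' → v' ∈ K × v ≢ v'
        snd vK (yes va) = second vK (∈≢ {K} vK z∉) a λ { (inj₁ refl) vx → ⊥-elim (x-free vK vx) ; (inj₂ (inj₁ eq)) _ → eq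
                                                       ; (inj₂ (inj₂ refl)) vb' → ⊥-elim (pair (K⊆U vK) (∈≢ {K} vK y∉K) va vb') }
        snd vK (no nva) = second vK (∈≢ {K} vK z∉) b' λ { (inj₁ refl) vx → ⊥-elim (x-free vK vx) ; (inj₂ (inj₁ refl)) va → ⊥-elim (nva va) ; (inj₂ (inj₂ eq)) _ → eq }
        two : ∀ {v} → v ∈ K → (∃ λ v' → v' ∈ K × v ≢ v') → Done
        two vK (v' , v'K , ne) = three-attachments K K⊆U x∉K y∉K z∉ a b' w nbK x∈U x∉K (≢-sym ax) (e-≢ E xb') (≢-sym (D∌x w∈D)) vK v'K ne

      finish : Outcome Π → Done
      finish (done d) = d
      finish (tiny f) = ⊥-elim (Data.Sum.[ by , bz ]′ (f bD))
      finish (hangY h zK _ _ cover) = ⊥-elim (Data.Sum.[ (λ bK → Hang.S∌ h bK b∈S) , by ]′ (cover bD))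
      finish (hangW h zK _ w≢y wS yw cover) with ∃? (λ t → has? U t ×-dec (e? E x t ×-dec (e? E a t ×-dec (¬? (t ≟ b) ×-dec ¬? (t ≟ b')))))
      ... | no none = tail nba nby' (λ { refl → K∌Q zK (inj₂ (inj₁ refl)) })
        where
        open Hang h
        open HangFacts Π h
        w≡b : w ≡ b
        w≡b with cover bD
        ... | inj₁ bK = ⊥-elim (S∌ bK b∈S)
        ... | inj₂ (inj₁ eq) = ≡-sym eq
        ... | inj₂ (inj₂ eq) = ⊥-elim (by eq)
        nba : ∀ {t} → t ∈ U → e E x t → e E a t → t ≡ b ⊎ t ≡ b'
        nba {t} tU xt at with t ≟ b | t ≟ b'
        ... | yes eq | _ = inj₁ eq
        ... | no _ | yes eq = inj₂ eq
        ... | no n₁ | no n₂ = ⊥-elim (none (t , tU , xt , at , n₁ , n₂))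
        nby' : ∀ {t} → t ∈ U → e E y t → t ≡ a ⊎ (t ≡ b' ⊎ t ≡ b)
        nby' tU yt with D-closed y∈D tU yt
        ... | inj₂ (inj₁ refl) = ⊥-elim (nxy (e-sym E yt))
        ... | inj₂ (inj₂ (inj₁ eq)) = inj₁ eq
        ... | inj₂ (inj₂ (inj₂ eq)) = inj₂ (inj₁ eq)
        ... | inj₁ tD with cover tD
        ... | inj₁ tK = ⊥-elim (nb-y w≢y tU yt tK)
        ... | inj₂ (inj₁ eq) = inj₂ (inj₂ (trans eq w≡b))
        ... | inj₂ (inj₂ eq) = ⊥-elim (e-≢ E yt (≡-sym eq))
      -- w is b, so a further common neighbour c of x and a lies outside D, in a component attached
      -- to Q only. It does not contain z, which is in D.
      ... | yes (c , cU , xc , ac , cb , cb') = three-attachments C (λ a → proj₁ (walk-end a)) (λ a → proj₂ (walk-end a) (inj₁ refl)) y∉C z∉C x a b' nbC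
                y∈U y∉C (≢-sym x≢y) (≢-sym ay) (≢-sym b'≢y) (here refl (cU , c∉Q)) (proj₁ (proj₂ c')) (proj₂ (proj₂ c'))
        where
        open Hang h
        open HangFacts Π h
        w≡b : w ≡ b
        w≡b with cover bD
        ... | inj₁ bK = ⊥-elim (S∌ bK b∈S)
        ... | inj₂ (inj₁ eq) = ≡-sym eq
        ... | inj₂ (inj₂ eq) = ⊥-elim (by eq)
        C : Sub
        C = comp E (U ∖ Q) c
        c∉Q : c ∉ Q
        c∉Q (inj₁ refl) = e-irr E xc
        c∉Q (inj₂ (inj₁ refl)) = e-irr E ac
        c∉Q (inj₂ (inj₂ eq)) = cb' eq
        c≢y : c ≢ y
        c≢y refl = nxy xc
        c∉D : c ∉ D
        c∉D cD with cover cD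
        ... | inj₁ cK = S∌ cK ((xc , ac) , cb')
        ... | inj₂ (inj₁ eq) = cb (trans eq w≡b)
        ... | inj₂ (inj₂ eq) = c≢y eq
        y∉C : y ∉ C
        y∉C a = c∉D (walk-sym E a)
        z∉C : z ∉ C
        z∉C a = c∉D (walk-trans (K⊆D zK) (walk-sym E a))
        nbC : Nb C (⁅ x ⁆ ∪ (⁅ a ⁆ ∪ ⁅ b' ⁆))
        nbC {b = t} vC tU vt with has? Q t
        ... | yes q = inj₂ q
        ... | no n = inj₁ (comp-closed E {U ∖ Q} vC (tU , n) vt)
        c' : ∃ λ t → t ∈ C × c ≢ t
        c' with third-neighbour (cU , (λ { refl → e-irr E xc }) , c≢y , (λ { refl → z∉C (here refl (cU , c∉Q)) })) x a
        ... | t , tU , ct , tx , ta = t , comp-closed E {U ∖ Q} (here refl (cU , c∉Q)) (tU , t∉Q) ct , e-≢ E ct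
          where
          t∉Q : t ∉ Q
          t∉Q (inj₁ eq) = tx eq
          t∉Q (inj₂ (inj₁ eq)) = ta eq
          t∉Q (inj₂ (inj₂ refl)) = ntx cU b'U xc xb' ct

      result' : Done
      result' = finish (Core.core Π k≥2 low hyp)

    side-of : Info → Side E U x y z
    side-of i = record { A = Info.A i ; B = Info.B i ; A⊆U = Info.A⊆U i ; B⊆U = Info.BU i ; x∈A = Info.x∈A i ; y∉A = Info.y∉A i
                       ; AB = Info.AB i ; A≤B = Info.A≤B i ; A≥2 = Info.A≥2 i ; B≥2 = Info.B≥2 i ; nby = Info.nby i }

    module Sq (nxy : ¬ e E x y) (ntx : NoTri x) (nty : NoTri y) (nt₂ : NoTri₂) (X : Side E U x y z) where
      open Side X

      a∈ = #-elem≢ {A} x A≥2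
      a = proj₁ a∈
      aA : a ∈ A
      aA = proj₁ (proj₂ a∈)
      a≢x : a ≢ x
      a≢x = proj₂ (proj₂ a∈)
      a≢y : a ≢ y
      a≢y = ∈≢ {A} aA y∉A
      B≢x : ∀ {b} → b ∈ B → b ≢ x
      B≢x bB refl = e-irr E (xB bB)
      B≢y : ∀ {b} → b ∈ B → b ≢ y
      B≢y bB refl = nxy (xB bB)
      B≢a : ∀ {b} → b ∈ B → b ≢ a
      B≢a bB eq = e-irr E (subst (λ t → e E t _) (≡-sym eq) (AB aA bB))

      -- If no vertex of B other than z is adjacent to y, then y has at most one neighbour besides
      -- z. Otherwise such a vertex b lies on a 4-cycle with x, a and b' to which `Square` applies.
      common : (∀ {t} → t ∈ A → ¬ e E y t) → (∀ {r} → r ∈ U → e E x r → ¬ e E y r → r ∈ B) → Done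
      common noA cond with ∃? (λ t → has? B t ×-dec (e? E y t ×-dec ¬? (t ≟ z)))
      ... | no none = few' nby
        where
        inz : ∀ {t} → t ∈ B → e E y t → t ≡ z
        inz {t} bB yt with t ≟ z
        ... | yes eq = eq
        ... | no n = ⊥-elim (none (t , bB , yt , n))
        few' : _ → Done
        few' (inj₁ f) = near-pendant-root nxy z λ tU yt → Data.Sum.[ (λ tA → ⊥-elim (noA tA yt)) , (λ tB → inj₂ (inz tB yt)) ]′ (f tU yt)
        few' (inj₂ (u , _ , _ , _ , _ , _ , _ , f)) = near-pendant-root nxy u λ tU yt →
          Data.Sum.[ Data.Sum.[ (λ tA → ⊥-elim (noA tA yt)) , (λ tB → inj₂ (inz tB yt)) ]′ , inj₁ ]′ (f tU yt)
      ... | yes (b , bB , yb , bz) = Square.result' nxy ntx nt₂ a b b' (A⊆U aA) (B⊆U bB) (B⊆U b'B) a≢x a≢y (xB bB) (xB b'B) (AB aA bB) (AB aA b'B) (≢-sym b'b) bz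
              (λ rU xr nyr → AB aA (cond rU xr nyr)) nbxy (walk-edge {A = has (U ∖ (⁅ x ⁆ ∪ (⁅ a ⁆ ∪ ⁅ b' ⁆)))} (y∈U , y∉Q) (B⊆U bB , b∉Q) yb) tail
        where
        b'∈ = #-elem≢ {B} b B≥2
        b' = proj₁ b'∈
        b'B : b' ∈ B
        b'B = proj₁ (proj₂ b'∈)
        b'b : b' ≢ b
        b'b = proj₂ (proj₂ b'∈)
        y∉Q : y ∉ (⁅ x ⁆ ∪ (⁅ a ⁆ ∪ ⁅ b' ⁆))
        y∉Q (inj₁ eq) = x≢y (≡-sym eq)
        y∉Q (inj₂ (inj₁ eq)) = a≢y (≡-sym eq)
        y∉Q (inj₂ (inj₂ eq)) = B≢y b'B (≡-sym eq)
        b∉Q : b ∉ (⁅ x ⁆ ∪ (⁅ a ⁆ ∪ ⁅ b' ⁆))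
        b∉Q (inj₁ eq) = B≢x bB eq
        b∉Q (inj₂ (inj₁ eq)) = B≢a bB eq
        b∉Q (inj₂ (inj₂ eq)) = b'b (≡-sym eq)
        nbxy : ∀ {r} → r ∈ U → e E x r → e E y r → ¬ e E a r → r ≡ z ⊎ (e E r z × z ∈ U × z ≢ y × z ≢ x × z ≢ a × z ≢ b')
        nbxy {r} rU xr yr nar with nby
        ... | inj₁ f = ⊥-elim (Data.Sum.[ (λ rA → noA rA yr) , (λ rB → nar (AB aA rB)) ]′ (f rU yr))
        ... | inj₂ (u , _ , _ , _ , z∉A , z∉B , w , f) with f rU yr
        ... | inj₁ (inj₁ rA) = ⊥-elim (noA rA yr)
        ... | inj₁ (inj₂ rB) = ⊥-elim (nar (AB aA rB))
        ... | inj₂ refl with w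
        ... | inj₁ eq = inj₁ eq
        ... | inj₂ (zU , zy , uz , _) = inj₂ (uz , zU , zy , ≢-sym (∈≢ {A} x∈A z∉A) , ≢-sym (∈≢ {A} aA z∉A) , ≢-sym (∈≢ {B} b'B z∉B))
        -- Now x and y have no neighbours besides b and b', so all other vertices, a among them, are
        -- attached to these two.
        tail : (∀ {t} → t ∈ U → e E x t → e E a t → t ≡ b ⊎ t ≡ b') → (∀ {t} → t ∈ U → e E y t → t ≡ a ⊎ (t ≡ b' ⊎ t ≡ b)) → a ≢ z → Done
        tail nba nby' a≢z = two-attachments P proj₁ (λ q → proj₂ q (inj₁ (inj₁ refl))) (λ q → proj₂ q (inj₁ (inj₂ refl))) b b' nbP x∈U (λ q → proj₂ q (inj₁ (inj₁ refl)))
                              (≢-sym (B≢x bB)) (≢-sym (B≢x b'B)) {a}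
                              (A⊆U aA , λ { (inj₁ (inj₁ eq)) → a≢x eq ; (inj₁ (inj₂ eq)) → a≢y eq ; (inj₂ (inj₁ eq)) → B≢a bB (≡-sym eq) ; (inj₂ (inj₂ eq)) → B≢a b'B (≡-sym eq) }) a≢z
          where
          P : Sub
          P = U ∖ ((⁅ x ⁆ ∪ ⁅ y ⁆) ∪ (⁅ b ⁆ ∪ ⁅ b' ⁆))
          ny : ∀ {t} → t ∈ U → e E y t → t ≡ b ⊎ t ≡ b'
          ny tU yt with nby' tU yt
          ... | inj₁ refl = ⊥-elim (noA aA yt)
          ... | inj₂ s = Data.Sum.swap s
          nx : ∀ {t} → t ∈ U → e E x t → t ≡ b ⊎ t ≡ b'
          nx {t} tU xt with e? E y t
          ... | yes yt = ny tU yt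
          ... | no nyt = nba tU xt (AB aA (cond tU xt nyt))
          nbP : Nb P (⁅ b ⁆ ∪ ⁅ b' ⁆)
          nbP {v} {t} (vU , v∉) tU vt with t ≟ x | t ≟ y | t ≟ b | t ≟ b'
          ... | yes refl | _ | _ | _ = ⊥-elim (v∉ (inj₂ (nx vU (e-sym E vt))))
          ... | no _ | yes refl | _ | _ = ⊥-elim (v∉ (inj₂ (ny vU (e-sym E vt))))
          ... | no _ | no _ | yes eq | _ = inj₂ (inj₁ eq)
          ... | no _ | no _ | no _ | yes eq = inj₂ (inj₂ eq)
          ... | no n₁ | no n₂ | no n₃ | no n₄ = inj₁ (tU , λ { (inj₁ (inj₁ eq)) → n₁ eq ; (inj₁ (inj₂ eq)) → n₂ eq ; (inj₂ (inj₁ eq)) → n₃ eq ; (inj₂ (inj₂ eq)) → n₄ eq })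

      -- Both sides then have the size of the neighbourhoods of the roots, so each B is the whole neighbourhood.
      opposite-sides : (Y : Side E U y x z) → ∀ {t₁ t₂} → t₁ ∈ A → e E y t₁ → t₂ ∈ Side.A Y → e E x t₂ → Done
      opposite-sides Y {t₁} {t₂} t₁A yt₁ t₂A xt₂ = go nby Y.nby
        where
        module Y = Side Y
        y∌B : ∀ {b} → b ∈ B → ¬ e E y b
        y∌B bB yb = nty (A⊆U t₁A) (B⊆U bB) yt₁ yb (AB t₁A bB)
        x∌B : ∀ {b} → b ∈ Y.B → ¬ e E x b
        x∌B bB xb = ntx (Y.A⊆U t₂A) (Y.B⊆U bB) xt₂ xb (Y.AB t₂A bB)
        Nx Ny : Sub
        Nx = nb E x ∩ U
        Ny = nb E y ∩ U
        A₀< : # (A - x) < # A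
        A₀< = #-< {A - x} {A} {x} proj₁ x∈A (λ c → proj₂ c refl)
        Y₀< : # (Y.A - y) < # Y.A
        Y₀< = #-< {Y.A - y} {Y.A} {y} proj₁ Y.x∈A (λ c → proj₂ c refl)
        Ny≤ : # Ny ≤ # A
        Ny≤ with nby
        ... | inj₁ f = #-mono {Ny} {A} λ (yt , tU) → Data.Sum.[ (λ a → a) , (λ b → ⊥-elim (y∌B b yt)) ]′ (f tU yt)
        ... | inj₂ (u , _ , _ , _ , _ , _ , _ , f) = ≤-trans (#-∪ {⁅ u ⁆} {A - x} λ (yt , tU) →
                Data.Sum.[ Data.Sum.[ (λ a → inj₂ (a , λ { refl → nxy (e-sym E yt) })) , (λ b → ⊥-elim (y∌B b yt)) ]′ , inj₁ ]′ (f tU yt))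
                (≤-trans (+-monoˡ-≤ _ (#-one {⁅ u ⁆} u (λ s → s))) A₀<)
        Nx≤ : # Nx ≤ # Y.A
        Nx≤ with Y.nby
        ... | inj₁ f = #-mono {Nx} {Y.A} λ (xt , tU) → Data.Sum.[ (λ a → a) , (λ b → ⊥-elim (x∌B b xt)) ]′ (f tU xt)
        ... | inj₂ (u , _ , _ , _ , _ , _ , _ , f) = ≤-trans (#-∪ {⁅ u ⁆} {Y.A - y} λ (xt , tU) →
                Data.Sum.[ Data.Sum.[ (λ a → inj₂ (a , λ { refl → nxy xt })) , (λ b → ⊥-elim (x∌B b xt)) ]′ , inj₁ ]′ (f tU xt))
                (≤-trans (+-monoˡ-≤ _ (#-one {⁅ u ⁆} u (λ s → s))) Y₀<)
        B⊆Nx : B ⊆ Nx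
        B⊆Nx b = xB b , B⊆U b
        B⊆Ny : Y.B ⊆ Ny
        B⊆Ny b = Y.xB b , Y.B⊆U b
        B≤Nx : # B ≤ # Nx
        B≤Nx = #-mono {B} {Nx} B⊆Nx
        YB≤Ny : # Y.B ≤ # Ny
        YB≤Ny = #-mono {Y.B} {Ny} B⊆Ny
        Nx≤Ny : # Nx ≤ # Ny
        Nx≤Ny = ≤-trans Nx≤ (≤-trans Y.A≤B YB≤Ny)
        Ny≤B : # Ny ≤ # B
        Ny≤B = ≤-trans Ny≤ A≤B
        Nx⊆B : ∀ {r} → r ∈ U → e E x r → r ∈ B
        Nx⊆B {r} rU xr with has? B r
        ... | yes b = b
        ... | no n = ⊥-elim (<⇒≱ (#-< {B} {Nx} B⊆Nx (xr , rU) n) (≤-trans Nx≤Ny Ny≤B))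
        Ny⊆B : ∀ {r} → r ∈ U → e E y r → r ∈ Y.B
        Ny⊆B {r} rU yr with has? Y.B r
        ... | yes b = b
        ... | no n = ⊥-elim (<⇒≱ (#-< {Y.B} {Ny} B⊆Ny (yr , rU) n) (≤-trans Ny≤B (≤-trans B≤Nx (≤-trans Nx≤ Y.A≤B))))
        go : _ → _ → Done
        -- Without an extra vertex the neighbourhood of y would fit into A without x, which is too
        -- small.
        go (inj₁ f) _ = ⊥-elim (<⇒≱ (≤-trans (s≤s (#-mono {Ny} {A - x} λ (yt , tU) → Data.Sum.[ (λ a → a , λ { refl → nxy (e-sym E yt) }) , (λ b → ⊥-elim (y∌B b yt)) ]′ (f tU yt))) A₀<)
                                  (≤-trans A≤B (≤-trans B≤Nx Nx≤Ny)))
        go _ (inj₁ f) = ⊥-elim (<⇒≱ (≤-trans (s≤s (#-mono {Nx} {Y.A - y} λ (xt , tU) → Data.Sum.[ (λ a → a , λ { refl → nxy xt }) , (λ b → ⊥-elim (x∌B b xt)) ]′ (f tU xt))) Y₀<)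
                                  (≤-trans Y.A≤B (≤-trans YB≤Ny (≤-trans Ny≤B B≤Nx))))
        go (inj₂ (u , u∉A , u∉B , yu , z∉A , z∉B , wu , f)) (inj₂ (u' , _ , _ , xu' , _ , _ , _ , f')) =
          -- The extra neighbour u' of x goes into Q. Any other b in B is then in the A at y, hence
          -- adjacent to u, and y reaches b through u.
          Square.result' nxy ntx nt₂ a b u' (A⊆U aA) (B⊆U bB) u'U a≢x a≢y (xB bB) xu' (AB aA bB) (AB aA u'B) bu' (∈≢ {B} bB z∉B)
            (λ rU xr _ → AB aA (Nx⊆B rU xr)) (λ rU xr _ nar → ⊥-elim (nar (AB aA (Nx⊆B rU xr))))
            (step (y∈U , y∉Q) yu (walk-edge {A = has (U ∖ (⁅ x ⁆ ∪ (⁅ a ⁆ ∪ ⁅ u' ⁆)))} (uU , u∉Q) (B⊆U bB , b∉Q) ub)) tail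
          where
          u'∈ : ∃ λ t → t ∈ U × t ≡ u'
          u'∈ with has? U u'
          ... | yes a = u' , a , refl
          ... | no n = ⊥-elim (<⇒≱ {# Nx} {# Y.A} (≤-trans (s≤s (#-mono {Nx} {Y.A - y} λ (xt , tU) →
                   Data.Sum.[ Data.Sum.[ (λ a → a , λ { refl → nxy xt }) , (λ b → ⊥-elim (x∌B b xt)) ]′ , (λ { refl → ⊥-elim (n tU) }) ]′ (f' tU xt))) Y₀<)
                   (≤-trans Y.A≤B (≤-trans YB≤Ny (≤-trans Ny≤B B≤Nx))))
          u'U : u' ∈ U
          u'U = subst (_∈ U) (proj₂ (proj₂ u'∈)) (proj₁ (proj₂ u'∈))
          u∈ : ∃ λ t → t ∈ U × t ≡ u
          u∈ with has? U u
          ... | yes a = u , a , refl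
          ... | no n = ⊥-elim (<⇒≱ {# Ny} {# A} (≤-trans (s≤s (#-mono {Ny} {A - x} λ (yt , tU) →
                   Data.Sum.[ Data.Sum.[ (λ a → a , λ { refl → nxy (e-sym E yt) }) , (λ b → ⊥-elim (y∌B b yt)) ]′ , (λ { refl → ⊥-elim (n tU) }) ]′ (f tU yt))) A₀<)
                   (≤-trans A≤B (≤-trans B≤Nx Nx≤Ny)))
          uU : u ∈ U
          uU = subst (_∈ U) (proj₂ (proj₂ u∈)) (proj₁ (proj₂ u∈))
          u'B : u' ∈ B
          u'B = Nx⊆B u'U xu'
          b∈ = #-elem≢ {B} u' B≥2
          b = proj₁ b∈
          bB : b ∈ B
          bB = proj₁ (proj₂ b∈)
          bu' : b ≢ u'
          bu' = proj₂ (proj₂ b∈)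
          bYA : b ∈ Y.A
          bYA with f' (B⊆U bB) (xB bB)
          ... | inj₁ (inj₁ c) = c
          ... | inj₁ (inj₂ c) = ⊥-elim (x∌B c (xB bB))
          ... | inj₂ eq = ⊥-elim (bu' eq)
          ub : e E u b
          ub = e-sym E (Y.AB bYA (Ny⊆B uU yu))
          y∉Q : y ∉ (⁅ x ⁆ ∪ (⁅ a ⁆ ∪ ⁅ u' ⁆))
          y∉Q (inj₁ eq) = x≢y (≡-sym eq)
          y∉Q (inj₂ (inj₁ eq)) = a≢y (≡-sym eq)
          y∉Q (inj₂ (inj₂ eq)) = B≢y u'B (≡-sym eq)
          b∉Q : b ∉ (⁅ x ⁆ ∪ (⁅ a ⁆ ∪ ⁅ u' ⁆))
          b∉Q (inj₁ eq) = B≢x bB eq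
          b∉Q (inj₂ (inj₁ eq)) = B≢a bB eq
          b∉Q (inj₂ (inj₂ eq)) = bu' eq
          u≢ : ∀ {t} → t ∈ A ⊎ t ∈ B → u ≢ t
          u≢ (inj₁ c) refl = u∉A c
          u≢ (inj₂ c) refl = u∉B c
          u∉Q : u ∉ (⁅ x ⁆ ∪ (⁅ a ⁆ ∪ ⁅ u' ⁆))
          u∉Q (inj₁ eq) = u≢ (inj₁ x∈A) eq
          u∉Q (inj₂ (inj₁ eq)) = u≢ (inj₁ aA) eq
          u∉Q (inj₂ (inj₂ eq)) = u≢ (inj₂ u'B) eq
          tail : (∀ {t} → t ∈ U → e E x t → e E a t → t ≡ b ⊎ t ≡ u') → (∀ {t} → t ∈ U → e E y t → t ≡ a ⊎ (t ≡ u' ⊎ t ≡ b)) → a ≢ z → Done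
          tail _ nby' _ with nby' uU yu
          ... | inj₁ eq = ⊥-elim (u≢ (inj₁ aA) eq)
          ... | inj₂ (inj₁ eq) = ⊥-elim (u≢ (inj₂ u'B) eq)
          ... | inj₂ (inj₂ eq) = ⊥-elim (u≢ (inj₂ bB) eq)

  -- The induction step

  -- By the structure at x, r₂ is the extra neighbour of y. If it were not z, it would have a
  -- neighbour b in B, and b would not be adjacent to y. Then, by the structure at y, both b and r₁
  -- would be the extra neighbour of x, but r₁ is not in B.
  apart : ∀ {E U x y z} → NoTriangle E U y → (X : Side E U x y z) (Y : Side E U y x z) →
          (∀ {t} → t ∈ Side.A X → ¬ e E y t) → (∀ {t} → t ∈ Side.A Y → ¬ e E x t) →
          ∀ {r₁ r₂} → r₁ ∈ U → e E x r₁ → ¬ e E y r₁ → r₁ ∉ Side.B X → r₂ ∈ U → e E y r₂ → ¬ e E x r₂ → r₂ ≡ z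
  apart {E} {U} {x} {y} {z} nty X Y no₁ no₂ {r₁} {r₂} r₁U xr₁ nyr₁ r₁B r₂U yr₂ nxr₂ = go X.nby
    where
    module X = Side X
    module Y = Side Y
    go : _ → r₂ ≡ z
    go (inj₁ f) = ⊥-elim (Data.Sum.[ (λ a → no₁ a yr₂) , (λ b → nxr₂ (X.xB b)) ]′ (f r₂U yr₂))
    go (inj₂ (u , _ , _ , _ , _ , _ , w , f)) with f r₂U yr₂
    ... | inj₁ (inj₁ a) = ⊥-elim (no₁ a yr₂)
    ... | inj₁ (inj₂ b) = ⊥-elim (nxr₂ (X.xB b))
    ... | inj₂ refl with w
    ... | inj₁ s = s
    ... | inj₂ (_ , _ , _ , b , bB , br₂) = ⊥-elim (no-b (e? E y b) Y.nby)
      where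
      no-b : Dec (e E y b) → _ → ⊥
      no-b (yes yb) _ = nty (X.B⊆U bB) r₂U yb yr₂ br₂
      no-b (no nyb) (inj₁ g) = Data.Sum.[ (λ a → no₂ a (X.xB bB)) , (λ b → nyb (Y.xB b)) ]′ (g (X.B⊆U bB) (X.xB bB))
      no-b (no nyb) (inj₂ (_ , _ , _ , _ , _ , _ , _ , g)) with g (X.B⊆U bB) (X.xB bB) | g r₁U xr₁
      ... | inj₁ (inj₁ a) | _ = no₂ a (X.xB bB)
      ... | inj₁ (inj₂ b∈) | _ = nyb (Y.xB b∈)
      ... | inj₂ _ | inj₁ (inj₁ a) = no₂ a xr₁
      ... | inj₂ _ | inj₁ (inj₂ r∈) = nyr₁ (Y.xB r∈)
      ... | inj₂ bu | inj₂ ru = r₁B (subst (_∈ X.B) (trans bu (≡-sym ru)) bB)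

  module OneSide {k : ℕ} (I : Inst k) (k≥2 : 2 ≤ k) (ih : Smaller (# (Inst.U I))) (nxy : ¬ e (Inst.E I) (Inst.x I) (Inst.y I)) where
    open Inst I

    Done : Set
    Done = AdmInst I

    NoTri : V → Set
    NoTri = NoTriangle E U

    NoTri₂ : Set
    NoTri₂ = Reduce.NoTri₂ I k≥2 ih

    nyx : ¬ e E y x
    nyx a = nxy (e-sym E a)

    tri? : Done ⊎ NoTri x
    tri? with ∃? (λ b → ∃? (λ c → has? U b ×-dec (has? U c ×-dec (e? E x b ×-dec (e? E x c ×-dec e? E b c)))))
    ... | yes (b , c , bU , cU , xb , xc , bc) = inj₁ (Reduce.Triangle.result I k≥2 ih nxy b c bU cU xb xc bc)
    ... | no none = inj₂ λ {b} {c} bU cU xb xc bc → none (b , c , bU , cU , xb , xc , bc)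

    module _ (ntx : NoTri x) (nty : NoTri y) where

      avoid : V → Set
      avoid v = v ≢ x × v ≢ y

      off : ∀ {b u v} → b ∈ U → v ∈ U → e E x b → e E b v → e E u v → u ≢ x
      off bU vU xb bv uv refl = ntx bU vU xb uv bv

      -- The clique is taken in the common neighbourhood of b and b' without x and y. This is
      -- symmetric in the roots, so the same clique is used at y when x leaves the case open.
      twin : ∀ {b b' u v} → b ∈ U → b' ∈ U → b ≢ b' → e E x b → e E x b' → u ∈ U → v ∈ U → avoid u → avoid v →
             e E b u → e E b v → e E b' u → e E b' v → e E u v → Done
      twin {b} {b'} {u} {v} bU b'U bb' xb xb' uU vU (ux , uy) (vx , vy) bu bv b'u b'v uv
        with max-clique E ((((nb E b ∩ nb E b') ∩ U) - x) - y) (⁅ u ⁆ ∪ ⁅ v ⁆)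
               (λ { (inj₁ refl) → (((bu , b'u) , uU) , ux) , uy ; (inj₂ refl) → (((bv , b'v) , vU) , vx) , vy })
               (λ { (inj₁ refl) (inj₁ refl) n → ⊥-elim (n refl) ; (inj₁ refl) (inj₂ refl) n → uv
                  ; (inj₂ refl) (inj₁ refl) n → e-sym E uv ; (inj₂ refl) (inj₂ refl) n → ⊥-elim (n refl) })
      ... | C , C₀⊆ , C⊆ , cl , mx = first (Reduce.TwoPendant.result I k≥2 ih nxy ntx nty b b' bU b'U xb xb' bb' C (λ a → proj₁ (proj₁ (C⊆ a))) x∉C y∉C cl C≥2
                     (λ vU bv b'v vx vy → mx ((((bv , b'v) , vU) , vx) , vy)))
        where
        C≥2 : 2 ≤ # C
        C≥2 = ≤-trans (s≤s (#-pos {⁅ u ⁆} refl)) (#-< {⁅ u ⁆} {C} {v} (λ { refl → C₀⊆ (inj₁ refl) }) (C₀⊆ (inj₂ refl)) (λ q → e-≢ E uv (≡-sym q)))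
        x∉C : x ∉ C
        x∉C a = proj₂ (proj₁ (C⊆ a)) refl
        y∉C : y ∉ C
        y∉C a = proj₂ (C⊆ a) refl
        first : Done ⊎ (∀ {t} → t ∈ U → e E y t → t ≡ b ⊎ (t ≡ b' ⊎ t ≡ z)) → Done
        first (inj₁ d) = d
        first (inj₂ nby) with e? E y b | e? E y b'
        ... | no nyb | _ = Reduce.near-pendant-root I k≥2 ih nxy b' λ tU yt → Data.Sum.[ (λ { refl → ⊥-elim (nyb yt) }) , (λ s → s) ]′ (nby tU yt)
        ... | yes _ | no nyb' = Reduce.near-pendant-root I k≥2 ih nxy b λ tU yt → Data.Sum.[ inj₁ , Data.Sum.[ (λ { refl → ⊥-elim (nyb' yt) }) , inj₂ ]′ ]′ (nby tU yt)
        ... | yes yb | yes yb' = second (Reduce.TwoPendant.result (swapInst I) k≥2 ih nyx nty ntx b b' bU b'U yb yb' bb' C (λ a → proj₁ (proj₁ (C⊆ a))) y∉C x∉C cl C≥2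
                     (λ vU bv b'v vy vx → mx ((((bv , b'v) , vU) , vx) , vy)))
          where
          second : AdmInst (swapInst I) ⊎ (∀ {t} → t ∈ U → e E x t → t ≡ b ⊎ (t ≡ b' ⊎ t ≡ z)) → Done
          second (inj₁ d) = adm-reverse E d
          second (inj₂ nbx) with #-elem≢ {C} z C≥2
          ... | c , cC , cz = Reduce.both I k≥2 ih b b' bU b'U bb' xb yb' nxy nbx nby (proj₂ (proj₁ (proj₁ (C⊆ cC))) , proj₂ (proj₁ (C⊆ cC)) , proj₂ (C⊆ cC) , cz)
                  (≢-sym (e-≢ E (proj₁ (proj₁ (proj₁ (proj₁ (C⊆ cC))))))) (≢-sym (e-≢ E (proj₂ (proj₁ (proj₁ (proj₁ (C⊆ cC)))))))

      pendant : (∀ {b b' u v} → b ∈ U → b' ∈ U → b ≢ b' → e E x b → e E x b' → u ∈ U → v ∈ U → avoid u → avoid v →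
                 e E b u → e E b v → e E b' u → e E b' v → e E u v → ⊥) →
                ∀ {b u v} → b ∈ U → u ∈ U → v ∈ U → avoid u → avoid v → e E x b → e E b u → e E b v → e E u v → Done
      pendant no-twin {b} {u} {v} bU uU vU (ux , uy) (vx , vy) xb bu bv uv
        with max-clique E (((nb E b ∩ U) - x) - y) (⁅ u ⁆ ∪ ⁅ v ⁆)
               (λ { (inj₁ refl) → ((bu , uU) , ux) , uy ; (inj₂ refl) → ((bv , vU) , vx) , vy })
               (λ { (inj₁ refl) (inj₁ refl) n → ⊥-elim (n refl) ; (inj₁ refl) (inj₂ refl) n → uv
                  ; (inj₂ refl) (inj₁ refl) n → e-sym E uv ; (inj₂ refl) (inj₂ refl) n → ⊥-elim (n refl) })
      ... | C , C₀⊆ , C⊆ , cl , mx = Reduce.Pendant.result I k≥2 ih nxy ntx nty b bU xb C (λ a → proj₁ (proj₁ (C⊆ a)))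
              (λ a → proj₂ (proj₁ (C⊆ a)) refl) (λ a → proj₂ (C⊆ a) refl) cl
              (≤-trans (s≤s (#-pos {⁅ u ⁆} refl)) (#-< {⁅ u ⁆} {C} {v} (λ { refl → C₀⊆ (inj₁ refl) }) (C₀⊆ (inj₂ refl)) (λ q → e-≢ E uv (≡-sym q))))
              (λ vU bv vx vy → mx (((bv , vU) , vx) , vy)) no-b'
        where
        no-b' : ∀ {t} → t ∈ U → e E x t → t ≢ b → NotAll E C t
        no-b' {t} tU xt tb with not-all? E C t
        ... | inj₁ n = n
        ... | inj₂ all = ⊥-elim (no-twin bU tU (≢-sym tb) xb xt uU vU (ux , uy) (vx , vy) bu bv (all (C₀⊆ (inj₁ refl))) (all (C₀⊆ (inj₂ refl))) uv)

      avoid? : ∀ v → Dec (avoid v)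
      avoid? v = ¬? (v ≟ x) ×-dec ¬? (v ≟ y)

      -- Twins are excluded first, because `pendant` relies on no other neighbour of x being
      -- adjacent to all of C.
      tri₂? : Done ⊎ NoTri₂
      tri₂? with ∃? (λ b → ∃? (λ b' → ∃? (λ u → ∃? (λ v → has? U b ×-dec (has? U b' ×-dec (¬? (b ≟ b') ×-dec (e? E x b ×-dec (e? E x b' ×-dec
                   (has? U u ×-dec (has? U v ×-dec (avoid? u ×-dec (avoid? v ×-dec (e? E b u ×-dec (e? E b v ×-dec (e? E b' u ×-dec (e? E b' v ×-dec e? E u v))))))))))))))))
      ... | yes (_ , _ , _ , _ , bU , b'U , bb' , xb , xb' , uU , vU , au , av , bu , bv , b'u , b'v , uv) =
            inj₁ (twin bU b'U bb' xb xb' uU vU au av bu bv b'u b'v uv)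
      ... | no no-twin with ∃? (λ b → ∃? (λ u → ∃? (λ v → has? U b ×-dec (has? U u ×-dec (has? U v ×-dec (avoid? u ×-dec (avoid? v ×-dec
                   (e? E x b ×-dec (e? E b u ×-dec (e? E b v ×-dec e? E u v))))))))))
      ... | yes (_ , _ , _ , bU , uU , vU , au , av , xb , bu , bv , uv) =
            inj₁ (pendant (λ bU b'U bb' xb xb' uU vU au av bu bv b'u b'v uv →
              no-twin (_ , _ , _ , _ , bU , b'U , bb' , xb , xb' , uU , vU , au , av , bu , bv , b'u , b'v , uv)) bU uU vU au av xb bu bv uv)
      ... | no none = inj₂ λ bU uU vU uy vy xb bu bv uv →
            none (_ , _ , _ , bU , uU , vU , (off bU vU xb bv uv , uy) , (off bU uU xb bu (e-sym E uv) , vy) , xb , bu , bv , uv)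

      side? : NoTri₂ → Done ⊎ Side E U x y z
      side? nt₂ with 2 ≤? # (nb E x ∩ U)
      ... | no few = inj₁ (adm-reverse E (thin (∃? (has? (nb E x ∩ U)))))
        where
        thin : Dec (∃ λ v → v ∈ (nb E x ∩ U)) → AdmInst (swapInst I)
        thin (no none) = Reduce.near-pendant-root (swapInst I) k≥2 ih nyx x λ tU xt → ⊥-elim (none (_ , xt , tU))
        thin (yes (q , xq , qU)) = Reduce.near-pendant-root (swapInst I) k≥2 ih nyx q only
          where
          only : ∀ {t} → t ∈ U → e E x t → t ≡ q ⊎ t ≡ z
          only {t} tU xt with t ≟ q
          ... | yes s = inj₁ s
          ... | no n = ⊥-elim (few (≤-trans (s≤s (#-pos {⁅ q ⁆} refl)) (#-< {⁅ q ⁆} {nb E x ∩ U} {t} (λ { refl → xq , qU }) (xt , tU) n)))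
      ... | yes two = go (Reduce.biclique I k≥2 ih nxy two)
        where
        go : Reduce.Biclique I k≥2 ih → Done ⊎ Side E U x y z
        go bic with 2 ≤? # (Reduce.Biclique.A bic)
        ... | yes s≥2 = Data.Sum.map₂ (Reduce.side-of I k≥2 ih) (Reduce.Bip.Wide.result I k≥2 ih nxy ntx nty nt₂ bic s≥2)
        ... | no s<2 = inj₁ (Reduce.Lone.result' I k≥2 ih nxy ntx nty nt₂ bic (s≤s⁻¹ (≰⇒> s<2)))

  module TwoSides {k : ℕ} (I : Inst k) (k≥2 : 2 ≤ k) (ih : Smaller (# (Inst.U I))) (nxy : ¬ e (Inst.E I) (Inst.x I) (Inst.y I)) where
    open Inst I

    Done : Set
    Done = AdmInst I

    nyx : ¬ e E y x
    nyx a = nxy (e-sym E a)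

    -- By `mixed` either both roots have neighbours in the A at the other root or none has. In the
    -- latter case call a neighbour of one root private if the other root is not adjacent to it. If
    -- private neighbours were missing from the B at both roots, `apart` would make them equal to z
    -- and hence to each other.
    final : NoTriangle E U x → NoTriangle E U y → Reduce.NoTri₂ I k≥2 ih → Reduce.NoTri₂ (swapInst I) k≥2 ih → Side E U x y z → Side E U y x z → Done
    final ntx nty nt₂ nt₂′ SX SY with ∃? (λ t → has? (Side.A SX) t ×-dec e? E y t) | ∃? (λ t → has? (Side.A SY) t ×-dec e? E x t)
    ... | yes (_ , t₁A , yt₁) | yes (_ , t₂A , xt₂) = Reduce.Sq.opposite-sides I k≥2 ih nxy ntx nty nt₂ SX SY t₁A yt₁ t₂A xt₂
    ... | no no₁ | yes (_ , tA , xt) = ⊥-elim (mixed ntx SX SY (λ a b → no₁ (_ , a , b)) tA xt)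
    ... | yes (_ , tA , yt) | no no₂ = ⊥-elim (mixed nty SY SX (λ a b → no₂ (_ , a , b)) tA yt)
    ... | no no₁ | no no₂ with ∃? (λ r → has? U r ×-dec (e? E x r ×-dec (¬? (e? E y r) ×-dec ¬? (has? (Side.B SX) r))))
                             | ∃? (λ r → has? U r ×-dec (e? E y r ×-dec (¬? (e? E x r) ×-dec ¬? (has? (Side.B SY) r))))
    ... | no n | _ = Reduce.Sq.common I k≥2 ih nxy ntx nty nt₂ SX (λ a b → no₁ (_ , a , b)) (λ {r} a b c → decidable-stable (has? (Side.B SX) r) λ d → n (r , a , b , c , d))
    ... | yes _ | no n = adm-reverse E (Reduce.Sq.common (swapInst I) k≥2 ih nyx nty ntx nt₂′ SY (λ a b → no₂ (_ , a , b)) (λ {r} a b c → decidable-stable (has? (Side.B SY) r) λ d → n (r , a , b , c , d)))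
    ... | yes (r₁ , a , b , c , d) | yes (r₂ , a' , b' , c' , d') = ⊥-elim (c' (subst (e E x) (trans r₁z (≡-sym r₂z)) b))
      where
      r₂z : r₂ ≡ z
      r₂z = apart nty SX SY (λ a b → no₁ (_ , a , b)) (λ a b → no₂ (_ , a , b)) a b c d a' b' c'
      r₁z : r₁ ≡ z
      r₁z = apart ntx SY SX (λ a b → no₂ (_ , a , b)) (λ a b → no₁ (_ , a , b)) a' b' c' d' a b c

    main : Done
    main with OneSide.tri? I k≥2 ih nxy | OneSide.tri? (swapInst I) k≥2 ih nyx
    ... | inj₁ d | _ = d
    ... | inj₂ _ | inj₁ d = adm-reverse E d
    ... | inj₂ ntx | inj₂ nty with OneSide.tri₂? I k≥2 ih nxy ntx nty | OneSide.tri₂? (swapInst I) k≥2 ih nyx nty ntx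
    ... | inj₁ d | _ = d
    ... | inj₂ _ | inj₁ d = adm-reverse E d
    ... | inj₂ nt₂ | inj₂ nt₂′ with OneSide.side? I k≥2 ih nxy ntx nty nt₂ | OneSide.side? (swapInst I) k≥2 ih nyx nty ntx nt₂′
    ... | inj₁ d | _ = d
    ... | inj₂ _ | inj₁ d = adm-reverse E d
    ... | inj₂ SX | inj₂ SY = final ntx nty nt₂ nt₂′ SX SY

  -- Only the case in which the roots are not adjacent matters, since the paths sought have length at least 2.
  module CutEdge {k : ℕ} (I : Inst k) where
    open Inst I

    root-edge : V → V → Set
    root-edge u v = (u ≡ x × v ≡ y) ⊎ (u ≡ y × v ≡ x)

    E′ : Rel
    E′ = record
      { e = λ u v → e E u v × ¬ root-edge u v
      ; e? = λ u v → e? E u v ×-dec ¬? (((u ≟ x) ×-dec (v ≟ y)) ⊎-dec ((u ≟ y) ×-dec (v ≟ x)))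
      ; e-sym = λ (uv , n) → e-sym E uv , λ { (inj₁ (s , t)) → n (inj₂ (t , s)) ; (inj₂ (s , t)) → n (inj₁ (t , s)) }
      ; e-irr = λ (vv , _) → e-irr E vv }

    keep : ∀ {u v} → u ≢ x → u ≢ y → e E u v → e E′ u v
    keep ux uy uv = uv , λ { (inj₁ (s , _)) → ux s ; (inj₂ (s , _)) → uy s }

    rooted′ : Rooted E′ U x y
    rooted′ w v vU vw = Data.Sum.[ (λ q → go q (inj₁ refl)) , (λ q → go q (inj₂ refl)) ]′ (rooted w v vU vw)
      where
      -- The walk is stopped at its first root; until then it does not use the edge between the
      -- roots.
      go : ∀ {a r} → Walk (e E) (has (U - w)) a r → r ≡ x ⊎ r ≡ y → Walk (e E′) (has (U - w)) a x ⊎ Walk (e E′) (has (U - w)) a y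
      go {a} q end with a ≟ x | a ≟ y
      ... | yes s | _ = inj₁ (here s (walk-start q))
      ... | no _ | yes s = inj₂ (here s (walk-start q))
      go (here refl _) end | no ax | no ay = ⊥-elim (Data.Sum.[ ax , ay ] end)
      go (step aU ab q) end | no ax | no ay = Data.Sum.map (step aU (keep ax ay ab)) (step aU (keep ax ay ab)) (go q end)

    I′ : Inst k
    I′ = record
      { E = E′ ; U = U ; x = x ; y = y ; z = z ; x∈U = x∈U ; y∈U = y∈U ; x≢y = x≢y ; rooted = rooted′
      ; deg = λ {v} vU vx vy vz → ≤-trans (deg vU vx vy vz) (#-mono {nb E v ∩ U} {nb E′ v ∩ U} λ (a , b) → keep vx vy a , b)
      ; inner = inner }

    nxy : ¬ e E′ x y
    nxy (_ , n) = n (inj₁ (refl , refl))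

    back : AdmInst I′ → AdmInst I
    back (adm b d b≥ d≡ p) = adm b d b≥ d≡ λ i l → path-map (λ _ _ → proj₁) (λ a → a) (p i l)

  -- A fan at an inner vertex is a path between the roots with that vertex in its interior.
  one-path : (I : Inst 1) → AdmInst I
  one-path I = found (Basic.fan I vU)
    where
    open Inst I
    v : V
    v = proj₁ inner
    vU : v ∈ U
    vU = proj₁ (proj₂ inner)
    long : ∀ {A u m} → Path (e E) A u v m → v ≢ u → 1 ≤ m
    long (nil s _) n = ⊥-elim (n (≡-sym s))
    long (cons _ _ _) _ = s≤s z≤n
    found : Basic.Fan I x y v → AdmInst I
    found F = adm (m + l) 1 (+-mono-≤ (long p (proj₁ (proj₂ (proj₂ inner)))) (long q (proj₁ (proj₂ (proj₂ (proj₂ inner)))))) (inj₁ refl)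
      λ { zero _ → subst (Path (e E) (has U) x y) (≡-sym (+-identityʳ _))
                     (path-mono (λ { (inj₁ o) → A⊆U (on-in p o) ; (inj₂ o) → B⊆U (on-in q o) })
                       (path-append (path-tight p) (path-reverse E (path-tight q)) meet))
        ; (suc i) (s≤s ()) }
      where open Basic.Fan F

  -- k = 1 stands apart because the reductions rely on ordinary vertices having at least three
  -- neighbours.
  admissible-paths : ∀ s → Smaller s
  admissible-paths (suc s) {suc zero} k≥1 I lt = one-path I
  admissible-paths (suc s) {suc (suc k)} k≥1 I lt = CutEdge.back I (TwoSides.main (CutEdge.I′ I) (s≤s (s≤s z≤n))
    (λ j J lt′ → admissible-paths s j J (≤-trans lt′ (s≤s⁻¹ lt))) (CutEdge.nxy I))

  -- From paths to cycles

  module Cycles (E : Rel) {k : ℕ} (k≥2 : 2 ≤ k) where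

    everywhere : V → Set
    everywhere _ = ⊤

    Closed : Set
    Closed = ∃ λ c → ∃ λ y → e E y c × Adm (e E) everywhere k c y

    -- Degrees are counted inside P with c added, so a lobe is self-contained: once it is a `Block`,
    -- it gives an instance with c as one root.
    record Lobe (P : Sub) (c z : V) : Set where
      field
        conn : ∀ {u v} → u ∈ P → v ∈ P → Walk (e E) (has P) u v
        deg  : ∀ {v} → v ∈ P → v ≢ z → suc k ≤ # (nb E v ∩ (P ∪ ⁅ c ⁆))
        c∉P  : c ∉ P
        some : ∃ λ v → v ∈ P × v ≢ z

      third : ∀ {v} s → v ∈ P → v ≢ z → ∃ λ t → t ∈ P × e E v t × t ≢ s
      third {v} s vP vz with #-> {nb E v ∩ (P ∪ ⁅ c ⁆)} {⁅ c ⁆ ∪ ⁅ s ⁆} (≤-trans (s≤s (#-two {⁅ c ⁆ ∪ ⁅ s ⁆} c s λ q → q)) (≤-trans (s≤s k≥2) (deg vP vz)))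
      ... | t , (vt , inj₁ tP) , n = t , tP , vt , λ q → n (inj₂ q)
      ... | t , (vt , inj₂ tc) , n = ⊥-elim (n (inj₁ tc))

      -- This covers the deletion of a vertex of P in `Rooted`; when c or a vertex outside the lobe
      -- is deleted, `conn` leads to the other root.
      Block : Set
      Block = ∀ u v → u ∈ P → v ∈ P → v ≢ u → Walk (e E) (has ((P ∪ ⁅ c ⁆) - u)) v c

      root : Block → ∃ λ y → y ∈ P × e E y c
      root bl with ∃? (λ y → has? P y ×-dec e? E y c)
      ... | yes r = r
      ... | no none with some
      ... | v , vP , vz with third v vP vz
      ... | u , uP , _ , uv = ⊥-elim (c∉P (walk-stays E {K = has P} stay vP (bl u v uP vP (≢-sym uv))))
        where
        stay : ∀ {s t} → s ∈ P → s ∈ ((P ∪ ⁅ c ⁆) - u) → t ∈ ((P ∪ ⁅ c ⁆) - u) → e E s t → t ∈ P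
        stay sP _ (inj₁ tP , _) st = tP
        stay sP _ (inj₂ refl , _) st = ⊥-elim (none (_ , sP , st))

      closed : Block → Closed
      closed bl with root bl
      ... | y , yP , yc = c , y , yc , adm-mono (λ _ → tt) (admissible-paths _ (≤-trans (s≤s z≤n) k≥2) inst ≤-refl)
        where
        P≢c : ∀ {v} → v ∈ P → v ≢ c
        P≢c vP refl = c∉P vP
        rooted : Rooted E (P ∪ ⁅ c ⁆) c y
        rooted w v (inj₂ refl) cw = inj₁ (here refl (inj₂ refl , cw))
        rooted w v (inj₁ vP) vw with has? P w
        ... | yes wP = inj₁ (bl w v wP vP vw)
        ... | no w∉ = inj₂ (walk-mono (λ t → inj₁ t , λ { refl → w∉ t }) (conn vP yP))
        inner : ∃ λ v → v ∈ (P ∪ ⁅ c ⁆) × v ≢ c × v ≢ y × v ≢ z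
        inner with some
        ... | v , vP , vz with v ≟ y
        ... | no vy = v , inj₁ vP , P≢c vP , vy , vz
        ... | yes refl with third z vP vz
        ... | t , tP , vt , tz = t , inj₁ tP , P≢c tP , ≢-sym (e-≢ E vt) , tz
        inst : Inst k
        inst = record { E = E ; U = P ∪ ⁅ c ⁆ ; x = c ; y = y ; z = z ; x∈U = inj₂ refl ; y∈U = inj₁ yP ; x≢y = ≢-sym (P≢c yP)
                      ; rooted = rooted
                      ; deg = λ { (inj₁ vP) _ _ vz → deg vP vz ; (inj₂ s) vc _ _ → ⊥-elim (vc s) }
                      ; inner = inner }

    comp-pairs : ∀ {A v₀ u v} → u ∈ comp E A v₀ → v ∈ comp E A v₀ → Walk (e E) (has (comp E A v₀)) u v
    comp-pairs {A} a b = walk-trans (walk-sym E (comp-conn E {A} a)) (comp-conn E {A} b)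

    -- While some vertex of P separates part of P from c, a smaller lobe is found behind it, or z is a pendant vertex that can be deleted.
    search : ∀ s (P : Sub) c z → Lobe P c z → # P < s → Closed
    search (suc s) P c z L lt with ∃? (λ u → ∃? (λ v → has? P u ×-dec (has? P v ×-dec (¬? (v ≟ u) ×-dec ¬? (walk? E ((P ∪ ⁅ c ⁆) - u) v c)))))
    ... | no none = Lobe.closed L λ u v uP vP vu → decidable-stable (walk? E ((P ∪ ⁅ c ⁆) - u) v c) λ n → none (u , v , uP , vP , vu , n)
    ... | yes (u , v₀ , uP , v₀P , v₀u , cut) = shrink (∃? (λ v → has? P₁ v ×-dec ¬? (v ≟ z)))
      where
      open Lobe L
      P₁ : Sub
      P₁ = comp E (P - u) v₀
      v₀∈ : v₀ ∈ P₁
      v₀∈ = here refl (v₀P , v₀u)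
      u∉ : u ∉ P₁
      u∉ q = proj₂ (walk-end q) refl
      P₁⊆ : P₁ ⊆ P
      P₁⊆ q = proj₁ (walk-end q)
      near : ∀ {v t} → v ∈ P₁ → e E v t → t ∈ (P ∪ ⁅ c ⁆) → t ∈ (P₁ ∪ ⁅ u ⁆)
      near {v} {t} vK vt tP with t ≟ u
      ... | yes q = inj₂ q
      near vK vt (inj₁ tP) | no n = inj₁ (comp-closed E {P - u} vK (tP , n) vt)
      near vK vt (inj₂ refl) | no n = ⊥-elim (cut (walk-trans (walk-mono (λ (a , b) → inj₁ a , b) vK)
        (walk-edge {A = has ((P ∪ ⁅ c ⁆) - u)} (inj₁ (P₁⊆ vK) , ∈≢ {P₁} vK u∉) (inj₂ refl , n) vt)))
      shrink : Dec (∃ λ v → v ∈ P₁ × v ≢ z) → Closed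
      shrink (yes some₁) = search s P₁ u z record
        { conn = comp-pairs {P - u}
        ; deg = λ {v} vK vz → ≤-trans (deg (P₁⊆ vK) vz) (#-mono {nb E v ∩ (P ∪ ⁅ c ⁆)} {nb E v ∩ (P₁ ∪ ⁅ u ⁆)} λ (vt , tP) → vt , near vK vt tP)
        ; c∉P = u∉ ; some = some₁ }
        (≤-trans (#-< {P₁} {P} P₁⊆ uP u∉) (s≤s⁻¹ lt))
      -- Behind u there is only z. Its deletion costs only u a neighbour, so u becomes the
      -- exceptional vertex and c stays.
      shrink (no none) = search s P₂ c u record
        { conn = comp-pairs {P - z}
        ; deg = λ {v} vK vu → ≤-trans (deg (P₂⊆ vK) (proj₂ (walk-end vK)))
                  (#-mono {nb E v ∩ (P ∪ ⁅ c ⁆)} {nb E v ∩ (P₂ ∪ ⁅ c ⁆)} λ (vt , tP) → vt , near₂ vK vu vt tP)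
        ; c∉P = λ q → c∉P (P₂⊆ q) ; some = some₂ }
        (≤-trans (#-< {P₂} {P} P₂⊆ zP λ q → proj₂ (walk-end q) refl) (s≤s⁻¹ lt))
        where
        is-z : ∀ {v} → v ∈ P₁ → v ≡ z
        is-z {v} vK = decidable-stable (v ≟ z) λ n → none (v , vK , n)
        z∈ : z ∈ P₁
        z∈ = subst (_∈ P₁) (is-z v₀∈) v₀∈
        zP : z ∈ P
        zP = P₁⊆ z∈
        uz : u ≢ z
        uz refl = u∉ z∈
        P₂ : Sub
        P₂ = comp E (P - z) u
        P₂⊆ : P₂ ⊆ P
        P₂⊆ q = proj₁ (walk-end q)
        near₂ : ∀ {v t} → v ∈ P₂ → v ≢ u → e E v t → t ∈ (P ∪ ⁅ c ⁆) → t ∈ (P₂ ∪ ⁅ c ⁆)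
        near₂ vK vu vt (inj₂ tc) = inj₂ tc
        near₂ {v} {t} vK vu vt (inj₁ tP) with t ≟ z
        ... | no n = inj₁ (comp-closed E {P - z} vK (tP , n) vt)
        ... | yes refl = ⊥-elim (Data.Sum.[ (λ q → proj₂ (walk-end vK) (is-z q)) , vu ]′ (near z∈ (e-sym E vt) (inj₁ (P₂⊆ vK))))
        some₂ : ∃ λ v → v ∈ P₂ × v ≢ u
        some₂ with third z uP uz
        ... | t , tP , ut , tz = t , walk-edge {A = has (P - z)} (uP , uz) (tP , tz) ut , ≢-sym (e-≢ E ut)

    -- One vertex of small degree becomes c, exempt as a root, the other becomes z. If there are
    -- fewer, a repetition or an arbitrary vertex fills the place. The order of the graph yields a
    -- vertex different from both.
    closed-paths : 3 ≤ # (sub everywhere λ _ → yes tt) → (Low : Sub) → # Low ≤ 2 → (∀ {v} → v ∉ Low → suc k ≤ # (nb E v)) → Closed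
    closed-paths order Low low≤2 deg = from-pair (pair (∃? (has? Low)))
      where
      All : Sub
      All = sub everywhere λ _ → yes tt
      pair : Dec (∃ λ v → v ∈ Low) → ∃ λ c → ∃ λ z → ∀ {v} → v ∈ Low → v ≡ c ⊎ v ≡ z
      pair (no none) = let (c , _) = #-elem {All} (≤-trans (s≤s z≤n) order) in c , c , λ a → ⊥-elim (none (_ , a))
      pair (yes (c , cL)) with ∃? (has? (Low - c))
      ... | no none = c , c , λ {v} a → inj₁ (decidable-stable (v ≟ c) λ n → none (v , a , n))
      ... | yes (z , zL , zc) = c , z , covered
        where
        covered : ∀ {v} → v ∈ Low → v ≡ c ⊎ v ≡ z
        covered {v} vL with v ≟ c | v ≟ z
        ... | yes q | _ = inj₁ q
        ... | no _ | yes q = inj₂ q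
        ... | no vc | no vz = ⊥-elim (<⇒≱ (≤-trans (s≤s (≤-trans (s≤s (#-pos {⁅ z ⁆} refl))
                (#-< {⁅ z ⁆} {⁅ z ⁆ ∪ ⁅ c ⁆} {c} inj₁ (inj₂ refl) (λ q → zc (≡-sym q)))))
                (#-< {⁅ z ⁆ ∪ ⁅ c ⁆} {Low} {v} (λ { (inj₁ refl) → zL ; (inj₂ refl) → cL }) vL Data.Sum.[ vz , vc ]′)) low≤2)
      from-pair : (∃ λ c → ∃ λ z → ∀ {v} → v ∈ Low → v ≡ c ⊎ v ≡ z) → Closed
      from-pair (c , z , cover) with #-> {All} {⁅ c ⁆ ∪ ⁅ z ⁆} (≤-trans (s≤s (#-two {⁅ c ⁆ ∪ ⁅ z ⁆} c z λ q → q)) order)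
      ... | v₀ , _ , n = search (suc (# P)) P c z record
        { conn = comp-pairs {All - c}
        ; deg = λ {v} vP vz → ≤-trans (deg λ a → Data.Sum.[ proj₂ (walk-end vP) , vz ]′ (cover a))
                  (#-mono {nb E v} {nb E v ∩ (P ∪ ⁅ c ⁆)} λ vt → vt , near vP vt)
        ; c∉P = λ q → proj₂ (walk-end q) refl
        ; some = v₀ , here refl (tt , λ q → n (inj₁ q)) , λ q → n (inj₂ q) } ≤-refl
        where
        P : Sub
        P = comp E (All - c) v₀
        near : ∀ {v t} → v ∈ P → e E v t → t ∈ (P ∪ ⁅ c ⁆)
        near {v} {t} vP vt with t ≟ c
        ... | yes q = inj₂ q
        ... | no q = inj₁ (comp-closed E {All - c} vP (tt , q) vt)

  -- Translation to the given graphs and cycles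

  count-filter : ∀ {A : Set} {m} {P : A → Set} (P? : ∀ a → Dec (P a)) (f : Fin m → A) →
                 length (filter P? (tabulate f)) ≡ count (λ i → P (f i)) (λ i → P? (f i))
  count-filter {m = zero} P? f = refl
  count-filter {m = suc m} P? f with P? (f fz)
  ... | yes _ = cong suc (count-filter P? (λ i → f (fs i)))
  ... | no _ = count-filter P? (λ i → f (fs i))

  relation : Rel
  relation = record
    { e = Adj Γ ; e? = λ u v → adj Γ u v Data.Bool.≟ true
    ; e-sym = λ {u} {v} uv → trans (Defs.sym Γ v u) uv
    ; e-irr = λ {v} vv → false≢true (trans (≡-sym (irrefl Γ v)) vv) }
    where
    false≢true : false ≡ true → ⊥
    false≢true ()

  at : ∀ {A u v m} → Path (Adj Γ) A u v m → Fin (suc m) → V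
  at {u = u} _ fz = u
  at (cons _ _ p) (fs i) = at p i

  at-in : ∀ {A u v m} (p : Path (Adj Γ) A u v m) i → A (at p i)
  at-in p fz = path-start p
  at-in (cons _ _ p) (fs i) = proj₁ (at-in p i)

  at-injective : ∀ {A u v m} (p : Path (Adj Γ) A u v m) i j → at p i ≡ at p j → i ≡ j
  at-injective p fz fz q = refl
  at-injective (cons _ _ p) fz (fs j) q = ⊥-elim (proj₂ (at-in p j) (≡-sym q))
  at-injective (cons _ _ p) (fs i) fz q = ⊥-elim (proj₂ (at-in p i) q)
  at-injective (cons _ _ p) (fs i) (fs j) q = cong fs (at-injective p i j q)

  at-consec : ∀ {A u v m} (p : Path (Adj Γ) A u v m) i j → suc (toℕ i) ≡ toℕ j → Adj Γ (at p i) (at p j)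
  at-consec (cons _ uw p) fz (fs fz) q = uw
  at-consec (cons _ _ p) (fs i) (fs j) q = at-consec p i j (suc-injective q)

  at-last : ∀ {A u v m} (p : Path (Adj Γ) A u v m) i → toℕ i ≡ m → at p i ≡ v
  at-last (nil q _) fz _ = q
  at-last (cons _ _ p) (fs i) q = at-last p i (suc-injective q)

  -- The closing edge adds 1 to every length, so the differences persist, and paths of length at
  -- least 2 give cycles of length at least 3.
  close : ∀ {A u v m} → 2 ≤ m → Adj Γ v u → Path (Adj Γ) A u v m → Cycle Γ
  close {u = u} {m = m} m≥2 vu p = record
    { len = suc m ; len≥3 = s≤s m≥2 ; vert = at p ; injective = at-injective p ; consec = at-consec p
    ; closing = λ { i fz q _ → subst (λ t → Adj Γ t u) (≡-sym (at-last p i (suc-injective q))) vu ; i (fs j) q () } }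

  admissible : ∀ {k} (k≥2 : 2 ≤ k) → Cycles.Closed relation k≥2 → ContainsAdmissible Γ k
  admissible {k} k≥2 (c , y , yc , adm base diff base≥ diff≡ paths) =
    (λ i → close (≤-trans base≥ (m≤m+n base (toℕ i * diff))) yc (paths (toℕ i) (FP.toℕ<n i))) ,
    (λ i _ → ≤-trans base≥ (≤-trans (m≤m+n base (toℕ i * diff)) (n≤1+n _))) ,
    Data.Sum.map grow grow diff≡
    where
    grow : ∀ {d} → diff ≡ d → ∀ (i j : Fin k) → suc (toℕ i) ≡ toℕ j → suc (base + toℕ j * diff) ≡ suc (base + toℕ i * diff) + d
    grow refl i j q rewrite ≡-sym q = cong suc (trans (cong (base +_) (+-comm diff _)) (≡-sym (+-assoc base _ diff)))

  admissible-cycles : ∀ {k} → 2 ≤ k → 3 ≤ n Γ → lowDegCount Γ (k + 1) ≤ 2 → ContainsAdmissible Γ k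
  admissible-cycles {k} k≥2 order low = admissible k≥2 (Cycles.closed-paths relation k≥2 order′ Low low′ high)
    where
    Low : Sub
    Low = sub (λ v → degree Γ v < k + 1) (λ v → Data.Nat._<?_ (degree Γ v) (k + 1))
    low′ : # Low ≤ 2
    low′ = ≤-trans (≤-reflexive (trans (#-unfold Low) (≡-sym (count-filter (λ v → Data.Nat._<?_ (degree Γ v) (k + 1)) (λ v → v))))) low
    high : ∀ {v} → v ∉ Low → suc k ≤ # (nb relation v)
    high {v} v∉ = ≤-trans (≤-trans (≤-reflexive (+-comm 1 k)) (≮⇒≥ v∉))
      (≤-reflexive (trans (count-filter (λ u → adj Γ v u Data.Bool.≟ true) (λ u → u)) (≡-sym (#-unfold (nb relation v)))))
    count-all : ∀ m → count {m} (λ _ → ⊤) (λ _ → yes tt) ≡ m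
    count-all zero = refl
    count-all (suc m) = cong suc (count-all m)
    order′ : 3 ≤ # (sub (λ _ → ⊤) λ _ → yes tt)
    order′ = ≤-trans order (≤-reflexive (≡-sym (trans (#-unfold (sub (λ _ → ⊤) λ _ → yes tt)) (count-all (n Γ)))))

theorem2 : (k : ℕ) → 2 ≤ k → (G : Graph) → 3 ≤ n G →
    lowDegCount G (k + 1) ≤ 2 → ContainsAdmissible G k
theorem2 k k≥2 G = InGraph.admissible-cycles G k≥2
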